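{- Let $\mathcal{G}$ be a (non-degenerate) $[n,k,d]_q$ A$^s$MDS code with $1<s<q-1$ and such that it is not the case that both $s+1$ and $q$ are powers of $2$. If $k>(s-1)(q+1)-1$ and $n>s(q+1)+k-3$, then the dual code $\mathcal{G}^\perp$ is an A$^s$MDS code, so $\mathcal{G}$ is an N$^s$MDS code.
   Context: A linear $[n,k,d]_q$ code is identified with a projective system: a finite multiset $\mathcal{G}$ of $n$ points (counted with multiplicity) of $\mathrm{PG}(k-1,q)$, not all lying in one hyperplane, with $n-d=\max_H|\mathcal{G}\cap H|$ over hyperplanes $H$ (counted with multiplicity); equivalently, the columns of a generator matrix of a non-degenerate linear code $C\subseteq\mathbb{F}_q^n$ of dimension $k$ and minimum distance $d$. The Singleton defect is $S(\mathcal{G})=n-k+1-d$; $\mathcal{G}$ is A$^s$MDS if $S(\mathcal{G})=s$. The dual code $\mathcal{G}^\perp$ is $C^\perp$, of length $n$ and dimension $n-k$. $\mathcal{G}$ is N$^s$MDS if both $\mathcal{G}$ and $\mathcal{G}^\perp$ are A$^s$MDS. -}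

module Defs where

open import Level using (_⊔_)
open import Algebra.Bundles using (CommutativeRing)
open import Data.Nat as ℕ using (ℕ; zero; suc; _^_; _≤_)
open import Data.Fin using (Fin; zero; suc)
open import Data.Fin.Properties using () renaming (_≟_ to _≟ᶠ_)
open import Data.Product using (Σ; ∃; _×_; _,_)
open import Relation.Nullary using (¬_; Dec; yes; no)
open import Relation.Binary.PropositionalEquality using (_≡_)

record IsFiniteField {c ℓ} (F : CommutativeRing c ℓ) (q : ℕ) : Set (c ⊔ ℓ) where
  open CommutativeRing F
  field
    0≉1         : ¬ (0# ≈ 1#)
    inverse     : ∀ x → ¬ (x ≈ 0#) → ∃ λ y → x * y ≈ 1#
    enum        : Fin q → Carrier
    index       : Carrier → Fin q
    enum-index  : ∀ x → enum (index x) ≈ x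
    index-enum  : ∀ i → index (enum i) ≡ i
    index-cong  : ∀ {x y} → x ≈ y → index x ≡ index y

IsPowerOf2 : ℕ → Set
IsPowerOf2 m = ∃ λ e → m ≡ 2 ^ e

module Codes {c ℓ} (F : CommutativeRing c ℓ) {q : ℕ} (FF : IsFiniteField F q) where
  open CommutativeRing F using (Carrier; _≈_; _+_; _*_; 0#; 1#; refl; sym; trans; reflexive)
  open IsFiniteField FF

  _≈?_ : (x y : Carrier) → Dec (x ≈ y)
  x ≈? y with index x ≟ᶠ index y
  ... | yes p = yes (trans (sym (enum-index x))
                    (trans (reflexive (Relation.Binary.PropositionalEquality.cong enum p))
                           (enum-index y)))
  ... | no ¬p = no (λ e → ¬p (index-cong e))

  Vector : ℕ → Set c
  Vector m = Fin m → Carrier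

  sumF : ∀ {m} → (Fin m → Carrier) → Carrier
  sumF {zero}  f = 0#
  sumF {suc m} f = f zero + sumF (λ i → f (suc i))

  IsZero : ∀ {m} → Vector m → Set ℓ
  IsZero v = ∀ j → v j ≈ 0#

  weight : ∀ {m} → Vector m → ℕ
  weight {zero}  v = 0
  weight {suc m} v with v zero ≈? 0#
  ... | yes _ = weight (λ j → v (suc j))
  ... | no  _ = suc (weight (λ j → v (suc j)))

  -- k × n generator matrix (rows = basis, columns = points of the projective system)
  Matrix : ℕ → ℕ → Set c
  Matrix k n = Fin k → Fin n → Carrier

  encode : ∀ {k n} → Matrix k n → Vector k → Vector n
  encode G x j = sumF (λ i → x i * G i j)

  Code : ∀ {k n} → Matrix k n → Vector n → Set (c ⊔ ℓ)
  Code G v = ∃ λ x → ∀ j → v j ≈ encode G x j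

  -- the dual code C^⊥ = { y | <c, y> = 0 for all c ∈ C }  (= { y | G yᵀ = 0 })
  DualCode : ∀ {k n} → Matrix k n → Vector n → Set ℓ
  DualCode G y = ∀ i → sumF (λ j → G i j * y j) ≈ 0#

  -- G generates a non-degenerate [n,k]_q code / projective system of n points
  -- in PG(k-1,q): rows linearly independent (dimension k, points span PG(k-1,q))
  -- and every column nonzero (each column is a projective point).
  IsProjectiveSystem : ∀ {k n} → Matrix k n → Set (c ⊔ ℓ)
  IsProjectiveSystem {k} {n} G =
    (∀ x → IsZero (encode G x) → IsZero x) × (∀ j → ¬ IsZero (λ i → G i j))

  HasMinDist : ∀ {n} {a} → (Vector n → Set a) → ℕ → Set (c ⊔ ℓ ⊔ a)
  HasMinDist P d =
    (∃ λ v → P v × ¬ IsZero v × weight v ≡ d)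
    × (∀ v → P v → ¬ IsZero v → d ≤ weight v)

  -- Singleton defect of an [len, dim, d] code equals s, i.e. len - dim + 1 - d = s
  -- (written without truncated subtraction; len ≥ dim, and len-dim+1 ≥ d by Singleton)
  IsAsMDS : (len dim d s : ℕ) → Set
  IsAsMDS len dim d s = len ℕ.+ 1 ≡ dim ℕ.+ d ℕ.+ s

  AsMDS : ∀ {k n} → Matrix k n → ℕ → Set (c ⊔ ℓ)
  AsMDS {k} {n} G s = ∃ λ d → HasMinDist (Code G) d × IsAsMDS n k d s

  DualAsMDS : ∀ {k n} → Matrix k n → ℕ → Set (c ⊔ ℓ)
  DualAsMDS {k} {n} G s = ∃ λ d → HasMinDist (DualCode G) d × IsAsMDS n (n ℕ.∸ k) d s

  NsMDS : ∀ {k n} → Matrix k n → ℕ → Set (c ⊔ ℓ)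
  NsMDS G s = AsMDS G s × DualAsMDS G s

{-# OPTIONS --safe #-}

-- Write N = s + 1. A dual word of weight t ≤ k - s is a relation between t columns; adding columns up to k - 2
-- and projecting from their span (of vector dimension k - 3) gives at least s(q+1) points of PG(2,q) with at
-- most N on a line. Counting along pencils, there are at most s(q+1) + 1 of them. If there are only s(q+1), each
-- point lies on exactly one s-secant and these s-secants are concurrent, so one point can be added. A set of
-- s(q+1) + 1 points is a maximal arc: every line meets it in 0 or N points, whence N divides q, and for odd q
-- this is excluded by the argument of Ball and Blokhuis: identify AG(2,q) with GF(q²), let b run over the arc,
-- put B(Z) = ∏(Z - b) and let e(Z) be the coefficient of T^N in ∏(1 - (Z - b)^(q-1) T). Comparing, at each z
-- outside the arc, logarithmic derivatives with the product over the external directions shows (B e)′(z) = 0;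
-- by degree B e has zero derivative, so it is a polynomial in Z^p, of degree too small for its roots.
-- Hence dual words have weight at least k + 1 - s. Conversely, k + 1 columns in a hyperplane containing the
-- maximal number k - 1 + s of columns satisfy two independent relations, and since k + 1 > (s-1)(q+1) one of
-- the q + 1 combinations of these has at least s zeros.

module Submission where

open import Defs
open import Level using (Level; _⊔_)
open import Algebra.Bundles using (CommutativeRing; CommutativeMonoid)
import Algebra.Properties.CommutativeMonoid.Sum as Sum
import Algebra.Properties.CommutativeSemiring.Binomial as Binomial
import Algebra.Solver.Ring
open import Algebra.Solver.Ring.AlmostCommutativeRing using (fromCommutativeRing; _-Raw-AlmostCommutative⟶_)
open import Data.Empty using (⊥)
open import Data.Fin as Fin using (Fin; zero; suc; toℕ; fromℕ; inject₁; punchIn; punchOut; combine; remQuot; finToFun; funToFin; splitAt; _↑ˡ_; _↑ʳ_)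
open import Data.Fin.Permutation using (Permutation; permutation)
open import Data.Fin.Properties using (any?; all?; ¬∀⟶∃¬; cast-is-id; combine-remQuot; finToFun-funToFin; funToFin-finToFin; inject≤-injective; inject₁-injective; injective⇒≤; pigeonhole; punchIn-punchOut; punchInᵢ≢i; remQuot-combine; splitAt-↑ʳ; splitAt-↑ˡ; suc-injective; toℕ-fromℕ; toℕ-inject₁; toℕ<n) renaming (_≟_ to _≟ᶠ_; <⇒≢ to <⇒≢ᶠ)
open import Data.Integer as ℤ using (ℤ; +_; -[1+_])
import Data.Integer.Properties as ℤ
open import Data.List using ([]; _∷_)
open import Data.List.Relation.Unary.All using (All; []; _∷_)
open import Data.Maybe using (Maybe; just; nothing)
open import Data.Nat as ℕ using (ℕ; zero; suc; z≤n; s≤s)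
open import Data.Nat.Combinatorics using (_C_; nCn≡1; nC1≡n; nCk+nC[k+1]≡[n+1]C[k+1])
open import Data.Nat.Coprimality using (Coprime; coprime-divisor; coprime-Bézout)
open import Data.Nat.Divisibility using (_∣_; divides; quotient; _∣?_; _∣0; ∣-refl; ∣-trans; ∣⇒≤; ∣1⇒≡1; m∣m*n; n∣m*n; *-cancelˡ-∣; ∣m∣n⇒∣m+n; ∣m+n∣m⇒∣n)
open import Data.Nat.GCD using (module Bézout)
open import Data.Nat.ListAction using (product)
open import Data.Nat.Primality using (Prime; euclidsLemma; prime⇒irreducible; prime⇒nonZero; prime⇒nonTrivial)
open import Data.Nat.Primality.Factorisation using (factorise; PrimeFactorisation)
import Data.Nat.Properties as ℕ
open import Data.Nat.Tactic.RingSolver using (solve-∀)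
open import Data.Product using (∃; _×_; _,_; proj₁; proj₂)
import Data.Sign as Sign
open import Data.Sum using (_⊎_; inj₁; inj₂; [_,_]′)
open import Function using (_∘_; id; case_of_)
open import Relation.Binary.PropositionalEquality as ≡ using (_≡_)
open import Relation.Nullary using (¬_; Dec; yes; no; contradiction)
open import Relation.Nullary.Decidable using (¬?; _×-dec_)

-- Ring solving with integer coefficients

-- In the plane modules `n′` is s, `n` is s + 1 and `N` is the number of points. The exclusion of
-- powers of 2 enters through one inequality. B e has degree at most 2nq - q; as a nonzero
-- polynomial in Z^p vanishing at N = nq - q + n points it would need degree at least pN. For p ≥ 3
-- this is impossible. For p = 2 there is no contradiction: n divides q and n < q, so q ≥ 2n, which
-- says exactly 2N ≤ 2nq - q; and maximal arcs do exist in even planes. That B e is not zero is read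
-- off its leading coefficient (-N/n)^n, since N/n = q + 1 - q/n is 1 modulo p. The completion of
-- s(q+1) points is a count in the dual plane. The s-secants are listed once for each of their
-- points. Every point of the plane lies on at least s entries of this list, which first requires
-- that n does not divide q + 1, and along an n-secant the average is exactly s. A point where two
-- s-secants meet has at least 2s entries, so no n-secant passes through it and it can be added.

module IntegerSolver {c ℓ} (R : CommutativeRing c ℓ) where
  open CommutativeRing R
  open import Algebra.Properties.Ring ring
  open import Algebra.Properties.AbelianGroup +-abelianGroup using (⁻¹-∙-comm)
  open import Algebra.Properties.Group +-group using (ε⁻¹≈ε)
  open import Algebra.Properties.Semiring.Mult.TCOptimised semiring renaming (_×_ to _·_)
  open import Relation.Binary.Reasoning.Setoid setoid

  fromℤ : ℤ → Carrier
  fromℤ (+ n)    = n · 1#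
  fromℤ -[1+ n ] = - (suc n · 1#)

  fromℤ-⊖ : ∀ m n → fromℤ (m ℤ.⊖ n) ≈ m · 1# - n · 1#
  fromℤ-⊖ zero    zero    = sym (trans (+-identityˡ _) ε⁻¹≈ε)
  fromℤ-⊖ zero    (suc n) = sym (+-identityˡ _)
  fromℤ-⊖ (suc m) zero    = sym (trans (+-congˡ ε⁻¹≈ε) (+-identityʳ _))
  fromℤ-⊖ (suc m) (suc n) = begin
    fromℤ (suc m ℤ.⊖ suc n)               ≡⟨ ≡.cong fromℤ (ℤ.[1+m]⊖[1+n]≡m⊖n m n) ⟩
    fromℤ (m ℤ.⊖ n)                       ≈⟨ fromℤ-⊖ m n ⟩
    m · 1# - n · 1#                       ≈⟨ +-congʳ (+-identityˡ _) ⟨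
    (0# + m · 1#) - n · 1#                ≈⟨ +-congʳ (+-congʳ (-‿inverseʳ 1#)) ⟨
    ((1# - 1#) + m · 1#) - n · 1#         ≈⟨ +-congʳ (trans (+-assoc _ _ _) (trans (+-congˡ (+-comm _ _)) (sym (+-assoc _ _ _)))) ⟩
    ((1# + m · 1#) - 1#) - n · 1#         ≈⟨ +-assoc _ _ _ ⟩
    (1# + m · 1#) + (- 1# - n · 1#)       ≈⟨ +-congˡ (⁻¹-∙-comm _ _) ⟩
    (1# + m · 1#) - (1# + n · 1#)         ≈⟨ +-cong (1+× m 1#) (-‿cong (1+× n 1#)) ⟨
    suc m · 1# - suc n · 1#               ∎

  fromℤ-+ : ∀ x y → fromℤ (x ℤ.+ y) ≈ fromℤ x + fromℤ y
  fromℤ-+ (+ m)    (+ n)    = ×-homo-+ 1# m n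
  fromℤ-+ (+ m)    -[1+ n ] = fromℤ-⊖ m (suc n)
  fromℤ-+ -[1+ m ] (+ n)    = trans (fromℤ-⊖ n (suc m)) (+-comm _ _)
  fromℤ-+ -[1+ m ] -[1+ n ] = begin
    - (suc (suc (m ℕ.+ n)) · 1#)     ≡⟨ ≡.cong (λ k → - (suc k · 1#)) (≡.sym (ℕ.+-suc m n)) ⟩
    - ((suc m ℕ.+ suc n) · 1#)       ≈⟨ -‿cong (×-homo-+ 1# (suc m) (suc n)) ⟩
    - (suc m · 1# + suc n · 1#)      ≈⟨ ⁻¹-∙-comm _ _ ⟨
    - (suc m · 1#) - suc n · 1#      ∎

  fromℤ-neg : ∀ x → fromℤ (ℤ.- x) ≈ - fromℤ x
  fromℤ-neg (+ zero)  = sym ε⁻¹≈ε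
  fromℤ-neg (+ suc n) = refl
  fromℤ-neg -[1+ n ]  = sym (-‿involutive _)

  fromℤ-◃⁺ : ∀ n → fromℤ (Sign.+ ℤ.◃ n) ≈ n · 1#
  fromℤ-◃⁺ zero    = refl
  fromℤ-◃⁺ (suc n) = refl

  fromℤ-◃⁻ : ∀ n → fromℤ (Sign.- ℤ.◃ n) ≈ - (n · 1#)
  fromℤ-◃⁻ zero    = sym ε⁻¹≈ε
  fromℤ-◃⁻ (suc n) = refl

  fromℤ-* : ∀ x y → fromℤ (x ℤ.* y) ≈ fromℤ x * fromℤ y
  fromℤ-* (+ m)    (+ n)    = trans (fromℤ-◃⁺ (m ℕ.* n)) (×1-homo-* m n)
  fromℤ-* (+ m)    -[1+ n ] = trans (fromℤ-◃⁻ (m ℕ.* suc n)) (trans (-‿cong (×1-homo-* m (suc n))) (-‿distribʳ-* _ _))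
  fromℤ-* -[1+ m ] (+ n)    = trans (fromℤ-◃⁻ (suc m ℕ.* n)) (trans (-‿cong (×1-homo-* (suc m) n)) (-‿distribˡ-* _ _))
  fromℤ-* -[1+ m ] -[1+ n ] = trans (fromℤ-◃⁺ (suc m ℕ.* suc n)) (trans (×1-homo-* (suc m) (suc n)) (sym (begin
    - (suc m · 1#) * - (suc n · 1#)     ≈⟨ -‿distribˡ-* _ _ ⟨
    - (suc m · 1# * - (suc n · 1#))     ≈⟨ -‿cong (-‿distribʳ-* _ _) ⟨
    - - (suc m · 1# * (suc n · 1#))     ≈⟨ -‿involutive _ ⟩
    suc m · 1# * (suc n · 1#)           ∎)))

  fromℤ-morphism : ℤ.+-*-rawRing -Raw-AlmostCommutative⟶ fromCommutativeRing R
  fromℤ-morphism = record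
    { ⟦_⟧    = fromℤ
    ; +-homo = fromℤ-+
    ; *-homo = fromℤ-*
    ; -‿homo = fromℤ-neg
    ; 0-homo = refl
    ; 1-homo = refl
    }

  -- Only a sound test is required: distinct integers may have the same image in positive
  -- characteristic, so nothing is claimed about them.
  fromℤ-≟ : ∀ x y → Maybe (fromℤ x ≈ fromℤ y)
  fromℤ-≟ x y with x ℤ.≟ y
  ... | yes p = just (reflexive (≡.cong fromℤ p))
  ... | no _  = nothing

  open Algebra.Solver.Ring ℤ.+-*-rawRing (fromCommutativeRing R) fromℤ-morphism fromℤ-≟ public
    using (solve; _:=_; _:+_; _:*_; _:-_; :-_; _:^_; con)

-- Power series, polynomials and quadratic extensions

module PowerSeries {c ℓ} (R : CommutativeRing c ℓ) where
  open CommutativeRing R hiding (zero)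
  open IntegerSolver R
  open import Relation.Binary.Reasoning.Setoid setoid

  -- Polynomials are represented as series too, with a separate degree bound `Deg≤`. No normal form
  -- is needed and equality stays coefficientwise.
  Series : Set c
  Series = ℕ → Carrier

  infix 4 _≋_
  _≋_ : Series → Series → Set ℓ
  f ≋ g = ∀ k → f k ≈ g k

  tail : Series → Series
  tail f k = f (suc k)

  infixl 7 _⊛_
  -- The Cauchy product, by recursion on the index from f = f 0 + X · `tail f`; no sum over pairs of
  -- indices appears.
  _⊛_ : Series → Series → Series
  (f ⊛ g) zero    = f 0 * g 0
  (f ⊛ g) (suc k) = f 0 * g (suc k) + (tail f ⊛ g) k

  infixr 7 _•_
  _•_ : Carrier → Series → Series
  (a • f) k = a * f k

  infixl 6 _⊞_
  _⊞_ : Series → Series → Series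
  (f ⊞ g) k = f k + g k

  const : Carrier → Series
  const a zero    = a
  const a (suc k) = 0#

  ⊛-cong : ∀ {f f′ g g′} → f ≋ f′ → g ≋ g′ → f ⊛ g ≋ f′ ⊛ g′
  ⊛-cong p r zero    = *-cong (p 0) (r 0)
  ⊛-cong p r (suc k) = +-cong (*-cong (p 0) (r (suc k))) (⊛-cong (p ∘ suc) r k)

  ⊛-distribʳ : ∀ h f g → (f ⊞ g) ⊛ h ≋ (f ⊛ h) ⊞ (g ⊛ h)
  ⊛-distribʳ h f g zero    = distribʳ _ _ _
  ⊛-distribʳ h f g (suc k) = begin
    (f 0 + g 0) * h (suc k) + ((tail f ⊞ tail g) ⊛ h) k
      ≈⟨ +-congˡ (⊛-distribʳ h (tail f) (tail g) k) ⟩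
    (f 0 + g 0) * h (suc k) + ((tail f ⊛ h) k + (tail g ⊛ h) k)
      ≈⟨ solve 5 (λ a b c d e → (a :+ b) :* c :+ (d :+ e) := (a :* c :+ d) :+ (b :* c :+ e)) refl _ _ _ _ _ ⟩
    (f 0 * h (suc k) + (tail f ⊛ h) k) + (g 0 * h (suc k) + (tail g ⊛ h) k) ∎

  •-⊛ : ∀ a f g → (a • f) ⊛ g ≋ a • (f ⊛ g)
  •-⊛ a f g zero    = *-assoc _ _ _
  •-⊛ a f g (suc k) = trans (+-cong (*-assoc _ _ _) (•-⊛ a (tail f) g k)) (sym (distribˡ _ _ _))

  -- The definition peels the left factor; commutativity needs this mirror recursion, which peels
  -- the right one.
  ⊛-sucʳ : ∀ f g k → (f ⊛ g) (suc k) ≈ (f ⊛ tail g) k + f (suc k) * g 0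
  ⊛-sucʳ f g zero    = refl
  ⊛-sucʳ f g (suc k) = trans (+-congˡ (⊛-sucʳ (tail f) g k)) (sym (+-assoc _ _ _))

  ⊛-comm : ∀ f g → f ⊛ g ≋ g ⊛ f
  ⊛-comm f g zero    = *-comm _ _
  ⊛-comm f g (suc k) = begin
    f 0 * g (suc k) + (tail f ⊛ g) k   ≈⟨ +-cong (*-comm _ _) (⊛-comm (tail f) g k) ⟩
    g (suc k) * f 0 + (g ⊛ tail f) k   ≈⟨ +-comm _ _ ⟩
    (g ⊛ tail f) k + g (suc k) * f 0   ≈⟨ ⊛-sucʳ g f k ⟨
    (g ⊛ f) (suc k)                    ∎

  ⊛-assoc : ∀ f g h → (f ⊛ g) ⊛ h ≋ f ⊛ (g ⊛ h)
  ⊛-assoc f g h zero    = *-assoc _ _ _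
  ⊛-assoc f g h (suc k) = begin
    f 0 * g 0 * h (suc k) + (((f 0 • tail g) ⊞ (tail f ⊛ g)) ⊛ h) k
      ≈⟨ +-congˡ (trans (⊛-distribʳ h (f 0 • tail g) (tail f ⊛ g) k)
                        (+-cong (•-⊛ (f 0) (tail g) h k) (⊛-assoc (tail f) g h k))) ⟩
    f 0 * g 0 * h (suc k) + (f 0 * (tail g ⊛ h) k + (tail f ⊛ (g ⊛ h)) k)
      ≈⟨ solve 5 (λ a b c d e → a :* b :* c :+ (a :* d :+ e) := a :* (b :* c :+ d) :+ e) refl _ _ _ _ _ ⟩
    f 0 * (g 0 * h (suc k) + (tail g ⊛ h) k) + (tail f ⊛ (g ⊛ h)) k ∎

  0⊛ : ∀ f k → ((λ _ → 0#) ⊛ f) k ≈ 0#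
  0⊛ f zero    = zeroˡ _
  0⊛ f (suc k) = trans (+-cong (zeroˡ _) (0⊛ f k)) (+-identityˡ _)

  const-⊛ : ∀ a f → const a ⊛ f ≋ a • f
  const-⊛ a f zero    = refl
  const-⊛ a f (suc k) = trans (+-congˡ (0⊛ f k)) (+-identityʳ _)

  1⊛ : ∀ f → const 1# ⊛ f ≋ f
  1⊛ f k = trans (const-⊛ 1# f k) (*-identityˡ _)

  -- As a ring, series can serve as coefficients again: powers, the Frobenius map and symmetric
  -- functions are later taken over it.
  seriesRing : CommutativeRing c ℓ
  seriesRing = record
    { Carrier = Series ; _≈_ = _≋_ ; _+_ = _⊞_ ; _*_ = _⊛_
    ; -_ = λ f k → - f k ; 0# = λ _ → 0# ; 1# = const 1#
    ; isCommutativeRing = record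
      { isRing = record
        { +-isAbelianGroup = record
          { isGroup = record
            { isMonoid = record
              { isSemigroup = record
                { isMagma = record
                  { isEquivalence = record
                    { refl = λ _ → refl ; sym = λ p k → sym (p k) ; trans = λ p r k → trans (p k) (r k) }
                  ; ∙-cong = λ p r k → +-cong (p k) (r k) }
                ; assoc = λ f g h k → +-assoc _ _ _ }
              ; identity = (λ f k → +-identityˡ _) , (λ f k → +-identityʳ _) }
            ; inverse = (λ f k → -‿inverseˡ _) , (λ f k → -‿inverseʳ _)
            ; ⁻¹-cong = λ p k → -‿cong (p k) }
          ; comm = λ f g k → +-comm _ _ }
        ; *-cong = λ {f} {f′} {g} {g′} → ⊛-cong {f} {f′} {g} {g′}
        ; *-assoc = ⊛-assoc
        ; *-identity = 1⊛ , (λ f k → trans (⊛-comm f (const 1#) k) (1⊛ f k))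
        ; distrib = (λ h f g k → trans (⊛-comm h (f ⊞ g) k)
                        (trans (⊛-distribʳ h f g k) (+-cong (⊛-comm f h k) (⊛-comm g h k)))) , ⊛-distribʳ
        }
      ; *-comm = ⊛-comm } }

  shift : Series → Series
  shift f zero    = 0#
  shift f (suc k) = f k

  shift-⊛ : ∀ f g → shift f ⊛ g ≋ shift (f ⊛ g)
  shift-⊛ f g zero    = zeroˡ _
  shift-⊛ f g (suc k) = trans (+-congʳ (zeroˡ _)) (+-identityˡ _)

module Quadratic {c ℓ} (R : CommutativeRing c ℓ) (δ : CommutativeRing.Carrier R) where
  open CommutativeRing R hiding (zero)
  open IntegerSolver R

  -- This is R[X]/(X² - δ). A nonsquare δ yields the field of order q², and δ = 0 yields the dual
  -- numbers.
  quadraticRing : CommutativeRing c ℓ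
  quadraticRing = record
    { Carrier = Carrier × Carrier
    ; _≈_ = λ x y → (proj₁ x ≈ proj₁ y) × (proj₂ x ≈ proj₂ y)
    ; _+_ = λ x y → (proj₁ x + proj₁ y) , (proj₂ x + proj₂ y)
    ; _*_ = λ x y → (proj₁ x * proj₁ y + δ * (proj₂ x * proj₂ y)) , (proj₁ x * proj₂ y + proj₂ x * proj₁ y)
    ; -_ = λ x → (- proj₁ x) , (- proj₂ x) ; 0# = 0# , 0# ; 1# = 1# , 0#
    ; isCommutativeRing = record
      { isRing = record
        { +-isAbelianGroup = record
          { isGroup = record
            { isMonoid = record
              { isSemigroup = record
                { isMagma = record
                  { isEquivalence = record
                    { refl = refl , refl ; sym = λ p → sym (proj₁ p) , sym (proj₂ p)
                    ; trans = λ p r → trans (proj₁ p) (proj₁ r) , trans (proj₂ p) (proj₂ r) }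
                  ; ∙-cong = λ p r → +-cong (proj₁ p) (proj₁ r) , +-cong (proj₂ p) (proj₂ r) }
                ; assoc = λ _ _ _ → +-assoc _ _ _ , +-assoc _ _ _ }
              ; identity = (λ _ → +-identityˡ _ , +-identityˡ _) , (λ _ → +-identityʳ _ , +-identityʳ _) }
            ; inverse = (λ _ → -‿inverseˡ _ , -‿inverseˡ _) , (λ _ → -‿inverseʳ _ , -‿inverseʳ _)
            ; ⁻¹-cong = λ p → -‿cong (proj₁ p) , -‿cong (proj₂ p) }
          ; comm = λ _ _ → +-comm _ _ , +-comm _ _ }
        ; *-cong = λ p r → +-cong (*-cong (proj₁ p) (proj₁ r)) (*-congˡ (*-cong (proj₂ p) (proj₂ r)))
                         , +-cong (*-cong (proj₁ p) (proj₂ r)) (*-cong (proj₂ p) (proj₁ r))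
        ; *-assoc = λ (a , b) (c , d) (e , f) →
            solve 7 (λ a b c d e f δ → (a :* c :+ δ :* (b :* d)) :* e :+ δ :* ((a :* d :+ b :* c) :* f)
                       := a :* (c :* e :+ δ :* (d :* f)) :+ δ :* (b :* (c :* f :+ d :* e))) refl a b c d e f δ ,
            solve 7 (λ a b c d e f δ → (a :* c :+ δ :* (b :* d)) :* f :+ (a :* d :+ b :* c) :* e
                       := a :* (c :* f :+ d :* e) :+ b :* (c :* e :+ δ :* (d :* f))) refl a b c d e f δ
        ; *-identity = (λ (a , b) → solve 3 (λ a b δ → con (+ 1) :* a :+ δ :* (con (+ 0) :* b) := a) refl a b δ ,
                                    solve 2 (λ a b → con (+ 1) :* b :+ con (+ 0) :* a := b) refl a b) ,
                       (λ (a , b) → solve 3 (λ a b δ → a :* con (+ 1) :+ δ :* (b :* con (+ 0)) := a) refl a b δ ,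
                                    solve 2 (λ a b → a :* con (+ 0) :+ b :* con (+ 1) := b) refl a b)
        ; distrib =
            (λ (a , b) (c , d) (e , f) →
              solve 7 (λ a b c d e f δ → a :* (c :+ e) :+ δ :* (b :* (d :+ f))
                        := (a :* c :+ δ :* (b :* d)) :+ (a :* e :+ δ :* (b :* f))) refl a b c d e f δ ,
              solve 6 (λ a b c d e f → a :* (d :+ f) :+ b :* (c :+ e)
                        := (a :* d :+ b :* c) :+ (a :* f :+ b :* e)) refl a b c d e f) ,
            (λ (a , b) (c , d) (e , f) →
              solve 7 (λ a b c d e f δ → (c :+ e) :* a :+ δ :* ((d :+ f) :* b)
                        := (c :* a :+ δ :* (d :* b)) :+ (e :* a :+ δ :* (f :* b))) refl a b c d e f δ ,
              solve 6 (λ a b c d e f → (c :+ e) :* b :+ (d :+ f) :* a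
                        := (c :* b :+ d :* a) :+ (e :* b :+ f :* a)) refl a b c d e f)
        }
      ; *-comm = λ (a , b) (c , d) →
          solve 5 (λ a b c d δ → a :* c :+ δ :* (b :* d) := c :* a :+ δ :* (d :* b)) refl a b c d δ ,
          solve 4 (λ a b c d → a :* d :+ b :* c := c :* b :+ d :* a) refl a b c d } }

-- Polynomials over R are evaluated in an R-algebra A: A = R gives values, the dual numbers give
-- values together with derivatives.
record RingMap {c ℓ} (R A : CommutativeRing c ℓ) : Set (c ⊔ ℓ) where
  private
    module R = CommutativeRing R
    module A = CommutativeRing A
  field
    ⟦_⟧    : R.Carrier → A.Carrier
    ⟦⟧-cong : ∀ {x y} → x R.≈ y → ⟦ x ⟧ A.≈ ⟦ y ⟧
    +-homo : ∀ x y → ⟦ x R.+ y ⟧ A.≈ ⟦ x ⟧ A.+ ⟦ y ⟧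
    *-homo : ∀ x y → ⟦ x R.* y ⟧ A.≈ ⟦ x ⟧ A.* ⟦ y ⟧
    0-homo : ⟦ R.0# ⟧ A.≈ A.0#
    1-homo : ⟦ R.1# ⟧ A.≈ A.1#

idMap : ∀ {c ℓ} (R : CommutativeRing c ℓ) → RingMap R R
idMap R = record
  { ⟦_⟧ = id ; ⟦⟧-cong = id ; +-homo = λ _ _ → refl ; *-homo = λ _ _ → refl ; 0-homo = refl ; 1-homo = refl }
  where open CommutativeRing R

module Degree {c ℓ} (R : CommutativeRing c ℓ) where
  open CommutativeRing R hiding (zero)
  open PowerSeries R

  Deg≤ : ℕ → Series → Set ℓ
  Deg≤ d f = ∀ k → d ℕ.< k → f k ≈ 0#

  Deg≤-⊛ : ∀ {d e f g} → Deg≤ d f → Deg≤ e g → Deg≤ (d ℕ.+ e) (f ⊛ g)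
  Deg≤-⊛ {zero} {e} {f} {g} df dg zero ()
  Deg≤-⊛ {zero} {e} {f} {g} df dg (suc k) e<k =
    trans (+-cong (trans (*-congˡ (dg (suc k) e<k)) (zeroʳ _))
                  (trans (⊛-cong {f = tail f} (λ i → df (suc i) (s≤s z≤n)) (λ _ → refl) k) (0⊛ g k)))
          (+-identityˡ _)
  Deg≤-⊛ {suc d} {e} {f} {g} df dg (suc k) (s≤s d+e<k) =
    trans (+-cong (trans (*-congˡ (dg (suc k) (s≤s (ℕ.≤-trans (ℕ.m≤n+m e d) (ℕ.<⇒≤ d+e<k))))) (zeroʳ _))
                  (Deg≤-⊛ {d} {e} {tail f} {g} (λ i d<i → df (suc i) (s≤s d<i)) dg k d+e<k))
          (+-identityˡ _)

  ⊛-lead : ∀ {d e f g} → Deg≤ d f → Deg≤ e g → (f ⊛ g) (d ℕ.+ e) ≈ f d * g e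
  ⊛-lead {zero} {zero} {f} {g} df dg = refl
  ⊛-lead {zero} {suc e} {f} {g} df dg =
    trans (+-congˡ (trans (⊛-cong {f = tail f} (λ i → df (suc i) (s≤s z≤n)) (λ _ → refl) e) (0⊛ g e))) (+-identityʳ _)
  ⊛-lead {suc d} {e} {f} {g} df dg =
    trans (+-congʳ (trans (*-congˡ (dg (suc (d ℕ.+ e)) (s≤s (ℕ.m≤n+m e d)))) (zeroʳ _)))
      (trans (+-identityˡ _) (⊛-lead {d} {e} {tail f} {g} (λ i d<i → df (suc i) (s≤s d<i)) dg))

  Deg≤-⊞ : ∀ {d f g} → Deg≤ d f → Deg≤ d g → Deg≤ d (f ⊞ g)
  Deg≤-⊞ df dg k d<k = trans (+-cong (df k d<k) (dg k d<k)) (+-identityˡ _)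

  linear : Carrier → Series
  linear a zero          = a
  linear a (suc zero)    = 1#
  linear a (suc (suc k)) = 0#

  Deg≤-linear : ∀ a → Deg≤ 1 (linear a)
  Deg≤-linear a (suc zero)    (s≤s ())
  Deg≤-linear a (suc (suc k)) _ = refl

  open import Algebra.Properties.Semiring.Exp semiring using (_^_)
  open import Algebra.Properties.Semiring.Exp (CommutativeRing.semiring seriesRing) using () renaming (_^_ to _^ˢ_)

  Deg≤-^ : ∀ {d f} m → Deg≤ d f → Deg≤ (m ℕ.* d) (f ^ˢ m)
  Deg≤-^ zero    df (suc k) _ = refl
  Deg≤-^ (suc m) df           = Deg≤-⊛ df (Deg≤-^ m df)

  ^-lead : ∀ {d f} m → Deg≤ d f → (f ^ˢ m) (m ℕ.* d) ≈ f d ^ m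
  ^-lead zero    df = refl
  ^-lead (suc m) df = trans (⊛-lead df (Deg≤-^ m df)) (*-congˡ (^-lead m df))

module Evaluation {c ℓ} {R A : CommutativeRing c ℓ} (ι : RingMap R A) where
  private module R = CommutativeRing R
  open CommutativeRing A hiding (zero)
  open RingMap ι
  open PowerSeries R
  open Degree R
  open IntegerSolver A
  open import Relation.Binary.Reasoning.Setoid setoid

  -- A bare series has no value at a point, so the degree at which Horner's scheme stops is an
  -- argument. It is harmless only with a matching `Deg≤`.
  ev : ℕ → Series → Carrier → Carrier
  ev zero    f y = ⟦ f 0 ⟧
  ev (suc d) f y = ⟦ f 0 ⟧ + y * ev d (tail f) y

  ev-cong : ∀ d {f g} y → f ≋ g → ev d f y ≈ ev d g y
  ev-cong zero    y p = ⟦⟧-cong (p 0)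
  ev-cong (suc d) y p = +-cong (⟦⟧-cong (p 0)) (*-congˡ (ev-cong d y (p ∘ suc)))

  ev-zero : ∀ d {f} y → (∀ k → k ℕ.≤ d → f k R.≈ R.0#) → ev d f y ≈ 0#
  ev-zero zero    y p = trans (⟦⟧-cong (p 0 z≤n)) 0-homo
  ev-zero (suc d) y p = trans (+-cong (trans (⟦⟧-cong (p 0 z≤n)) 0-homo) (*-congˡ (ev-zero d y (λ k k≤d → p (suc k) (s≤s k≤d)))))
                              (trans (+-identityˡ _) (zeroʳ _))

  ev-⊞ : ∀ d f g y → ev d (f ⊞ g) y ≈ ev d f y + ev d g y
  ev-⊞ zero    f g y = +-homo _ _
  ev-⊞ (suc d) f g y = trans (+-cong (+-homo _ _) (*-congˡ (ev-⊞ d (tail f) (tail g) y)))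
    (solve 5 (λ a b y c d → (a :+ b) :+ y :* (c :+ d) := (a :+ y :* c) :+ (b :+ y :* d)) refl _ _ _ _ _)

  ev-• : ∀ d a f y → ev d (a • f) y ≈ ⟦ a ⟧ * ev d f y
  ev-• zero    a f y = *-homo _ _
  ev-• (suc d) a f y = trans (+-cong (*-homo _ _) (*-congˡ (ev-• d a (tail f) y)))
    (solve 4 (λ a b y c → a :* b :+ y :* (a :* c) := a :* (b :+ y :* c)) refl _ _ _ _)

  ev-mono : ∀ {d e} f y → e ℕ.≤ d → Deg≤ e f → ev d f y ≈ ev e f y
  ev-mono {zero}  f y z≤n       df = refl
  ev-mono {suc d} f y z≤n       df =
    trans (+-congˡ (trans (*-congˡ (ev-zero d y (λ k _ → df (suc k) (s≤s z≤n)))) (zeroʳ _))) (+-identityʳ _)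
  ev-mono {suc d} f y (s≤s e≤d) df = +-congˡ (*-congˡ (ev-mono (tail f) y e≤d (λ k e<k → df (suc k) (s≤s e<k))))

  ev-⊛ : ∀ d e {f g} y → Deg≤ d f → Deg≤ e g → ev (d ℕ.+ e) (f ⊛ g) y ≈ ev d f y * ev e g y
  ev-⊛ zero e {f} {g} y df dg = trans (ev-cong e y f⊛g) (ev-• e (f 0) g y)
    where
    f⊛g : f ⊛ g ≋ f 0 • g
    f⊛g zero    = R.refl
    f⊛g (suc k) = R.trans (R.+-congˡ (R.trans (⊛-cong {f = tail f} (λ i → df (suc i) (s≤s z≤n)) (λ _ → R.refl) k) (0⊛ g k))) (R.+-identityʳ _)
  ev-⊛ (suc d) e {f} {g} y df dg = begin
    ⟦ f 0 R.* g 0 ⟧ + y * ev (d ℕ.+ e) ((f 0 • tail g) ⊞ (tail f ⊛ g)) y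
      ≈⟨ +-cong (*-homo _ _) (*-congˡ (trans (ev-⊞ (d ℕ.+ e) (f 0 • tail g) (tail f ⊛ g) y)
           (+-cong (ev-• (d ℕ.+ e) (f 0) (tail g) y) (ev-⊛ d e y (λ k d<k → df (suc k) (s≤s d<k)) dg)))) ⟩
    ⟦ f 0 ⟧ * ⟦ g 0 ⟧ + y * (⟦ f 0 ⟧ * ev (d ℕ.+ e) (tail g) y + ev d (tail f) y * ev e g y)
      ≈⟨ solve 6 (λ a b y c d e → a :* b :+ y :* (a :* c :+ d :* e) := a :* (b :+ y :* c) :+ y :* (d :* e)) refl _ _ _ _ _ _ ⟩
    ⟦ f 0 ⟧ * ev (suc d ℕ.+ e) g y + y * (ev d (tail f) y * ev e g y)
      ≈⟨ +-congʳ (*-congˡ (ev-mono g y (ℕ.m≤n+m e (suc d)) dg)) ⟩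
    ⟦ f 0 ⟧ * ev e g y + y * (ev d (tail f) y * ev e g y)
      ≈⟨ solve 4 (λ a b c d → a :* b :+ c :* (d :* b) := (a :+ c :* d) :* b) refl _ _ _ _ ⟩
    (⟦ f 0 ⟧ + y * ev d (tail f) y) * ev e g y ∎

  ev-linear : ∀ a y → ev 1 (linear a) y ≈ ⟦ a ⟧ + y
  ev-linear a y = +-congˡ (trans (*-congˡ 1-homo) (*-identityʳ y))

  open import Algebra.Properties.Semiring.Exp semiring using (_^_)
  open import Algebra.Properties.Semiring.Exp (CommutativeRing.semiring seriesRing) using () renaming (_^_ to _^ˢ_)

  ev-^ : ∀ d {f} m y → Deg≤ d f → ev (m ℕ.* d) (f ^ˢ m) y ≈ ev d f y ^ m
  ev-^ d zero    y df = 1-homo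
  ev-^ d (suc m) y df = trans (ev-⊛ d (m ℕ.* d) y df (Deg≤-^ m df)) (*-congˡ (ev-^ d m y df))

module Roots {c ℓ} (R : CommutativeRing c ℓ)
  (cancel : ∀ x y → CommutativeRing._≈_ R (CommutativeRing._*_ R x y) (CommutativeRing.0# R) →
            ¬ CommutativeRing._≈_ R x (CommutativeRing.0# R) → CommutativeRing._≈_ R y (CommutativeRing.0# R)) where
  open CommutativeRing R hiding (zero)
  open PowerSeries R
  open Evaluation (idMap R)
  open IntegerSolver R
  open import Algebra.Properties.Ring ring using (x∙y⁻¹≈ε⇒x≈y)
  open import Relation.Binary.Reasoning.Setoid setoid

  -- Synthetic division, with the remainder f(a) moved to the left. The quotient keeps the leading
  -- coefficient, which is all that counting roots needs.
  divide : ∀ d f a → ∃ λ g → (g d ≈ f (suc d)) ×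
           (∀ y → ev (suc d) f y - ev (suc d) f a ≈ (y - a) * ev d g y)
  divide zero f a = tail f , refl , λ y →
    solve 4 (λ f0 f1 y a → (f0 :+ y :* f1) :- (f0 :+ a :* f1) := (y :- a) :* f1) refl (f 0) (f 1) y a
  divide (suc d) f a with divide d (tail f) a
  ... | g , g-top , g-eq = h , g-top , λ y → begin
    (f 0 + y * E y) - (f 0 + a * E a)
      ≈⟨ solve 5 (λ f y a u v → (f :+ y :* u) :- (f :+ a :* v) := (y :- a) :* v :+ y :* (u :- v)) refl (f 0) y a (E y) (E a) ⟩
    (y - a) * E a + y * (E y - E a)
      ≈⟨ +-congˡ (*-congˡ (g-eq y)) ⟩
    (y - a) * E a + y * ((y - a) * ev d g y)
      ≈⟨ solve 4 (λ b v y w → b :* v :+ y :* (b :* w) := b :* (v :+ y :* w)) refl (y - a) (E a) y (ev d g y) ⟩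
    (y - a) * (E a + y * ev d g y) ∎
    where
    E : Carrier → Carrier
    E = ev (suc d) (tail f)
    h : Series
    h zero    = E a
    h (suc k) = g k

  -- Dividing by one root leaves the other roots and the leading coefficient, at one degree less.
  top≈0 : ∀ d f (r : Fin (suc d) → Carrier) → (∀ i j → r i ≈ r j → i ≡ j) →
          (∀ i → ev d f (r i) ≈ 0#) → f d ≈ 0#
  top≈0 zero    f r r-inj root = root zero
  top≈0 (suc d) f r r-inj root with divide d f (r zero)
  ... | g , g-top , g-eq = trans (sym g-top) (top≈0 d g (r ∘ suc) (λ i j e → suc-injective (r-inj _ _ e)) λ i →
      cancel (r (suc i) - r zero) _
        (trans (sym (g-eq (r (suc i)))) (trans (+-cong (root (suc i)) (-‿cong (root zero))) (-‿inverseʳ 0#)))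
        (λ e → case r-inj _ _ (x∙y⁻¹≈ε⇒x≈y _ _ e) of λ ()))

  coeffs≈0 : ∀ d f (r : Fin (suc d) → Carrier) → (∀ i j → r i ≈ r j → i ≡ j) →
             (∀ i → ev d f (r i) ≈ 0#) → ∀ k → k ℕ.≤ d → f k ≈ 0#
  coeffs≈0 zero    f r r-inj root zero    z≤n = root zero
  coeffs≈0 (suc d) f r r-inj root k k≤d with ℕ.m≤n⇒m<n∨m≡n k≤d
  ... | inj₂ ≡.refl = top≈0 (suc d) f r r-inj root
  ... | inj₁ (s≤s k≤d′) = coeffs≈0 d f (r ∘ Fin.inject₁) (λ i j e → inject₁-injective (r-inj _ _ e))
          (λ i → trans (sym (drop d f (r (Fin.inject₁ i)) (top≈0 (suc d) f r r-inj root))) (root (Fin.inject₁ i))) k k≤d′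
    where
    drop : ∀ d f y → f (suc d) ≈ 0# → ev (suc d) f y ≈ ev d f y
    drop zero    f y e = trans (+-congˡ (trans (*-congˡ e) (zeroʳ _))) (+-identityʳ _)
    drop (suc d) f y e = +-congˡ (*-congˡ (drop d (tail f) y e))

-- Prime powers and the Frobenius map

C-absorb : ∀ n k → suc k ℕ.* (suc n C suc k) ≡ suc n ℕ.* (n C k)
C-absorb zero    zero    = ≡.refl
C-absorb zero    (suc k) = ℕ.*-zeroʳ (suc (suc k))
C-absorb (suc n) zero    = ≡.trans (ℕ.*-identityˡ _) (≡.trans (nC1≡n (suc (suc n))) (≡.sym (ℕ.*-identityʳ _)))
C-absorb (suc n) (suc k) = begin
  suc (suc k) ℕ.* (suc (suc n) C suc (suc k))
    ≡⟨ ≡.cong (suc (suc k) ℕ.*_) (nCk+nC[k+1]≡[n+1]C[k+1] (suc n) (suc k)) ⟨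
  suc (suc k) ℕ.* (a ℕ.+ b)
    ≡⟨ expand k a b ⟩
  a ℕ.+ suc k ℕ.* a ℕ.+ suc (suc k) ℕ.* b
    ≡⟨ ≡.cong₂ (λ u v → a ℕ.+ u ℕ.+ v) (C-absorb n k) (C-absorb n (suc k)) ⟩
  a ℕ.+ suc n ℕ.* (n C k) ℕ.+ suc n ℕ.* (n C suc k)
    ≡⟨ ℕ.+-assoc a _ _ ⟩
  a ℕ.+ (suc n ℕ.* (n C k) ℕ.+ suc n ℕ.* (n C suc k))
    ≡⟨ ≡.cong (a ℕ.+_) (≡.trans (≡.sym (ℕ.*-distribˡ-+ (suc n) (n C k) (n C suc k)))
                                (≡.cong (suc n ℕ.*_) (nCk+nC[k+1]≡[n+1]C[k+1] n k))) ⟩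
  a ℕ.+ suc n ℕ.* a ∎
  where
  open ≡.≡-Reasoning
  a = suc n C suc k
  expand : ∀ k a b → suc (suc k) ℕ.* (a ℕ.+ b) ≡ a ℕ.+ suc k ℕ.* a ℕ.+ suc (suc k) ℕ.* b
  expand = solve-∀
  b = suc n C suc (suc k)

-- By absorption p divides k · C(p, k), and it cannot divide k, which is positive and smaller than
-- p.
prime∣C : ∀ {p} → Prime p → ∀ k → 0 ℕ.< k → k ℕ.< p → p ∣ (p C k)
prime∣C {zero}  pp k       0<k ()
prime∣C {suc p} pp (suc k) 0<k k<p
  with euclidsLemma (suc k) (suc p C suc k) pp (divides (p C k) (≡.trans (C-absorb p k) (ℕ.*-comm (suc p) _)))
... | inj₁ p∣k = contradiction (∣⇒≤ p∣k) (ℕ.<⇒≱ k<p)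
... | inj₂ p∣C = p∣C

prime-∤⇒coprime : ∀ {p m} → Prime p → ¬ (p ∣ m) → Coprime p m
prime-∤⇒coprime pp p∤m (d∣p , d∣m) with prime⇒irreducible pp d∣p
... | inj₁ d≡1    = d≡1
... | inj₂ ≡.refl = contradiction d∣m p∤m

∣p^h⇒power : ∀ {p} → Prime p → ∀ h {m} → m ∣ p ℕ.^ h → ∃ λ e → m ≡ p ℕ.^ e
∣p^h⇒power pp zero    m∣1 = 0 , ∣1⇒≡1 m∣1
∣p^h⇒power {p} pp (suc h) {m} m∣ with p ∣? m
... | yes (divides m′ ≡.refl) with ∣p^h⇒power pp h {m′} (*-cancelˡ-∣ p {{prime⇒nonZero pp}} (≡.subst (_∣ p ℕ.^ suc h) (ℕ.*-comm m′ p) m∣))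
...   | e , ≡.refl = suc e , ℕ.*-comm m′ p
∣p^h⇒power {p} pp (suc h) {m} m∣ | no p∤m =
  ∣p^h⇒power pp h (coprime-divisor {m} {p} (λ (d∣m , d∣p) → prime-∤⇒coprime pp p∤m (d∣p , d∣m)) m∣)

prime-part : ∀ {p} → Prime p → ∀ m → 0 ℕ.< m → ∃ λ h → ∃ λ r → m ≡ p ℕ.^ h ℕ.* r × ¬ (p ∣ r)
prime-part {p} pp m 0<m = go m m ℕ.≤-refl 0<m
  where
  go : ∀ b m → m ℕ.≤ b → 0 ℕ.< m → ∃ λ h → ∃ λ r → m ≡ p ℕ.^ h ℕ.* r × ¬ (p ∣ r)
  go zero    m m≤b 0<m = contradiction m≤b (ℕ.<⇒≱ 0<m)
  go (suc b) m m≤b 0<m with p ∣? m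
  ... | no p∤m = 0 , m , ≡.sym (ℕ.*-identityˡ m) , p∤m
  ... | yes (divides zero ≡.refl) = contradiction 0<m λ ()
  ... | yes (divides m′@(suc _) ≡.refl)
      with go b m′ (ℕ.≤-pred (ℕ.≤-trans (ℕ.m<m*n m′ p (ℕ.nonTrivial⇒n>1 p {{prime⇒nonTrivial pp}})) m≤b)) (s≤s z≤n)
  ...   | h , r , eq , p∤r = suc h , r , ≡.trans (≡.cong (ℕ._* p) eq) (≡.trans (ℕ.*-comm _ p) (≡.sym (ℕ.*-assoc p _ r))) , p∤r

module Frobenius {c ℓ} (R : CommutativeRing c ℓ) where
  open CommutativeRing R hiding (zero)
  open import Algebra.Properties.Semiring.Mult semiring public using (×-congʳ; ×-assocˡ; ×-assoc-*; ×-homo-+; ×1-homo-*) renaming (_×_ to _·_)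
  open import Algebra.Properties.CommutativeSemiring.Exp commutativeSemiring public
  open Binomial commutativeSemiring using (theorem; binomialTerm)
  open Sum +-commutativeMonoid using (sum; sum-init-last; sum-cong-≋; sum-replicate-zero)
  open import Relation.Binary.Reasoning.Setoid setoid
  open import Algebra.Properties.Ring ring using (+-inverseʳ-unique)

  ·0 : ∀ m → m · 0# ≈ 0#
  ·0 zero    = refl
  ·0 (suc m) = trans (+-identityˡ _) (·0 m)

  module _ {p : ℕ} (pp : Prime p) (char : p · 1# ≈ 0#) where

    p·x≈0 : ∀ x → p · x ≈ 0#
    p·x≈0 x = trans (×-congʳ p (sym (*-identityˡ x))) (trans (sym (×-assoc-* p 1# x)) (trans (*-congʳ char) (zeroˡ x)))

    p∣⇒·≈0 : ∀ {m} x → p ∣ m → m · x ≈ 0#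
    p∣⇒·≈0 x (divides q ≡.refl) = trans (sym (×-assocˡ x q p)) (trans (×-congʳ q (p·x≈0 x)) (·0 q))

    frobenius : ∀ x y → (x + y) ^ p ≈ x ^ p + y ^ p
    frobenius x y = go p ≡.refl
      where
      -- The exponent is generalised so that it can be split as a successor, which separates the
      -- first and the last binomial term from those divisible by p.
      go : ∀ m → m ≡ p → (x + y) ^ m ≈ x ^ m + y ^ m
      go zero    ≡.refl = contradiction (prime⇒nonZero pp) λ ()
      go (suc m) m≡p = begin
        (x + y) ^ suc m                                       ≈⟨ theorem (suc m) x y ⟩
        t zero + sum (t ∘ suc)                                ≈⟨ +-congˡ (sum-init-last (t ∘ suc)) ⟩
        t zero + (sum (λ i → t (suc (inject₁ i))) + t (suc (fromℕ m)))
          ≈⟨ +-cong first (+-cong (trans (sum-cong-≋ middle) (sum-replicate-zero m)) last) ⟩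
        y ^ suc m + (0# + x ^ suc m)                          ≈⟨ trans (+-congˡ (+-identityˡ _)) (+-comm _ _) ⟩
        x ^ suc m + y ^ suc m                                 ∎
        where
        t : Fin (suc (suc m)) → Carrier
        t = binomialTerm x y (suc m)
        first : t zero ≈ y ^ suc m
        first = trans (+-identityʳ _) (*-identityˡ _)
        last : t (suc (fromℕ m)) ≈ x ^ suc m
        last rewrite toℕ-fromℕ m | nCn≡1 (suc m) | ℕ.n∸n≡0 m = trans (+-identityʳ _) (*-identityʳ _)
        middle : ∀ i → t (suc (inject₁ i)) ≈ 0#
        middle i rewrite toℕ-inject₁ i =
          p∣⇒·≈0 _ (≡.subst (λ z → p ∣ (z C suc (toℕ i))) (≡.sym m≡p)
            (prime∣C pp (suc (toℕ i)) (s≤s z≤n) (≡.subst (suc (toℕ i) ℕ.<_) m≡p (s≤s (toℕ<n i)))))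

    frobeniusᵉ : ∀ e x y → (x + y) ^ (p ℕ.^ e) ≈ x ^ (p ℕ.^ e) + y ^ (p ℕ.^ e)
    frobeniusᵉ zero    x y = trans (*-identityʳ _) (sym (+-cong (*-identityʳ _) (*-identityʳ _)))
    frobeniusᵉ (suc e) x y = begin
      (x + y) ^ (p ℕ.* p ℕ.^ e)                     ≈⟨ ^-assocʳ _ p (p ℕ.^ e) ⟨
      ((x + y) ^ p) ^ (p ℕ.^ e)                     ≈⟨ ^-congˡ (p ℕ.^ e) (frobenius x y) ⟩
      (x ^ p + y ^ p) ^ (p ℕ.^ e)                   ≈⟨ frobeniusᵉ e (x ^ p) (y ^ p) ⟩
      (x ^ p) ^ (p ℕ.^ e) + (y ^ p) ^ (p ℕ.^ e)     ≈⟨ +-cong (^-assocʳ _ p (p ℕ.^ e)) (^-assocʳ _ p (p ℕ.^ e)) ⟩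
      x ^ (p ℕ.* p ℕ.^ e) + y ^ (p ℕ.* p ℕ.^ e)     ∎

    0^p^e : ∀ e → 0# ^ (p ℕ.^ e) ≈ 0#
    0^p^e e with p ℕ.^ e | ℕ.m^n>0 p {{prime⇒nonZero pp}} e
    ... | suc m | _ = zeroˡ _

    frobeniusᵉ-neg : ∀ e x → (- x) ^ (p ℕ.^ e) ≈ - (x ^ (p ℕ.^ e))
    frobeniusᵉ-neg e x = +-inverseʳ-unique _ _ (begin
      x ^ (p ℕ.^ e) + (- x) ^ (p ℕ.^ e)  ≈⟨ frobeniusᵉ e x (- x) ⟨
      (x - x) ^ (p ℕ.^ e)                ≈⟨ ^-congˡ (p ℕ.^ e) (-‿inverseʳ x) ⟩
      0# ^ (p ℕ.^ e)                     ≈⟨ 0^p^e e ⟩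
      0#                                 ∎)

    frobeniusᵉ-sub : ∀ e x y → (x - y) ^ (p ℕ.^ e) ≈ x ^ (p ℕ.^ e) - y ^ (p ℕ.^ e)
    frobeniusᵉ-sub e x y = trans (frobeniusᵉ e x (- y)) (+-congˡ (frobeniusᵉ-neg e y))

-- Finite fields

module FiniteField {c ℓ} (F : CommutativeRing c ℓ) {q : ℕ} (FF : IsFiniteField F q) where
  open CommutativeRing F hiding (zero)
  open IsFiniteField FF public
  open Codes F FF using (_≈?_) public
  open Frobenius F
  open IntegerSolver F
  open import Relation.Binary.Reasoning.Setoid setoid
  open import Algebra.Properties.Ring ring using (+-cancelˡ)
  private
    module Π = Sum *-commutativeMonoid
    module ⅀ = Sum +-commutativeMonoid

  1≉0 : ¬ (1# ≈ 0#)
  1≉0 = 0≉1 ∘ sym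

  enum-injective : ∀ {i j} → enum i ≈ enum j → i ≡ j
  enum-injective {i} {j} e = ≡.trans (≡.sym (index-enum i)) (≡.trans (index-cong e) (index-enum j))

  cancel : ∀ x y → x * y ≈ 0# → ¬ (x ≈ 0#) → y ≈ 0#
  cancel x y xy≈0 x≉0 with inverse x x≉0
  ... | x⁻¹ , xx⁻¹≈1 = begin
    y                ≈⟨ *-identityˡ y ⟨
    1# * y           ≈⟨ *-congʳ xx⁻¹≈1 ⟨
    (x * x⁻¹) * y    ≈⟨ solve 3 (λ x i y → (x :* i) :* y := i :* (x :* y)) refl x x⁻¹ y ⟩
    x⁻¹ * (x * y)    ≈⟨ trans (*-congˡ xy≈0) (zeroʳ _) ⟩
    0#               ∎

  *-≉0 : ∀ {x y} → ¬ (x ≈ 0#) → ¬ (y ≈ 0#) → ¬ (x * y ≈ 0#)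
  *-≉0 x≉0 y≉0 xy≈0 = y≉0 (cancel _ _ xy≈0 x≉0)

  ^-≉0 : ∀ {x} m → ¬ (x ≈ 0#) → ¬ (x ^ m ≈ 0#)
  ^-≉0 zero    x≉0 = 1≉0
  ^-≉0 (suc m) x≉0 = *-≉0 x≉0 (^-≉0 m x≉0)

  ∏-≉0 : ∀ {m} (f : Fin m → Carrier) → (∀ i → ¬ (f i ≈ 0#)) → ¬ (Π.sum f ≈ 0#)
  ∏-≉0 {zero}  f f≉0 = 1≉0
  ∏-≉0 {suc m} f f≉0 = *-≉0 (f≉0 zero) (∏-≉0 (f ∘ suc) (f≉0 ∘ suc))

  *-cancelʳ-≉0 : ∀ {x y z} → ¬ (z ≈ 0#) → x * z ≈ y * z → x ≈ y
  *-cancelʳ-≉0 {x} {y} {z} z≉0 e = begin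
    x              ≈⟨ solve 2 (λ x y → x := (x :- y) :+ y) refl x y ⟩
    (x - y) + y    ≈⟨ +-congʳ (cancel z (x - y) (begin
      z * (x - y)    ≈⟨ solve 3 (λ x y z → z :* (x :- y) := x :* z :- y :* z) refl x y z ⟩
      x * z - y * z  ≈⟨ +-congʳ e ⟩
      y * z - y * z  ≈⟨ -‿inverseʳ _ ⟩
      0# ∎) z≉0) ⟩
    0# + y         ≈⟨ +-identityˡ y ⟩
    y              ∎

  permuteBy : (f g : Carrier → Carrier) → (∀ {x y} → x ≈ y → f x ≈ f y) → (∀ {x y} → x ≈ y → g x ≈ g y) →
              (∀ x → f (g x) ≈ x) → (∀ x → g (f x) ≈ x) → Permutation q q
  permuteBy f g f-cong g-cong fg gf =
    permutation (λ i → index (f (enum i))) (λ i → index (g (enum i)))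
      (λ i → ≡.trans (index-cong (trans (f-cong (enum-index _)) (fg _))) (index-enum i))
      (λ i → ≡.trans (index-cong (trans (g-cong (enum-index _)) (gf _))) (index-enum i))

  -- Translation by 1 permutes the field, so the sum of all elements equals itself plus q · 1.
  q·1≈0 : q · 1# ≈ 0#
  q·1≈0 = sym (+-cancelˡ (⅀.sum enum) _ _ (begin
    ⅀.sum enum + 0#                        ≈⟨ +-identityʳ _ ⟩
    ⅀.sum enum                             ≈⟨ ⅀.sum-permute enum π ⟩
    ⅀.sum (λ i → enum (index (enum i + 1#)))  ≈⟨ ⅀.sum-cong-≋ (λ i → enum-index (enum i + 1#)) ⟩
    ⅀.sum (λ i → enum i + 1#)              ≈⟨ ⅀.∑-distrib-+ enum (λ _ → 1#) ⟩
    ⅀.sum enum + ⅀.sum {q} (λ _ → 1#)      ≈⟨ +-congˡ (⅀.sum-replicate q) ⟩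
    ⅀.sum enum + q · 1#                    ∎))
    where
    π : Permutation q q
    π = permuteBy (_+ 1#) (_- 1#) +-congʳ +-congʳ
      (λ x → solve 1 (λ x → (x :- con (+ 1)) :+ con (+ 1) := x) refl x)
      (λ x → solve 1 (λ x → (x :+ con (+ 1)) :- con (+ 1) := x) refl x)

  -- 0 is replaced by 1 so that the product over the whole field is that of the nonzero elements.
  unitPart : Carrier → Carrier
  unitPart y with y ≈? 0#
  ... | yes _ = 1#
  ... | no _  = y

  unitPart-≉0 : ∀ y → ¬ (unitPart y ≈ 0#)
  unitPart-≉0 y with y ≈? 0#
  ... | yes _   = 1≉0
  ... | no y≉0 = y≉0

  unitPart-cong : ∀ {x y} → x ≈ y → unitPart x ≈ unitPart y
  unitPart-cong {x} {y} e with x ≈? 0# | y ≈? 0#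
  ... | yes _ | yes _ = refl
  ... | no _  | no _  = e
  ... | yes a | no b  = contradiction (trans (sym e) a) b
  ... | no a  | yes b = contradiction (trans e b) a

  -- The factor by which `unitPart y` changes when y is multiplied by a nonzero x; at y = 0 nothing
  -- changes.
  multiplierPart : Carrier → Carrier → Carrier
  multiplierPart x y with y ≈? 0#
  ... | yes _ = 1#
  ... | no _  = x

  unitPart-* : ∀ {x} → ¬ (x ≈ 0#) → ∀ y → unitPart (x * y) ≈ multiplierPart x y * unitPart y
  unitPart-* {x} x≉0 y with y ≈? 0# | (x * y) ≈? 0#
  ... | yes _   | yes _  = sym (*-identityˡ 1#)
  ... | yes y≈0 | no n   = contradiction (trans (*-congˡ y≈0) (zeroʳ x)) n
  ... | no y≉0  | yes e  = contradiction e (*-≉0 x≉0 y≉0)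
  ... | no _    | no _   = refl

  ∏-multiplierPart : ∀ x → Π.sum (λ i → multiplierPart x (enum i)) ≈ x ^ (q ℕ.∸ 1)
  ∏-multiplierPart x = go q enum (index 0#) (trans (enum-index 0#)) (λ i e → ≡.trans (≡.sym (index-enum i)) (index-cong e))
    where
    -- The field has exactly one zero, at index `o`. Taking out its factor 1 leaves q - 1 copies of
    -- x.
    go : ∀ m (f : Fin m → Carrier) (o : Fin m) → (∀ {y} → 0# ≈ y → f o ≈ y) → (∀ i → f i ≈ 0# → i ≡ o) →
         Π.sum (λ i → multiplierPart x (f i)) ≈ x ^ (m ℕ.∸ 1)
    go zero    f () _ _
    go (suc m) f o fo≈0 only = begin
      Π.sum h                                ≈⟨ Π.sum-remove {i = o} h ⟩
      h o * Π.sum (λ i → h (punchIn o i))    ≈⟨ *-cong at-o (Π.sum-cong-≋ off-o) ⟩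
      1# * Π.sum {m} (λ _ → x)               ≈⟨ *-identityˡ _ ⟩
      Π.sum {m} (λ _ → x)                    ≈⟨ Π.sum-replicate m ⟩
      x ^ m                                  ∎
      where
      h = λ i → multiplierPart x (f i)
      at-o : h o ≈ 1#
      at-o with f o ≈? 0#
      ... | yes _ = refl
      ... | no n  = contradiction (fo≈0 refl) n
      off-o : ∀ i → h (punchIn o i) ≈ x
      off-o i with f (punchIn o i) ≈? 0#
      ... | yes e = contradiction (only _ e) (punchInᵢ≢i o i)
      ... | no _  = refl

  -- Multiplication by x permutes the field and so preserves the product of all unit parts, while it
  -- multiplies this product by x^(q-1).
  fermat : ∀ {x} → ¬ (x ≈ 0#) → x ^ (q ℕ.∸ 1) ≈ 1#
  fermat {x} x≉0 with inverse x x≉0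
  ... | x⁻¹ , xx⁻¹≈1 = *-cancelʳ-≉0 (∏-≉0 (unitPart ∘ enum) (unitPart-≉0 ∘ enum)) (begin
    x ^ (q ℕ.∸ 1) * Π.sum (unitPart ∘ enum)
      ≈⟨ *-congʳ (∏-multiplierPart x) ⟨
    Π.sum (λ i → multiplierPart x (enum i)) * Π.sum (unitPart ∘ enum)
      ≈⟨ Π.∑-distrib-+ (λ i → multiplierPart x (enum i)) (unitPart ∘ enum) ⟨
    Π.sum (λ i → multiplierPart x (enum i) * unitPart (enum i))
      ≈⟨ Π.sum-cong-≋ (λ i → trans (unitPart-cong (enum-index (x * enum i))) (unitPart-* x≉0 (enum i))) ⟨
    Π.sum (λ i → unitPart (enum (index (x * enum i))))
      ≈⟨ Π.sum-permute (unitPart ∘ enum) π ⟨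
    Π.sum (unitPart ∘ enum)
      ≈⟨ *-identityˡ _ ⟨
    1# * Π.sum (unitPart ∘ enum) ∎)
    where
    π : Permutation q q
    π = permuteBy (x *_) (x⁻¹ *_) *-congˡ *-congˡ
      (λ y → trans (sym (*-assoc _ _ _)) (trans (*-congʳ xx⁻¹≈1) (*-identityˡ y)))
      (λ y → trans (sym (*-assoc _ _ _)) (trans (*-congʳ (trans (*-comm _ _) xx⁻¹≈1)) (*-identityˡ y)))

  1<q : 1 ℕ.< q
  1<q = go q (index 0#) (index 1#) λ e → 0≉1 (trans (sym (enum-index 0#)) (trans (reflexive (≡.cong enum e)) (enum-index 1#)))
    where
    go : ∀ m (i j : Fin m) → ¬ i ≡ j → 1 ℕ.< m
    go (suc zero)    zero zero n = contradiction ≡.refl n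
    go (suc (suc m)) i    j    n = s≤s (s≤s z≤n)

  suc[q∸1] : suc (q ℕ.∸ 1) ≡ q
  suc[q∸1] = ℕ.m+[n∸m]≡n (ℕ.<⇒≤ 1<q)

  x^q≈x : ∀ x → x ^ q ≈ x
  x^q≈x x = trans (^-congʳ x (≡.sym suc[q∸1])) (go (x ≈? 0#))
    where
    go : Dec (x ≈ 0#) → x ^ suc (q ℕ.∸ 1) ≈ x
    go (yes x≈0) = trans (*-congʳ x≈0) (trans (zeroˡ _) (sym x≈0))
    go (no x≉0)  = trans (*-congˡ (fermat x≉0)) (*-identityʳ x)

  -- The zero element q · 1 is the product of the elements p · 1 over the prime factors p of q, so
  -- one of them vanishes.
  characteristic : ∃ λ p → Prime p × (p · 1# ≈ 0#)
  characteristic = go factors factorsPrime (≡.subst (λ m → m · 1# ≈ 0#) isFactorisation q·1≈0)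
    where
    instance _ = ℕ.>-nonZero (ℕ.<⇒≤ 1<q)
    open PrimeFactorisation (factorise q)
    go : ∀ ps → All Prime ps → product ps · 1# ≈ 0# → ∃ λ p → Prime p × (p · 1# ≈ 0#)
    go []       _          e = contradiction (trans (sym (+-identityʳ 1#)) e) 1≉0
    go (p ∷ ps) (pp ∷ pps) e with (p · 1#) ≈? 0#
    ... | yes e′ = p , pp , e′
    ... | no n   = go ps pps (cancel _ _ (trans (sym (×1-homo-* p (product ps))) e) n)

  bezout : ∀ x y a b → a · 1# ≈ 0# → b · 1# ≈ 0# → 1 ℕ.+ y ℕ.* b ≡ x ℕ.* a → 1# ≈ 0#
  bezout x y a b a0 b0 eq = begin
    1#                          ≈⟨ +-identityʳ 1# ⟨
    1# + 0#                     ≈⟨ +-congˡ (trans (*-congˡ b0) (zeroʳ (y · 1#))) ⟨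
    1# + y · 1# * (b · 1#)      ≈⟨ +-congˡ (×1-homo-* y b) ⟨
    (1 ℕ.+ y ℕ.* b) · 1#        ≡⟨ ≡.cong (_· 1#) eq ⟩
    (x ℕ.* a) · 1#              ≈⟨ ×1-homo-* x a ⟩
    x · 1# * (a · 1#)           ≈⟨ trans (*-congˡ a0) (zeroʳ _) ⟩
    0#                          ∎

  -- Otherwise a Bézout relation between p and m would give 1 = 0.
  char-∣ : ∀ {p} → Prime p → p · 1# ≈ 0# → ∀ {m} → m · 1# ≈ 0# → p ∣ m
  char-∣ {p} pp char {m} m·1≈0 with p ∣? m
  ... | yes p∣m = p∣m
  ... | no p∤m with coprime-Bézout (prime-∤⇒coprime pp p∤m)
  ...   | Bézout.+- x y eq = contradiction (bezout x y p m char m·1≈0 eq) 1≉0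
  ...   | Bézout.-+ x y eq = contradiction (bezout y x m p m·1≈0 char eq) 1≉0

  open Roots F cancel public

-- Powers of series in characteristic p

module SeriesPowers {c ℓ} (R : CommutativeRing c ℓ) where
  open CommutativeRing R hiding (zero)
  open PowerSeries R
  open Degree R using (linear)
  open Frobenius R
  module S where
    open CommutativeRing seriesRing public
    open Frobenius seriesRing public

  ·-series : ∀ m f k → (m S.· f) k ≈ m · f k
  ·-series zero    f k = refl
  ·-series (suc m) f k = +-congˡ (·-series m f k)

  series-char : ∀ {p} → p · 1# ≈ 0# → p S.· S.1# S.≈ S.0#
  series-char {p} char zero    = trans (·-series p S.1# 0) char
  series-char {p} char (suc k) = trans (·-series p S.1# (suc k)) (·0 p)

  ⊛-first : ∀ k f g → (∀ i → i ℕ.< k → f i ≈ 0#) → (f ⊛ g) k ≈ f k * g 0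
  ⊛-first zero    f g f≈0 = refl
  ⊛-first (suc k) f g f≈0 =
    trans (+-cong (trans (*-congʳ (f≈0 0 (s≤s z≤n))) (zeroˡ _)) (⊛-first k (tail f) g (λ i i<k → f≈0 (suc i) (s≤s i<k))))
          (+-identityˡ _)

  -- Congruence to 1 modulo T^m. The coefficient at T^m itself is left free; under multiplication of
  -- such series it is additive.
  record Unital (m : ℕ) (f : Series) : Set ℓ where
    constructor unital
    field
      at-0   : f 0 ≈ 1#
      gap    : ∀ k → 0 ℕ.< k → k ℕ.< m → f k ≈ 0#
  open Unital public

  Unital-⊛-coeff : ∀ {m f g} → Unital m f → Unital m g → ∀ k → 0 ℕ.< k → k ℕ.≤ m → (f ⊛ g) k ≈ f k + g k
  Unital-⊛-coeff {m} {f} {g} uf ug (suc k) _ k<m =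
    trans (+-cong (trans (*-congʳ (at-0 uf)) (*-identityˡ _))
                  (trans (⊛-first k (tail f) g (λ i i<k → gap uf (suc i) (s≤s z≤n) (ℕ.<-≤-trans (s≤s i<k) k<m)))
                         (trans (*-congˡ (at-0 ug)) (*-identityʳ _))))
          (+-comm _ _)

  Unital-⊛ : ∀ {m f g} → Unital m f → Unital m g → Unital m (f ⊛ g)
  Unital-⊛ uf ug = unital (trans (*-cong (at-0 uf) (at-0 ug)) (*-identityˡ _)) λ k 0<k k<m →
    trans (Unital-⊛-coeff uf ug k 0<k (ℕ.<⇒≤ k<m)) (trans (+-cong (gap uf k 0<k k<m) (gap ug k 0<k k<m)) (+-identityˡ _))

  Unital-^ : ∀ {m f} r → Unital m f → Unital m (f S.^ r)
  Unital-^ zero    uf = unital refl λ where (suc k) _ _ → refl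
  Unital-^ (suc r) uf = Unital-⊛ uf (Unital-^ r uf)

  Unital-^-coeff : ∀ {m f} r → Unital m f → ∀ k → 0 ℕ.< k → k ℕ.≤ m → (f S.^ r) k ≈ r · f k
  Unital-^-coeff zero    uf (suc k) _ _ = refl
  Unital-^-coeff (suc r) uf k 0<k k≤m =
    trans (Unital-⊛-coeff uf (Unital-^ r uf) k 0<k k≤m) (+-congˡ (Unital-^-coeff r uf k 0<k k≤m))

  X : Series
  X = shift S.1#

  X^-eq : ∀ m → (X S.^ m) m ≈ 1#
  X^-eq zero    = refl
  X^-eq (suc m) = trans (shift-⊛ S.1# (X S.^ m) (suc m)) (trans (1⊛ (X S.^ m) m) (X^-eq m))

  X^-lt : ∀ m k → k ℕ.< m → (X S.^ m) k ≈ 0#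
  X^-lt (suc m) zero    _         = zeroˡ _
  X^-lt (suc m) (suc k) (s≤s k<m) = trans (shift-⊛ S.1# (X S.^ m) (suc k)) (trans (1⊛ (X S.^ m) k) (X^-lt m k k<m))

  1^ : ∀ m → S.1# S.^ m S.≈ S.1#
  1^ zero    = S.refl
  1^ (suc m) = S.trans (1⊛ (S.1# S.^ m)) (1^ m)

  module _ {p : ℕ} (pp : Prime p) (char : p · 1# ≈ 0#) where

    [1+X]^p^e : ∀ e → linear 1# S.^ (p ℕ.^ e) S.≈ S.1# ⊞ X S.^ (p ℕ.^ e)
    [1+X]^p^e e = S.trans (S.^-congˡ (p ℕ.^ e) 1+X) (S.trans (S.frobeniusᵉ pp (series-char {p} char) e S.1# X)
                    (S.+-congʳ {X S.^ (p ℕ.^ e)} (1^ (p ℕ.^ e))))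
      where
      1+X : linear 1# S.≈ S.1# ⊞ X
      1+X zero          = sym (+-identityʳ _)
      1+X (suc zero)    = sym (+-identityˡ _)
      1+X (suc (suc k)) = sym (+-identityˡ _)

    -- (1 + X)^(p^e r) = (1 + X^(p^e))^r by Frobenius, and the first nontrivial coefficient of the
    -- right side is r.
    [1+X]^-coeff : ∀ e r → (linear 1# S.^ (p ℕ.^ e ℕ.* r)) (p ℕ.^ e) ≈ r · 1#
    [1+X]^-coeff e r = trans (sym (S.^-assocʳ (linear 1#) (p ℕ.^ e) r (p ℕ.^ e)))
      (trans (S.^-congˡ r ([1+X]^p^e e) (p ℕ.^ e))
      (trans (Unital-^-coeff r u (p ℕ.^ e) p^e>0 ℕ.≤-refl) (×-congʳ r at-p^e)))
      where
      p^e>0 : 0 ℕ.< p ℕ.^ e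
      p^e>0 = ℕ.m^n>0 p {{prime⇒nonZero pp}} e
      1-at : ∀ k → 0 ℕ.< k → S.1# k ≈ 0#
      1-at (suc k) _ = refl
      u : Unital (p ℕ.^ e) (S.1# ⊞ X S.^ (p ℕ.^ e))
      u = unital (trans (+-congˡ (X^-lt (p ℕ.^ e) 0 p^e>0)) (+-identityʳ _))
                 (λ k 0<k k<m → trans (+-cong (1-at k 0<k) (X^-lt (p ℕ.^ e) k k<m)) (+-identityˡ _))
      at-p^e : (S.1# ⊞ X S.^ (p ℕ.^ e)) (p ℕ.^ e) ≈ 1#
      at-p^e = trans (+-cong (1-at _ p^e>0) (X^-eq (p ℕ.^ e))) (+-identityˡ _)

-- The order of a finite field and the existence of nonsquares

module FieldOrder {c ℓ} (F : CommutativeRing c ℓ) {q : ℕ} (FF : IsFiniteField F q) where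
  open CommutativeRing F hiding (zero)
  open FiniteField F FF
  open PowerSeries F
  open Degree F
  open Evaluation (idMap F)
  open SeriesPowers F
  open Frobenius F
  open IntegerSolver F
  open import Relation.Binary.Reasoning.Setoid setoid
  open import Algebra.Properties.Ring ring using (+-cancelʳ)

  ev-top : ∀ d f y → ev (suc d) f y ≈ ev d f y + f (suc d) * y ^ suc d
  ev-top zero    f y = +-congˡ (trans (*-comm _ _) (*-congˡ (sym (*-identityʳ y))))
  ev-top (suc d) f y = trans (+-congˡ (*-congˡ (ev-top d (tail f) y)))
    (solve 5 (λ a y b c d → a :+ y :* (b :+ c :* d) := (a :+ y :* b) :+ c :* (y :* d)) refl _ _ _ _ _)

  -- (1 + Z)^q and 1 + Z^q agree on all of F, so their coefficients below degree q agree.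
  [1+X]^q-gap : ∀ k → 0 ℕ.< k → k ℕ.< q → (linear 1# S.^ q) k ≈ 0#
  [1+X]^q-gap = go q ≡.refl
    where
    go : ∀ m → m ≡ q → ∀ k → 0 ℕ.< k → k ℕ.< m → (linear 1# S.^ m) k ≈ 0#
    go (suc m) m≡q k@(suc k′) 0<k (s≤s k≤m) = trans (sym (+-identityʳ _)) (coeffs≈0 m g r r-inj roots k k≤m)
      where
      f = linear 1# S.^ suc m
      g : Series
      g = f ⊞ const (- 1#)
      deg : Deg≤ (suc m) f
      deg = ≡.subst (λ d → Deg≤ d f) (ℕ.*-identityʳ (suc m)) (Deg≤-^ {1} {linear 1#} (suc m) (Deg≤-linear 1#))
      1^≈1 : ∀ j → 1# ^ j ≈ 1#
      1^≈1 zero    = refl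
      1^≈1 (suc j) = trans (*-identityˡ _) (1^≈1 j)
      top : f (suc m) ≈ 1#
      top = trans (reflexive (≡.cong f (≡.sym (ℕ.*-identityʳ (suc m)))))
              (trans (^-lead {1} {linear 1#} (suc m) (Deg≤-linear 1#)) (1^≈1 (suc m)))
      value : ∀ y → ev (suc m) f y ≈ 1# + y
      value y = begin
        ev (suc m) f y           ≡⟨ ≡.cong (λ d → ev d f y) (≡.sym (ℕ.*-identityʳ (suc m))) ⟩
        ev (suc m ℕ.* 1) f y     ≈⟨ ev-^ 1 (suc m) y (Deg≤-linear 1#) ⟩
        ev 1 (linear 1#) y ^ suc m ≈⟨ ^-congˡ (suc m) (ev-linear 1# y) ⟩
        (1# + y) ^ suc m         ≡⟨ ≡.cong ((1# + y) ^_) m≡q ⟩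
        (1# + y) ^ q             ≈⟨ x^q≈x _ ⟩
        1# + y                   ∎
      low : ∀ y → ev m f y ≈ 1#
      low y = +-cancelʳ y _ _ (begin
        ev m f y + y                          ≈⟨ +-congˡ (trans (trans (*-congʳ top) (*-identityˡ _)) (trans (reflexive (≡.cong (y ^_) m≡q)) (x^q≈x y))) ⟨
        ev m f y + f (suc m) * y ^ suc m      ≈⟨ ev-top m f y ⟨
        ev (suc m) f y                        ≈⟨ value y ⟩
        1# + y                                ∎)
      r : Fin (suc m) → Carrier
      r i = enum (≡.subst Fin m≡q i)
      subst-inj : ∀ {a b} (e : a ≡ b) {i j} → ≡.subst Fin e i ≡ ≡.subst Fin e j → i ≡ j
      subst-inj ≡.refl e = e
      r-inj : ∀ i j → r i ≈ r j → i ≡ j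
      r-inj i j e = subst-inj m≡q (enum-injective e)
      const-ev : ∀ d a y → ev d (const a) y ≈ a
      const-ev zero    a y = refl
      const-ev (suc d) a y = trans (+-congˡ (trans (*-congˡ (ev-zero d y (λ _ _ → refl))) (zeroʳ _))) (+-identityʳ _)
      roots : ∀ i → ev m g (r i) ≈ 0#
      roots i = trans (ev-⊞ m f (const (- 1#)) (r i))
        (trans (+-cong (low (r i)) (const-ev m (- 1#) (r i))) (-‿inverseʳ 1#))

  -- Write q = p^h r with r prime to p. In (1 + X)^q the coefficient at X^(p^h) is r, which is not
  -- 0, whereas all coefficients strictly between degrees 0 and q vanish; hence p^h = q. This
  -- replaces the dimension over the prime field.
  order≡p^h : ∀ {p} → Prime p → p · 1# ≈ 0# → ∃ λ h → q ≡ p ℕ.^ h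
  order≡p^h {p} pp char with prime-part pp q (ℕ.<⇒≤ 1<q)
  ... | h , r , q≡ , p∤r with p ℕ.^ h ℕ.<? q
  ...   | yes p^h<q = contradiction (char-∣ pp char (trans (sym ([1+X]^-coeff pp char h r))
          (≡.subst (λ m → (linear 1# S.^ m) (p ℕ.^ h) ≈ 0#) q≡ ([1+X]^q-gap (p ℕ.^ h) (ℕ.m^n>0 p {{prime⇒nonZero pp}} h) p^h<q)))) p∤r
  ...   | no p^h≮q = h , ℕ.≤-antisym (ℕ.≮⇒≥ p^h≮q) (≤q r q≡)
    where
    ≤q : ∀ r → q ≡ p ℕ.^ h ℕ.* r → p ℕ.^ h ℕ.≤ q
    ≤q zero    e = contradiction 1<q (≡.subst (λ z → ¬ (1 ℕ.< z)) (≡.sym (≡.trans e (ℕ.*-zeroʳ (p ℕ.^ h)))) λ ())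
    ≤q (suc r) e = ≡.subst (p ℕ.^ h ℕ.≤_) (≡.sym e) (ℕ.m≤m*n (p ℕ.^ h) (suc r))

  -- If every element had a root, a choice of roots would be injective and would miss -u, where u is
  -- the root chosen for 1. Together with -u this would embed q + 1 elements into the field.
  nonsquare : ¬ (1# + 1# ≈ 0#) → ∃ λ δ → ∀ x → ¬ (x * x ≈ δ)
  nonsquare 2≉0 with all? (λ i → any? (λ j → (enum j * enum j) ≈? enum i))
  ... | no ¬all with ¬∀⟶∃¬ q _ (λ i → any? (λ j → (enum j * enum j) ≈? enum i)) ¬all
  ...   | i , ¬any = enum i , λ x e → ¬any (index x , trans (*-cong (enum-index x) (enum-index x)) e)
  nonsquare 2≉0 | yes sqrt = contradiction (injective⇒≤ {f = g} g-inj) ℕ.1+n≰n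
    where
    ρ : Fin q → Fin q
    ρ i = proj₁ (sqrt i)
    ρ² : ∀ i → enum (ρ i) * enum (ρ i) ≈ enum i
    ρ² i = proj₂ (sqrt i)
    ρ-inj : ∀ {i j} → ρ i ≡ ρ j → i ≡ j
    ρ-inj {i} {j} e = enum-injective (trans (sym (ρ² i)) (trans (reflexive (≡.cong (λ k → enum k * enum k) e)) (ρ² j)))
    one : Fin q
    one = index 1#
    u : Carrier
    u = enum (ρ one)
    u²≈1 : u * u ≈ 1#
    u²≈1 = trans (ρ² one) (enum-index 1#)
    -u∉ρ : ∀ i → ¬ index (- u) ≡ ρ i
    -u∉ρ i e = 2≉0 (cancel u (1# + 1#) (begin
        u * (1# + 1#)   ≈⟨ solve 1 (λ u → u :* (con (+ 1) :+ con (+ 1)) := u :- (:- u)) refl u ⟩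
        u - (- u)       ≈⟨ +-congˡ (-‿cong -u≈ρi) ⟩
        u - enum (ρ i)  ≡⟨ ≡.cong (λ k → u - enum (ρ k)) i≡one ⟩
        u - u           ≈⟨ -‿inverseʳ u ⟩
        0#              ∎) (λ u≈0 → 1≉0 (trans (sym u²≈1) (trans (*-congʳ u≈0) (zeroˡ u)))))
      where
      -u≈ρi : - u ≈ enum (ρ i)
      -u≈ρi = trans (sym (enum-index (- u))) (reflexive (≡.cong enum e))
      i≡one : i ≡ one
      i≡one = enum-injective (begin
        enum i                   ≈⟨ ρ² i ⟨
        enum (ρ i) * enum (ρ i)  ≈⟨ *-cong -u≈ρi -u≈ρi ⟨
        (- u) * (- u)            ≈⟨ solve 1 (λ u → (:- u) :* (:- u) := u :* u) refl u ⟩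
        u * u                    ≈⟨ ρ² one ⟩
        enum one                 ∎)
    g : Fin (suc q) → Fin q
    g zero    = index (- u)
    g (suc i) = ρ i
    g-inj : ∀ {i j} → g i ≡ g j → i ≡ j
    g-inj {zero}  {zero}  e = ≡.refl
    g-inj {zero}  {suc j} e = contradiction e (-u∉ρ j)
    g-inj {suc i} {zero}  e = contradiction (≡.sym e) (-u∉ρ i)
    g-inj {suc i} {suc j} e = ≡.cong suc (ρ-inj e)

module QuadraticExtension {c ℓ} (F : CommutativeRing c ℓ) {q : ℕ} (FF : IsFiniteField F q)
  (δ : CommutativeRing.Carrier F)
  (nonsquare : ∀ x → ¬ CommutativeRing._≈_ F (CommutativeRing._*_ F x x) δ) where
  open CommutativeRing F hiding (zero)
  open FiniteField F FF
  open Quadratic F δ public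
  open IntegerSolver F
  open import Relation.Binary.Reasoning.Setoid setoid
  open import Algebra.Properties.Ring ring using (x∙y⁻¹≈ε⇒x≈y)
  private module L = CommutativeRing quadraticRing

  norm : L.Carrier → Carrier
  norm (a , b) = a * a - δ * (b * b)

  -- A zero of the norm with b nonzero would give (a/b)² = δ.
  norm≈0 : ∀ x → norm x ≈ 0# → x L.≈ L.0#
  norm≈0 (a , b) e with b ≈? 0#
  ... | yes b≈0 = a≈0 , b≈0
    where
    a≈0 : a ≈ 0#
    a≈0 with a ≈? 0#
    ... | yes p = p
    ... | no n  = cancel a a (begin
      a * a                              ≈⟨ solve 3 (λ a b δ → a :* a := (a :* a :- δ :* (b :* b)) :+ δ :* b :* b) refl a b δ ⟩
      (a * a - δ * (b * b)) + δ * b * b  ≈⟨ +-cong e (trans (*-congˡ b≈0) (zeroʳ _)) ⟩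
      0# + 0#                            ≈⟨ +-identityˡ _ ⟩
      0# ∎) n
  ... | no b≉0 with inverse b b≉0
  ...   | i , bi≈1 = contradiction (begin
      (a * i) * (a * i)                    ≈⟨ solve 2 (λ a i → (a :* i) :* (a :* i) := (a :* a) :* (i :* i)) refl a i ⟩
      (a * a) * (i * i)                    ≈⟨ *-congʳ (x∙y⁻¹≈ε⇒x≈y _ _ e) ⟩
      (δ * (b * b)) * (i * i)              ≈⟨ solve 3 (λ δ b i → (δ :* (b :* b)) :* (i :* i) := δ :* ((b :* i) :* (b :* i))) refl δ b i ⟩
      δ * ((b * i) * (b * i))              ≈⟨ *-congˡ (*-cong bi≈1 bi≈1) ⟩
      δ * (1# * 1#)                        ≈⟨ solve 1 (λ δ → δ :* (con (+ 1) :* con (+ 1)) := δ) refl δ ⟩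
      δ                                    ∎) (nonsquare (a * i))

  quadraticField : IsFiniteField quadraticRing (q ℕ.* q)
  quadraticField = record
    { 0≉1        = λ e → 0≉1 (proj₁ e)
    ; inverse    = inv
    ; enum       = λ i → enum (proj₁ (remQuot {q} q i)) , enum (proj₂ (remQuot {q} q i))
    ; index      = λ (a , b) → combine (index a) (index b)
    ; enum-index = λ (a , b) →
        trans (reflexive (≡.cong (enum ∘ proj₁) (remQuot-combine (index a) (index b)))) (enum-index a) ,
        trans (reflexive (≡.cong (enum ∘ proj₂) (remQuot-combine (index a) (index b)))) (enum-index b)
    ; index-enum = λ i → ≡.trans (≡.cong₂ combine (index-enum _) (index-enum _)) (combine-remQuot {q} q i)
    ; index-cong = λ (e , e′) → ≡.cong₂ combine (index-cong e) (index-cong e′)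
    }
    where
    inv : ∀ x → ¬ (x L.≈ L.0#) → ∃ λ y → x L.* y L.≈ L.1#
    inv x@(a , b) x≉0 with inverse (norm x) (x≉0 ∘ norm≈0 x)
    ... | i , Ni≈1 = (a * i , - (b * i)) ,
      trans (solve 4 (λ a b δ i → a :* (a :* i) :+ δ :* (b :* (:- (b :* i))) := (a :* a :- δ :* (b :* b)) :* i) refl a b δ i) Ni≈1 ,
      solve 3 (λ a b i → a :* (:- (b :* i)) :+ b :* (a :* i) := con (+ 0)) refl a b i

-- Counting

module Σℕ = Sum ℕ.+-0-commutativeMonoid

⟨_⟩ : ∀ {a} {P : Set a} → Dec P → ℕ
⟨ yes _ ⟩ = 1
⟨ no _ ⟩  = 0

⟨⟩-mono : ∀ {a b} {P : Set a} {Q : Set b} (d : Dec P) (e : Dec Q) → (P → Q) → ⟨ d ⟩ ℕ.≤ ⟨ e ⟩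
⟨⟩-mono (no _)  e       f = z≤n
⟨⟩-mono (yes p) (yes _) f = ℕ.≤-refl
⟨⟩-mono (yes p) (no n)  f = contradiction (f p) n

⟨⟩-cong : ∀ {a b} {P : Set a} {Q : Set b} (d : Dec P) (e : Dec Q) → (P → Q) → (Q → P) → ⟨ d ⟩ ≡ ⟨ e ⟩
⟨⟩-cong d e f g = ℕ.≤-antisym (⟨⟩-mono d e f) (⟨⟩-mono e d g)

⟨⟩-yes : ∀ {a} {P : Set a} (d : Dec P) → P → ⟨ d ⟩ ≡ 1
⟨⟩-yes (yes _) p = ≡.refl
⟨⟩-yes (no n)  p = contradiction p n

⟨⟩-no : ∀ {a} {P : Set a} (d : Dec P) → ¬ P → ⟨ d ⟩ ≡ 0
⟨⟩-no (yes p) n = contradiction p n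
⟨⟩-no (no _)  n = ≡.refl

-- Cardinalities are sums of Iverson brackets, so that double counting becomes an exchange of sums.
count : ∀ {a m} {P : Fin m → Set a} → (∀ i → Dec (P i)) → ℕ
count P? = Σℕ.sum (λ i → ⟨ P? i ⟩)

∑-mono-≤ : ∀ {m} (f g : Fin m → ℕ) → (∀ i → f i ℕ.≤ g i) → Σℕ.sum f ℕ.≤ Σℕ.sum g
∑-mono-≤ {zero}  f g f≤g = z≤n
∑-mono-≤ {suc m} f g f≤g = ℕ.+-mono-≤ (f≤g zero) (∑-mono-≤ (f ∘ suc) (g ∘ suc) (f≤g ∘ suc))

∑-const : ∀ m c → Σℕ.sum {m} (λ _ → c) ≡ m ℕ.* c
∑-const zero    c = ≡.refl
∑-const (suc m) c = ≡.cong (c ℕ.+_) (∑-const m c)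

∑-≤-const : ∀ {m} (f : Fin m → ℕ) c → (∀ i → f i ℕ.≤ c) → Σℕ.sum f ℕ.≤ m ℕ.* c
∑-≤-const {m} f c f≤c = ≡.subst (Σℕ.sum f ℕ.≤_) (∑-const m c) (∑-mono-≤ f (λ _ → c) f≤c)

∑-≥-const : ∀ {m} (f : Fin m → ℕ) c → (∀ i → c ℕ.≤ f i) → m ℕ.* c ℕ.≤ Σℕ.sum f
∑-≥-const {m} f c c≤f = ≡.subst (ℕ._≤ Σℕ.sum f) (∑-const m c) (∑-mono-≤ (λ _ → c) f c≤f)

≤-∑ : ∀ {m} (f : Fin m → ℕ) i → f i ℕ.≤ Σℕ.sum f
≤-∑ f zero    = ℕ.m≤m+n _ _
≤-∑ f (suc i) = ℕ.≤-trans (≤-∑ (f ∘ suc) i) (ℕ.m≤n+m _ _)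

-- One term below `c` would already push the sum below `m * c`.
∑-saturated : ∀ {m} (f : Fin m → ℕ) c → (∀ i → f i ℕ.≤ c) → m ℕ.* c ℕ.≤ Σℕ.sum f → ∀ i → f i ≡ c
∑-saturated {suc m} f c f≤c full i with f i ℕ.≟ c
... | yes e = e
... | no n  = contradiction full (ℕ.<⇒≱ (begin-strict
  Σℕ.sum f                                  ≡⟨ Σℕ.sum-remove {i = i} f ⟩
  f i ℕ.+ Σℕ.sum (λ j → f (punchIn i j))    <⟨ ℕ.+-monoˡ-< _ (ℕ.≤∧≢⇒< (f≤c i) n) ⟩
  c ℕ.+ Σℕ.sum (λ j → f (punchIn i j))      ≤⟨ ℕ.+-monoʳ-≤ c (∑-≤-const _ c (λ j → f≤c (punchIn i j))) ⟩
  c ℕ.+ m ℕ.* c                             ∎))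
  where open ℕ.≤-Reasoning

∑-∣ : ∀ {m} n (f : Fin m → ℕ) → (∀ i → n ∣ f i) → n ∣ Σℕ.sum f
∑-∣ {zero}  n f n∣f = n ∣0
∑-∣ {suc m} n f n∣f = ∣m∣n⇒∣m+n (n∣f zero) (∑-∣ n (f ∘ suc) (n∣f ∘ suc))

∑-*ˡ : ∀ {m} c (f : Fin m → ℕ) → Σℕ.sum (λ i → c ℕ.* f i) ≡ c ℕ.* Σℕ.sum f
∑-*ˡ {zero}  c f = ≡.sym (ℕ.*-zeroʳ c)
∑-*ˡ {suc m} c f = ≡.trans (≡.cong (c ℕ.* f zero ℕ.+_) (∑-*ˡ c (f ∘ suc))) (≡.sym (ℕ.*-distribˡ-+ c (f zero) _))

∑-zero : ∀ {m} (f : Fin m → ℕ) → (∀ i → f i ≡ 0) → Σℕ.sum f ≡ 0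
∑-zero {m} f f≡0 = ≡.trans (Σℕ.sum-cong-≗ f≡0) (≡.trans (∑-const m 0) (ℕ.*-zeroʳ m))

module _ {a m} {P : Fin m → Set a} where

  count-none : (P? : ∀ i → Dec (P i)) → (∀ i → ¬ P i) → count P? ≡ 0
  count-none P? n = ∑-zero _ (λ i → ⟨⟩-no (P? i) (n i))

  count-all : (P? : ∀ i → Dec (P i)) → (∀ i → P i) → count P? ≡ m
  count-all P? al = ≡.trans (Σℕ.sum-cong-≗ (λ i → ⟨⟩-yes (P? i) (al i))) (≡.trans (∑-const m 1) (ℕ.*-identityʳ m))

  count-≤1 : (P? : ∀ i → Dec (P i)) → (∀ i j → P i → P j → i ≡ j) → count P? ℕ.≤ 1
  count-≤1 = go
    where
    go : ∀ {m} {P : Fin m → Set a} (P? : ∀ i → Dec (P i)) → (∀ i j → P i → P j → i ≡ j) → count P? ℕ.≤ 1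
    go {zero}  P? u = z≤n
    go {suc m} P? u with P? zero
    ... | no _  = go (P? ∘ suc) (λ i j p r → suc-injective (u _ _ p r))
    ... | yes p = s≤s (ℕ.≤-reflexive (∑-zero _ (λ i → ⟨⟩-no (P? (suc i)) (λ r → case u _ _ p r of λ ()))))

  count-≥1 : (P? : ∀ i → Dec (P i)) → ∀ i → P i → 1 ℕ.≤ count P?
  count-≥1 P? i p = ℕ.≤-trans (ℕ.≤-reflexive (≡.sym (⟨⟩-yes (P? i) p))) (≤-∑ _ i)

  count-unique : (P? : ∀ i → Dec (P i)) → ∀ i → P i → (∀ j → P j → j ≡ i) → count P? ≡ 1
  count-unique P? i p u = ℕ.≤-antisym (count-≤1 P? (λ j k pj pk → ≡.trans (u j pj) (≡.sym (u k pk)))) (count-≥1 P? i p)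

  count-find : (P? : ∀ i → Dec (P i)) → 0 ℕ.< count P? → ∃ P
  count-find = go
    where
    go : ∀ {m} {P : Fin m → Set a} (P? : ∀ i → Dec (P i)) → 0 ℕ.< count P? → ∃ P
    go {suc m} P? 0<c with P? zero
    ... | yes p = zero , p
    ... | no _  with go (P? ∘ suc) 0<c
    ...   | i , p = suc i , p

count-mono : ∀ {a b m} {P : Fin m → Set a} {Q : Fin m → Set b} (P? : ∀ i → Dec (P i)) (Q? : ∀ i → Dec (Q i)) →
             (∀ i → P i → Q i) → count P? ℕ.≤ count Q?
count-mono P? Q? f = ∑-mono-≤ _ _ (λ i → ⟨⟩-mono (P? i) (Q? i) (f i))

count-cong : ∀ {a b m} {P : Fin m → Set a} {Q : Fin m → Set b} (P? : ∀ i → Dec (P i)) (Q? : ∀ i → Dec (Q i)) →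
             (∀ i → P i → Q i) → (∀ i → Q i → P i) → count P? ≡ count Q?
count-cong P? Q? f g = ℕ.≤-antisym (count-mono P? Q? f) (count-mono Q? P? g)

members : ∀ {a m} {P : Fin m → Set a} (P? : ∀ i → Dec (P i)) → Fin (count P?) → Fin m
members {m = suc m} P? i with P? zero
members {m = suc m} P? zero    | yes _ = zero
members {m = suc m} P? (suc i) | yes _ = suc (members (P? ∘ suc) i)
members {m = suc m} P? i       | no _  = suc (members (P? ∘ suc) i)

members-∈ : ∀ {a m} {P : Fin m → Set a} (P? : ∀ i → Dec (P i)) i → P (members P? i)
members-∈ {m = suc m} P? i with P? zero
members-∈ {m = suc m} P? zero    | yes p = p
members-∈ {m = suc m} P? (suc i) | yes _ = members-∈ (P? ∘ suc) i
members-∈ {m = suc m} P? i       | no _  = members-∈ (P? ∘ suc) i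

members-injective : ∀ {a m} {P : Fin m → Set a} (P? : ∀ i → Dec (P i)) i j → members P? i ≡ members P? j → i ≡ j
members-injective {m = suc m} P? i j e with P? zero
members-injective {m = suc m} P? zero    zero    e | yes _ = ≡.refl
members-injective {m = suc m} P? zero    (suc j) () | yes _
members-injective {m = suc m} P? (suc i) zero    () | yes _
members-injective {m = suc m} P? (suc i) (suc j) e | yes _ = ≡.cong suc (members-injective (P? ∘ suc) i j (suc-injective e))
members-injective {m = suc m} P? i       j       e | no _  = members-injective (P? ∘ suc) i j (suc-injective e)

-- Stated for an arbitrary commutative monoid because it serves sums of field elements, products of
-- series and sums of natural numbers.
module MonoidCount {c ℓ} (M : CommutativeMonoid c ℓ) where
  open CommutativeMonoid M
  open Sum M using (sum)
  open import Algebra.Properties.Monoid.Mult monoid using (×-homo-+) renaming (_×_ to _·_)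

  ∑-indicator : ∀ {a m} {P : Fin m → Set a} (P? : ∀ i → Dec (P i)) x → sum (λ i → ⟨ P? i ⟩ · x) ≈ count P? · x
  ∑-indicator {m = zero}  P? x = refl
  ∑-indicator {m = suc m} P? x = trans (∙-congˡ (∑-indicator (P? ∘ suc) x)) (sym (×-homo-+ x ⟨ P? zero ⟩ _))

  ∑-members : ∀ {a m} {P : Fin m → Set a} (P? : ∀ i → Dec (P i)) (f : Fin m → Carrier) →
              sum (λ i → f (members P? i)) ≈ sum (λ i → ⟨ P? i ⟩ · f i)
  ∑-members {m = zero}  P? f = refl
  ∑-members {m = suc m} P? f with P? zero
  ... | yes _ = ∙-cong (sym (identityʳ _)) (∑-members (P? ∘ suc) (f ∘ suc))
  ... | no _  = trans (∑-members (P? ∘ suc) (f ∘ suc)) (sym (identityˡ _))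

  ∑-single : ∀ {m} (f : Fin m → Carrier) i → (∀ j → ¬ j ≡ i → f j ≈ ε) → sum f ≈ f i
  ∑-single {suc m} f i z = trans (Sum.sum-remove M {i = i} f)
    (trans (∙-congˡ (trans (Sum.sum-cong-≋ M (λ j → z (punchIn i j) (punchInᵢ≢i i j))) (Sum.sum-replicate-zero M m))) (identityʳ _))

-- Elementary symmetric functions

module ElementarySymmetric {c ℓ} (R : CommutativeRing c ℓ) where
  open CommutativeRing R hiding (zero)
  open PowerSeries R
  open Degree R
  open SeriesPowers R
  open Frobenius R
  open IntegerSolver R
  open import Algebra.Properties.Ring ring using (-0#≈0#)
  module ⅀ = Sum +-commutativeMonoid
  module Π = Sum *-commutativeMonoid
  module ΠS = Sum S.*-commutativeMonoid

  -- es a k is the coefficient of T^k in ∏ⱼ (1 - aⱼ T), i.e. (-1)^k times the k-th elementary symmetric function.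
  es : ∀ {m} → (Fin m → Carrier) → Series
  es {zero}  a k       = S.1# k
  es {suc m} a zero    = es (a ∘ suc) zero
  es {suc m} a (suc k) = es (a ∘ suc) (suc k) - a zero * es (a ∘ suc) k

  factor : Carrier → Series
  factor a zero          = 1#
  factor a (suc zero)    = - a
  factor a (suc (suc k)) = 0#

  factor-⊛ : ∀ a f k → (factor a ⊛ f) (suc k) ≈ f (suc k) - a * f k
  factor-⊛ a f zero    = solve 3 (λ a x y → con (+ 1) :* x :+ (:- a) :* y := x :- a :* y) refl a (f 1) (f 0)
  factor-⊛ a f (suc k) = trans (+-congˡ (+-congˡ (0⊛ f k)))
    (solve 3 (λ a x y → con (+ 1) :* x :+ ((:- a) :* y :+ con (+ 0)) := x :- a :* y) refl a _ _)

  factor-cong : ∀ {a b} → a ≈ b → factor a S.≈ factor b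
  factor-cong e zero          = refl
  factor-cong e (suc zero)    = -‿cong e
  factor-cong e (suc (suc k)) = refl

  factor-0 : ∀ {a} → a ≈ 0# → factor a S.≈ S.1#
  factor-0 e zero          = refl
  factor-0 e (suc zero)    = trans (-‿cong e) -0#≈0#
  factor-0 e (suc (suc k)) = refl

  Deg≤-factor : ∀ a → Deg≤ 1 (factor a)
  Deg≤-factor a (suc zero)    (s≤s ())
  Deg≤-factor a (suc (suc k)) _ = refl

  es-suc : ∀ {m} (a : Fin (suc m) → Carrier) → es a S.≈ factor (a zero) ⊛ es (a ∘ suc)
  es-suc a zero    = sym (*-identityˡ _)
  es-suc a (suc k) = sym (factor-⊛ (a zero) (es (a ∘ suc)) k)

  es-∏ : ∀ {m} (a : Fin m → Carrier) → es a S.≈ ΠS.sum (λ j → factor (a j))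
  es-∏ {zero}  a = S.refl
  es-∏ {suc m} a = S.trans (es-suc a) (S.*-congˡ {factor (a zero)} (es-∏ (a ∘ suc)))

  es-cong : ∀ {m} {a b : Fin m → Carrier} → (∀ i → a i ≈ b i) → es a S.≈ es b
  es-cong {a = a} {b} e = S.trans (es-∏ a) (S.trans (ΠS.sum-cong-≋ (λ i → factor-cong (e i))) (S.sym (es-∏ b)))

  Deg≤-es : ∀ {m} (a : Fin m → Carrier) → Deg≤ m (es a)
  Deg≤-es {zero}  a (suc k) _ = refl
  Deg≤-es {suc m} a k m<k = trans (es-suc a k) (Deg≤-⊛ {1} {m} (Deg≤-factor (a zero)) (Deg≤-es (a ∘ suc)) k m<k)

  es-0 : ∀ {m} (a : Fin m → Carrier) → es a 0 ≈ 1#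
  es-0 {zero}  a = refl
  es-0 {suc m} a = es-0 (a ∘ suc)

  es-1 : ∀ {m} (a : Fin m → Carrier) → es a 1 ≈ - ⅀.sum a
  es-1 {zero}  a = sym -0#≈0#
  es-1 {suc m} a = trans (+-cong (es-1 (a ∘ suc)) (-‿cong (*-congˡ (es-0 (a ∘ suc)))))
    (solve 2 (λ x s → :- s :- x :* con (+ 1) := :- (x :+ s)) refl _ _)

  open Evaluation (idMap R)

  ev-es : ∀ {m} (a : Fin m → Carrier) y → ev m (es a) y ≈ Π.sum (λ i → 1# - a i * y)
  ev-es {zero}  a y = refl
  ev-es {suc m} a y = trans (ev-cong (suc m) y (es-suc a))
    (trans (ev-⊛ 1 m y (Deg≤-factor (a zero)) (Deg≤-es (a ∘ suc)))
           (*-cong (solve 2 (λ a y → con (+ 1) :+ y :* (:- a) := con (+ 1) :- a :* y) refl (a zero) y) (ev-es (a ∘ suc) y)))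

  ∏-zero : ∀ {m} (f : Fin m → Carrier) i → f i ≈ 0# → Π.sum f ≈ 0#
  ∏-zero f zero    e = trans (*-congʳ e) (zeroˡ _)
  ∏-zero f (suc i) e = trans (*-congˡ (∏-zero (f ∘ suc) i e)) (zeroʳ _)

  ∏-unital-1 : ∀ {m} (f : Fin m → Series) → (∀ i → f i 0 ≈ 1#) →
               (ΠS.sum f 0 ≈ 1#) × (ΠS.sum f 1 ≈ ⅀.sum (λ i → f i 1))
  ∏-unital-1 {zero}  f f0 = refl , refl
  ∏-unital-1 {suc m} f f0 with ∏-unital-1 (f ∘ suc) (f0 ∘ suc)
  ... | e0 , e1 = trans (*-cong (f0 zero) e0) (*-identityˡ _) ,
    trans (+-cong (*-cong (f0 zero) e1) (*-congˡ e0)) (solve 2 (λ x y → con (+ 1) :* y :+ x :* con (+ 1) := x :+ y) refl _ _)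

  ⊛-zero : ∀ k f g → (∀ i j → i ℕ.+ j ≡ k → f i * g j ≈ 0#) → (f ⊛ g) k ≈ 0#
  ⊛-zero zero    f g z = z 0 0 ≡.refl
  ⊛-zero (suc k) f g z = trans (+-cong (z 0 (suc k) ≡.refl) (⊛-zero k (tail f) g (λ i j e → z (suc i) j (≡.cong suc e)))) (+-identityˡ _)

  -- The hypothesis concerns products, because in the applications sometimes one factor of a mixed
  -- term vanishes and sometimes the other.
  ⊛-head : ∀ k f g → (∀ i j → suc i ℕ.+ j ≡ k → f (suc i) * g j ≈ 0#) → (f ⊛ g) k ≈ f 0 * g k
  ⊛-head zero    f g z = refl
  ⊛-head (suc k) f g z = trans (+-congˡ (⊛-zero k (tail f) g (λ i j e → z i j (≡.cong suc e)))) (+-identityʳ _)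

  ∏-^ : ∀ {m} (f : Fin m → Series) r → ΠS.sum (λ i → f i S.^ r) S.≈ ΠS.sum f S.^ r
  ∏-^ {zero}  f r = S.sym (1^ r)
  ∏-^ {suc m} f r = S.trans (S.*-congˡ {f zero S.^ r} (∏-^ (f ∘ suc) r)) (S.sym (S.^-distrib-* (f zero) (ΠS.sum (f ∘ suc)) r))

  const-^ : ∀ a m → const a S.^ m S.≈ const (a ^ m)
  const-^ a zero    = S.refl
  const-^ a (suc m) = S.trans (S.*-congˡ {const a} (const-^ a m)) (S.trans (const-⊛ a (const (a ^ m))) λ where
    zero    → refl
    (suc k) → zeroʳ a)

  X^-⊛-lt : ∀ m f k → k ℕ.< m → (X S.^ m ⊛ f) k ≈ 0#
  X^-⊛-lt m f k k<m = ⊛-zero k (X S.^ m) f λ i j e →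
    trans (*-congʳ (X^-lt m i (ℕ.≤-<-trans (ℕ.≤-trans (ℕ.m≤m+n i j) (ℕ.≤-reflexive e)) k<m))) (zeroˡ _)

  X^-⊛-+ : ∀ m f k → (X S.^ m ⊛ f) (m ℕ.+ k) ≈ f k
  X^-⊛-+ zero    f k = 1⊛ f k
  X^-⊛-+ (suc m) f k = trans (⊛-cong {f = X S.^ suc m} {g = f} (S.trans (shift-⊛ S.1# (X S.^ m)) sh) S.refl (suc m ℕ.+ k))
                         (trans (shift-⊛ (X S.^ m) f (suc m ℕ.+ k)) (X^-⊛-+ m f k))
    where
    sh : shift (S.1# ⊛ (X S.^ m)) S.≈ shift (X S.^ m)
    sh zero    = refl
    sh (suc k) = 1⊛ (X S.^ m) k

  module _ {p : ℕ} (pp : Prime p) (char : p · 1# ≈ 0#) where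

    series-frobenius : ∀ e f → f S.^ (p ℕ.^ e) S.≈ const (f 0 ^ (p ℕ.^ e)) ⊞ (X S.^ (p ℕ.^ e) ⊛ (tail f S.^ (p ℕ.^ e)))
    series-frobenius e f = S.trans (S.^-congˡ n split) (S.trans (S.frobeniusᵉ pp (series-char {p} char) e (const (f 0)) (X ⊛ tail f))
        (S.+-cong {const (f 0) S.^ n} {const (f 0 ^ n)} {(X ⊛ tail f) S.^ n} (const-^ (f 0) n) (S.^-distrib-* X (tail f) n)))
      where
      n = p ℕ.^ e
      split : f S.≈ const (f 0) ⊞ (X ⊛ tail f)
      split zero    = sym (trans (+-congˡ (zeroˡ _)) (+-identityʳ _))
      split (suc k) = sym (trans (+-identityˡ _) (trans (shift-⊛ S.1# (tail f) (suc k)) (1⊛ (tail f) k)))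

    module _ (e : ℕ) where
      private
        n = p ℕ.^ e
        n>0 : 0 ℕ.< n
        n>0 = ℕ.m^n>0 p {{prime⇒nonZero pp}} e
        const-+ : ∀ a k → const a (n ℕ.+ k) ≈ 0#
        const-+ a k = go n n>0
          where
          go : ∀ m → 0 ℕ.< m → const a (m ℕ.+ k) ≈ 0#
          go (suc m) _ = refl

      ^p^e-0 : ∀ f → (f S.^ n) 0 ≈ f 0 ^ n
      ^p^e-0 f = trans (series-frobenius e f 0) (trans (+-congˡ (X^-⊛-lt n (tail f S.^ n) 0 n>0)) (+-identityʳ _))

      ^p^e-+ : ∀ f k → (f S.^ n) (n ℕ.+ k) ≈ (tail f S.^ n) k
      ^p^e-+ f k = trans (series-frobenius e f (n ℕ.+ k)) (trans (+-cong (const-+ _ k) (X^-⊛-+ n (tail f S.^ n) k)) (+-identityˡ _))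

      ^p^e-n : ∀ f → (f S.^ n) n ≈ f 1 ^ n
      ^p^e-n f = trans (reflexive (≡.cong (f S.^ n) (≡.sym (ℕ.+-identityʳ n)))) (trans (^p^e-+ f 0) (^p^e-0 (tail f)))

      -- In characteristic p a p^e-th power is a series in T^(p^e): removing the constant term by
      -- `series-frobenius` shifts the index by n and leaves again such a power.
      ^p^e-∤ : ∀ f k → ¬ (n ∣ k) → (f S.^ n) k ≈ 0#
      ^p^e-∤ f k = go k f k ℕ.≤-refl
        where
        go : ∀ b f k → k ℕ.≤ b → ¬ (n ∣ k) → (f S.^ n) k ≈ 0#
        go b f k k≤b n∤k with k ℕ.<? n
        go b f zero    k≤b n∤k | _ = contradiction (n ∣0) n∤k
        go b f (suc k) k≤b n∤k | yes k<n = trans (series-frobenius e f (suc k)) (trans (+-congˡ (X^-⊛-lt n (tail f S.^ n) (suc k) k<n)) (+-identityˡ _))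
        go (suc b) f k@(suc _) k≤b n∤k | no k≮n =
          trans (reflexive (≡.cong (f S.^ n) (≡.sym k≡)))
            (trans (^p^e-+ f k′) (go b (tail f) k′ k′≤b λ n∣k′ → n∤k (≡.subst (n ∣_) k≡ (∣m∣n⇒∣m+n ∣-refl n∣k′))))
          where
          k′ = k ℕ.∸ n
          k≡ : n ℕ.+ k′ ≡ k
          k≡ = ℕ.m+[n∸m]≡n (ℕ.≮⇒≥ k≮n)
          k′≤b : k′ ℕ.≤ b
          k′≤b = ℕ.≤-pred (ℕ.≤-trans (ℕ.≤-trans (ℕ.+-monoˡ-≤ k′ n>0) (ℕ.≤-reflexive k≡)) k≤b)

      sum-^ : ∀ {m} (f : Fin m → Carrier) → ⅀.sum f ^ n ≈ ⅀.sum (λ i → f i ^ n)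
      sum-^ {zero}  f = 0^p^e pp char e
      sum-^ {suc m} f = trans (frobeniusᵉ pp char e _ _) (+-congˡ (sum-^ (f ∘ suc)))

-- Maximal arcs in the affine plane

-- AG(2,q) is identified with the field L of order q²; the direction of the line through x and y is (x - y)^(q-1),
-- and the field dir lists the q + 1 directions.
record MaximalArc {c ℓ} (L : CommutativeRing c ℓ) (q n′ : ℕ) : Set (c ⊔ ℓ) where
  open CommutativeRing L hiding (zero)
  open Frobenius L
  field
    isFiniteField : IsFiniteField L (q ℕ.* q)
  open Codes L isFiniteField using (_≈?_)
  field
    {p h}         : ℕ
    prime         : Prime p
    char          : p · 1# ≈ 0#
    q≡p^h         : q ≡ p ℕ.^ h
    2≤n′          : 2 ℕ.≤ n′
    n<q           : suc n′ ℕ.< q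
    b             : Fin (suc (n′ ℕ.* suc q)) → Carrier
    b-injective   : ∀ i j → b i ≈ b j → i ≡ j
    dir           : Fin (suc q) → Carrier
    dir-injective : ∀ i j → dir i ≈ dir j → i ≡ j
    dir^          : ∀ i → dir i ^ suc q ≈ 1#
    dir-of        : ∀ u → ¬ (u ≈ 0#) → ∃ λ i → u ^ (q ℕ.∸ 1) ≈ dir i
    -- The point `b j` has slope 0 as seen from itself, and 0 is no direction; hence the bound is
    -- `n′` and not n′ + 1.
    line-≤        : ∀ j i → count (λ j′ → ((b j - b j′) ^ (q ℕ.∸ 1)) ≈? dir i) ℕ.≤ n′

arcSize<q² : ∀ n′ q → suc n′ ℕ.< q → suc (n′ ℕ.* suc q) ℕ.< q ℕ.* q
arcSize<q² n′ q n<q = ℕ.+-cancelʳ-< q _ (q ℕ.* q) (begin-strict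
  suc (n′ ℕ.* suc q) ℕ.+ q     ≡⟨ ≡.cong suc (ℕ.+-comm (n′ ℕ.* suc q) q) ⟩
  suc n′ ℕ.* suc q             ≡⟨ ℕ.*-suc (suc n′) q ⟩
  suc n′ ℕ.+ suc n′ ℕ.* q      <⟨ ℕ.+-monoˡ-≤ (suc n′ ℕ.* q) n<q ⟩
  suc (suc n′) ℕ.* q           ≤⟨ ℕ.*-monoˡ-≤ q n<q ⟩
  q ℕ.* q                      ≤⟨ ℕ.m≤m+n _ q ⟩
  q ℕ.* q ℕ.+ q                ∎)
  where open ℕ.≤-Reasoning

module Secants {c ℓ} {L : CommutativeRing c ℓ} {q n′ : ℕ} (arc : MaximalArc L q n′) where
  open CommutativeRing L hiding (zero)
  open MaximalArc arc public
  open FiniteField L isFiniteField public hiding (1<q; suc[q∸1])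
  open Frobenius L
  open IntegerSolver L
  open import Relation.Binary.Reasoning.Setoid setoid

  N n r : ℕ
  N = suc (n′ ℕ.* suc q)
  n = suc n′
  r = q ℕ.∸ 1

  suc-r : suc r ≡ q
  suc-r = ℕ.m+[n∸m]≡n (ℕ.≤-trans (s≤s z≤n) (ℕ.<⇒≤ n<q))

  0^r : 0# ^ r ≈ 0#
  0^r = go r (ℕ.≤-pred (ℕ.≤-trans (s≤s (s≤s z≤n)) (ℕ.≤-trans n<q (ℕ.≤-reflexive (≡.sym suc-r)))))
    where
    go : ∀ m → 0 ℕ.< m → 0# ^ m ≈ 0#
    go (suc m) _ = zeroˡ _

  dir≉0 : ∀ i → ¬ (dir i ≈ 0#)
  dir≉0 i e = 1≉0 (trans (sym (dir^ i)) (trans (*-congʳ e) (zeroˡ _)))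

  sub-^q : ∀ x y → (x - y) ^ q ≈ x ^ q - y ^ q
  sub-^q x y = ≡.subst (λ m → (x - y) ^ m ≈ x ^ m - y ^ m) (≡.sym q≡p^h) (frobeniusᵉ-sub prime char h x y)

  -- The equation x^(q-1) = d is not additive in x, but x^q = x d is. Directions are therefore
  -- compared in the second form.
  ^r⇒^q : ∀ {x d} → x ^ r ≈ d → x ^ q ≈ x * d
  ^r⇒^q {x} e = trans (^-congʳ x (≡.sym suc-r)) (*-congˡ e)

  ^q⇒^r : ∀ {x d} → ¬ (x ≈ 0#) → x ^ q ≈ x * d → x ^ r ≈ d
  ^q⇒^r {x} {d} x≉0 e = *-cancelʳ-≉0 x≉0 (begin
    x ^ r * x    ≈⟨ *-comm _ _ ⟩
    x ^ suc r    ≈⟨ ^-congʳ x suc-r ⟩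
    x ^ q        ≈⟨ e ⟩
    x * d        ≈⟨ *-comm _ _ ⟩
    d * x        ∎)

  sub-dir : ∀ {x y d} → x ^ r ≈ d → y ^ r ≈ d → ¬ (x - y ≈ 0#) → (x - y) ^ r ≈ d
  sub-dir {x} {y} {d} ex ey x≉y = ^q⇒^r x≉y (begin
    (x - y) ^ q      ≈⟨ sub-^q x y ⟩
    x ^ q - y ^ q    ≈⟨ +-cong (^r⇒^q ex) (-‿cong (^r⇒^q ey)) ⟩
    x * d - y * d    ≈⟨ solve 3 (λ x y d → x :* d :- y :* d := (x :- y) :* d) refl x y d ⟩
    (x - y) * d      ∎)

  sub≉0 : ∀ {x y} → ¬ (x ≈ y) → ¬ (x - y ≈ 0#)
  sub≉0 n e = n (x∙y⁻¹≈ε⇒x≈y _ _ e)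
    where open import Algebra.Properties.Ring ring using (x∙y⁻¹≈ε⇒x≈y)

  slope : Carrier → Fin N → Carrier
  slope z j = (z - b j) ^ r

  slope-self : ∀ {z j} → z ≈ b j → slope z j ≈ 0#
  slope-self e = trans (^-congˡ r (trans (+-congʳ e) (-‿inverseʳ _))) 0^r

  onLine : Carrier → Fin (suc q) → ℕ
  onLine z i = count (λ j → slope z j ≈? dir i)

  slope-class : ∀ z j → ¬ (z ≈ b j) → ∃ λ i → slope z j ≈ dir i
  slope-class z j n = dir-of (z - b j) (sub≉0 n)

  ∑-onLine : ∀ z → Σℕ.sum (onLine z) ℕ.+ count (λ j → z ≈? b j) ≡ N
  ∑-onLine z = ≡.trans (≡.cong (ℕ._+ count (λ j → z ≈? b j)) (Σℕ.∑-comm (λ i j → ⟨ slope z j ≈? dir i ⟩)))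
    (≡.trans (≡.sym (Σℕ.∑-distrib-+ (λ j → count (λ i → slope z j ≈? dir i)) (λ j → ⟨ z ≈? b j ⟩)))
    (≡.trans (Σℕ.sum-cong-≗ one) (≡.trans (∑-const N 1) (ℕ.*-identityʳ N))))
    where
    one : ∀ j → count (λ i → slope z j ≈? dir i) ℕ.+ ⟨ z ≈? b j ⟩ ≡ 1
    one j with z ≈? b j
    ... | yes e = ≡.cong (ℕ._+ 1) (count-none (λ i → slope z j ≈? dir i) (λ i e′ → dir≉0 i (trans (sym e′) (slope-self e))))
    ... | no n with slope-class z j n
    ...   | i , e = ≡.trans (ℕ.+-identityʳ _) (count-unique (λ i → slope z j ≈? dir i) i e
              (λ i′ e′ → dir-injective _ _ (trans (sym e′) e)))

  -- The q + 1 lines through an arc point carry at most n′ further points each and N - 1 = n′(q + 1)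
  -- in total, so every bound is attained.
  onLine-point : ∀ j i → onLine (b j) i ≡ n′
  onLine-point j = ∑-saturated (onLine (b j)) n′ (line-≤ j) (ℕ.≤-reflexive (≡.sym (ℕ.+-cancelʳ-≡ 1 _ _ (≡.trans
    (≡.cong (Σℕ.sum (onLine (b j)) ℕ.+_) (≡.sym (count-unique (λ j′ → b j ≈? b j′) j refl (λ j′ e → b-injective _ _ (sym e)))))
    (≡.trans (∑-onLine (b j)) (≡.trans (≡.cong suc (ℕ.*-comm n′ (suc q))) (ℕ.+-comm 1 _)))))))

  Outside : Carrier → Set ℓ
  Outside z = ∀ j → ¬ (z ≈ b j)

  -- On the line through z and `b j`, the points other than `b j` are those which `b j` sees in the
  -- same direction, and there are `n′` of them.
  onLine-outside : ∀ {z} → Outside z → ∀ {i j} → slope z j ≈ dir i → onLine z i ≡ n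
  onLine-outside {z} out {i} {j} ej = ≡.trans (Σℕ.sum-cong-≗ split) (≡.trans
      (Σℕ.∑-distrib-+ (λ j′ → ⟨ j′ ≟ᶠ j ⟩) (λ j′ → ⟨ slope (b j) j′ ≈? dir i ⟩))
      (≡.cong₂ ℕ._+_ (count-unique (_≟ᶠ j) j ≡.refl (λ _ e → e)) (onLine-point j i)))
    where
    split : ∀ j′ → ⟨ slope z j′ ≈? dir i ⟩ ≡ ⟨ j′ ≟ᶠ j ⟩ ℕ.+ ⟨ slope (b j) j′ ≈? dir i ⟩
    split j′ with j′ ≟ᶠ j
    ... | yes ≡.refl = ≡.trans (⟨⟩-yes (slope z j ≈? dir i) ej)
          (≡.cong suc (≡.sym (⟨⟩-no (slope (b j) j ≈? dir i) (λ e → dir≉0 i (trans (sym e) (slope-self refl))))))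
    ... | no j′≢j = ⟨⟩-cong (slope z j′ ≈? dir i) (slope (b j) j′ ≈? dir i) to from
      where
      bj≉bj′ : ¬ (b j ≈ b j′)
      bj≉bj′ e = j′≢j (≡.sym (b-injective _ _ e))
      to : slope z j′ ≈ dir i → slope (b j) j′ ≈ dir i
      to e = trans (^-congˡ r eq) (sub-dir e ej (λ e′ → sub≉0 bj≉bj′ (trans eq e′)))
        where
        eq : b j - b j′ ≈ (z - b j′) - (z - b j)
        eq = solve 3 (λ z x y → x :- y := (z :- y) :- (z :- x)) refl z (b j) (b j′)
      from : slope (b j) j′ ≈ dir i → slope z j′ ≈ dir i
      from e = trans (^-congˡ r eq) (sub-dir ej (neg e) (λ e′ → sub≉0 (out j′) (trans eq e′)))
        where
        eq : z - b j′ ≈ (z - b j) - (b j′ - b j)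
        eq = solve 3 (λ z x y → z :- y := (z :- x) :- (y :- x)) refl z (b j) (b j′)
        neg : slope (b j) j′ ≈ dir i → (b j′ - b j) ^ r ≈ dir i
        neg e = trans (^-congˡ r (solve 2 (λ x y → y :- x := con (+ 0) :- (x :- y)) refl (b j) (b j′)))
          (^q⇒^r (λ e′ → sub≉0 bj≉bj′ (begin
              b j - b j′                ≈⟨ solve 2 (λ x y → x :- y := :- (con (+ 0) :- (x :- y))) refl (b j) (b j′) ⟩
              - (0# - (b j - b j′))     ≈⟨ -‿cong e′ ⟩
              - 0#                      ≈⟨ solve 0 (:- (con (+ 0)) := con (+ 0)) refl ⟩
              0#                        ∎)) (begin
            (0# - (b j - b j′)) ^ q          ≈⟨ sub-^q 0# (b j - b j′) ⟩
            0# ^ q - (b j - b j′) ^ q        ≈⟨ +-cong (trans (^r⇒^q 0^r) (zeroˡ _)) (-‿cong (^r⇒^q e)) ⟩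
            0# - (b j - b j′) * dir i        ≈⟨ solve 2 (λ x d → con (+ 0) :- x :* d := (con (+ 0) :- x) :* d) refl _ _ ⟩
            (0# - (b j - b j′)) * dir i      ∎))

  onLine-0∨n : ∀ {z} → Outside z → ∀ i → onLine z i ≡ 0 ⊎ onLine z i ≡ n
  onLine-0∨n {z} out i with onLine z i ℕ.≟ 0
  ... | yes e = inj₁ e
  ... | no ≢0 with count-find (λ j → slope z j ≈? dir i) (ℕ.n≢0⇒n>0 ≢0)
  ...   | j , e = inj₂ (onLine-outside out e)

  ∑-onLine-outside : ∀ {z} → Outside z → Σℕ.sum (onLine z) ≡ N
  ∑-onLine-outside {z} out = ≡.trans (≡.sym (ℕ.+-identityʳ _))
    (≡.trans (≡.cong (Σℕ.sum (onLine z) ℕ.+_) (≡.sym (count-none (λ j → z ≈? b j) out))) (∑-onLine z))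

  N+q≡n[q+1] : N ℕ.+ q ≡ n ℕ.* suc q
  N+q≡n[q+1] = ≡.cong suc (ℕ.+-comm (n′ ℕ.* suc q) q)

  N<q² : N ℕ.< q ℕ.* q
  N<q² = arcSize<q² n′ q n<q

  outside-point : ∃ Outside
  outside-point with any? (λ i → all? (λ j → ¬? (enum i ≈? b j)))
  ... | yes (i , out) = enum i , out
  ... | no none = contradiction (injective⇒≤ {f = f} f-inj) (ℕ.<⇒≱ N<q²)
    where
    cover : ∀ i → ∃ λ j → enum i ≈ b j
    cover i with any? (λ j → enum i ≈? b j)
    ... | yes p = p
    ... | no n  = contradiction (i , λ j e → n (j , e)) none
    f : Fin (q ℕ.* q) → Fin N
    f i = proj₁ (cover i)
    f-inj : ∀ {i j} → f i ≡ f j → i ≡ j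
    f-inj {i} {j} e = enum-injective (trans (proj₂ (cover i)) (trans (reflexive (≡.cong b e)) (sym (proj₂ (cover j)))))

  -- Seen from a point outside, the arc is distributed over lines with 0 or n points each.
  n∣N : n ∣ N
  n∣N with outside-point
  ... | z , out = ≡.subst (n ∣_) (∑-onLine-outside out) (∑-∣ n (onLine z) λ i → case onLine-0∨n out i of λ where
    (inj₁ e) → ≡.subst (n ∣_) (≡.sym e) (n ∣0)
    (inj₂ e) → ≡.subst (n ∣_) (≡.sym e) ∣-refl)

  n∣q : n ∣ q
  n∣q = ∣m+n∣m⇒∣n (≡.subst (n ∣_) (≡.sym N+q≡n[q+1]) (m∣m*n (suc q))) n∣N

module RootProducts {c ℓ} (L : CommutativeRing c ℓ) {Q : ℕ} (LF : IsFiniteField L Q) where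
  open CommutativeRing L hiding (zero)
  open FiniteField L LF
  open PowerSeries L
  open Degree L
  open Evaluation (idMap L)
  open ElementarySymmetric L
  open IntegerSolver L
  open import Relation.Binary.Reasoning.Setoid setoid

  -- The difference of f and f(0) ∏(1 - xᵢ T) has degree at most m and vanishes at 0 and at the m
  -- points yᵢ = 1/xᵢ, which are distinct and nonzero.
  fromRoots : ∀ m f (x y : Fin m → Carrier) → (∀ i → x i * y i ≈ 1#) → (∀ i j → y i ≈ y j → i ≡ j) →
              (∀ i → ev m f (y i) ≈ 0#) → ∀ k → k ℕ.≤ m → f k ≈ f 0 * es x k
  fromRoots m f x y xy y-inj root zero _ = sym (trans (*-congˡ (es-0 x)) (*-identityʳ _))
  fromRoots (suc m) f x y xy y-inj root (suc k) (s≤s k≤m) = begin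
    f (suc k)                         ≈⟨ solve 3 (λ a b c → a := (a :+ (:- b) :* c) :+ b :* c) refl _ _ _ ⟩
    h (suc k) + f 0 * es x (suc k)    ≈⟨ +-congʳ hk≈0 ⟩
    0# + f 0 * es x (suc k)           ≈⟨ +-identityˡ _ ⟩
    f 0 * es x (suc k)                ∎
    where
    h : Series
    h = f ⊞ ((- f 0) • es x)
    y≉0 : ∀ i → ¬ (y i ≈ 0#)
    y≉0 i e = 1≉0 (trans (sym (xy i)) (trans (*-congˡ e) (zeroʳ _)))
    es-root : ∀ i → ev (suc m) (es x) (y i) ≈ 0#
    es-root i = trans (ev-es x (y i)) (∏-zero (λ j → 1# - x j * y i) i (trans (+-congˡ (-‿cong (xy i))) (-‿inverseʳ 1#)))
    h0 : h 0 ≈ 0#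
    h0 = trans (+-congˡ (*-congˡ (es-0 x))) (solve 1 (λ a → a :+ (:- a) :* con (+ 1) := con (+ 0)) refl (f 0))
    h-root : ∀ i → y i * ev m (tail h) (y i) ≈ 0#
    h-root i = begin
      y i * ev m (tail h) (y i)                 ≈⟨ +-identityˡ _ ⟨
      0# + y i * ev m (tail h) (y i)            ≈⟨ +-congʳ h0 ⟨
      ev (suc m) h (y i)                        ≈⟨ ev-⊞ (suc m) f ((- f 0) • es x) (y i) ⟩
      ev (suc m) f (y i) + ev (suc m) ((- f 0) • es x) (y i)
        ≈⟨ +-cong (root i) (trans (ev-• (suc m) (- f 0) (es x) (y i)) (trans (*-congˡ (es-root i)) (zeroʳ _))) ⟩
      0# + 0#                                   ≈⟨ +-identityˡ _ ⟩
      0#                                        ∎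
    hk≈0 : h (suc k) ≈ 0#
    hk≈0 = coeffs≈0 m (tail h) y y-inj (λ i → cancel (y i) _ (h-root i) (y≉0 i)) k k≤m

-- Symmetric functions whose arguments are polynomials of degree at most d in Z. The k-th one has
-- degree at most kd, and its values and its coefficient at Z^(kd) are symmetric functions of the
-- values and of the coefficients at Z^d.
module SymmetricEvaluation {c ℓ} {R A : CommutativeRing c ℓ} (ι : RingMap R A) where
  private
    module R = CommutativeRing R
    module Rs = CommutativeRing (PowerSeries.seriesRing R)
    module ER = ElementarySymmetric R
    module ES = ElementarySymmetric (PowerSeries.seriesRing R)
    module EA = ElementarySymmetric A
  open CommutativeRing A hiding (zero)
  open PowerSeries R using (Series; _⊛_)
  open Degree R
  open RingMap ι
  open Evaluation ι
  open import Algebra.Properties.Ring ring using (+-inverseʳ-unique)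
  open import Algebra.Properties.Ring R.ring using () renaming (-0#≈0# to R-0)

  ev-neg : ∀ d f y → ev d (Rs.- f) y ≈ - ev d f y
  ev-neg d f y = +-inverseʳ-unique _ _ (trans (sym (ev-⊞ d f (Rs.- f) y)) (ev-zero d y (λ k _ → R.-‿inverseʳ _)))

  Deg≤-neg : ∀ {d f} → Deg≤ d f → Deg≤ d (Rs.- f)
  Deg≤-neg df k d<k = R.trans (R.-‿cong (df k d<k)) R-0

  module _ {d : ℕ} where

    Deg≤-es′ : ∀ {m} (f : Fin m → Series) → (∀ j → Deg≤ d (f j)) → ∀ k → Deg≤ (k ℕ.* d) (ES.es f k)
    Deg≤-es′ {zero}  f df zero    (suc i) _ = R.refl
    Deg≤-es′ {zero}  f df (suc k) i       _ = R.refl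
    Deg≤-es′ {suc m} f df zero    = Deg≤-es′ (f ∘ suc) (df ∘ suc) zero
    Deg≤-es′ {suc m} f df (suc k) = Deg≤-⊞ (Deg≤-es′ (f ∘ suc) (df ∘ suc) (suc k))
      (Deg≤-neg (Deg≤-⊛ (df zero) (Deg≤-es′ (f ∘ suc) (df ∘ suc) k)))

    es-lead : ∀ {m} (f : Fin m → Series) → (∀ j → Deg≤ d (f j)) → ∀ k → ES.es f k (k ℕ.* d) R.≈ ER.es (λ j → f j d) k
    es-lead {zero}  f df zero    = R.refl
    es-lead {zero}  f df (suc k) = R.refl
    es-lead {suc m} f df zero    = es-lead (f ∘ suc) (df ∘ suc) zero
    es-lead {suc m} f df (suc k) = R.+-cong (es-lead (f ∘ suc) (df ∘ suc) (suc k))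
      (R.-‿cong (R.trans (⊛-lead (df zero) (Deg≤-es′ (f ∘ suc) (df ∘ suc) k)) (R.*-congˡ (es-lead (f ∘ suc) (df ∘ suc) k))))

    ev-es′ : ∀ {m} (f : Fin m → Series) → (∀ j → Deg≤ d (f j)) → ∀ k y →
             ev (k ℕ.* d) (ES.es f k) y ≈ EA.es (λ j → ev d (f j) y) k
    ev-es′ {zero}  f df zero    y = 1-homo
    ev-es′ {zero}  f df (suc k) y = ev-zero (suc k ℕ.* d) y (λ _ _ → R.refl)
    ev-es′ {suc m} f df zero    y = ev-es′ (f ∘ suc) (df ∘ suc) zero y
    ev-es′ {suc m} f df (suc k) y =
      trans (ev-⊞ (suc k ℕ.* d) (ES.es (f ∘ suc) (suc k)) (Rs.- (f zero ⊛ ES.es (f ∘ suc) k)) y)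
        (+-cong (ev-es′ (f ∘ suc) (df ∘ suc) (suc k) y)
          (trans (ev-neg (suc k ℕ.* d) (f zero ⊛ ES.es (f ∘ suc) k) y)
            (-‿cong (trans (ev-⊛ d (k ℕ.* d) y (df zero) (Deg≤-es′ (f ∘ suc) (df ∘ suc) k))
                           (*-congˡ (ev-es′ (f ∘ suc) (df ∘ suc) k y))))))

    module _ where
      private
        module ΠS = Sum Rs.*-commutativeMonoid
        module ΠA = Sum *-commutativeMonoid

      Deg≤-∏ : ∀ {m} (f : Fin m → Series) → (∀ j → Deg≤ d (f j)) → Deg≤ (m ℕ.* d) (ΠS.sum f)
      Deg≤-∏ {zero}  f df (suc k) _ = R.refl
      Deg≤-∏ {suc m} f df = Deg≤-⊛ (df zero) (Deg≤-∏ (f ∘ suc) (df ∘ suc))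

      ∏-lead : ∀ {m} (f : Fin m → Series) → (∀ j → Deg≤ d (f j)) → (∀ j → f j d R.≈ R.1#) → ΠS.sum f (m ℕ.* d) R.≈ R.1#
      ∏-lead {zero}  f df f1 = R.refl
      ∏-lead {suc m} f df f1 = R.trans (⊛-lead (df zero) (Deg≤-∏ (f ∘ suc) (df ∘ suc)))
        (R.trans (R.*-cong (f1 zero) (∏-lead (f ∘ suc) (df ∘ suc) (f1 ∘ suc))) (R.*-identityˡ _))

      ev-∏ : ∀ {m} (f : Fin m → Series) → (∀ j → Deg≤ d (f j)) → ∀ y → ev (m ℕ.* d) (ΠS.sum f) y ≈ ΠA.sum (λ j → ev d (f j) y)
      ev-∏ {zero}  f df y = 1-homo
      ev-∏ {suc m} f df y = trans (ev-⊛ d (m ℕ.* d) y (df zero) (Deg≤-∏ (f ∘ suc) (df ∘ suc))) (*-congˡ (ev-∏ (f ∘ suc) (df ∘ suc) y))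

-- Derivatives by dual numbers

module DualNumbers {c ℓ} (R : CommutativeRing c ℓ) where
  open CommutativeRing R hiding (zero)
  open Quadratic R 0# using () renaming (quadraticRing to dualRing) public
  open PowerSeries R
  open IntegerSolver R
  open Frobenius R
  open ElementarySymmetric R
  private
    module D = CommutativeRing dualRing
    module FD = Frobenius dualRing
    module ED = ElementarySymmetric dualRing
    module ΠD = Sum D.*-commutativeMonoid

  constants : RingMap R dualRing
  constants = record
    { ⟦_⟧ = λ x → x , 0#
    ; ⟦⟧-cong = λ e → e , refl
    ; +-homo = λ _ _ → refl , sym (+-identityˡ _)
    ; *-homo = λ x y → solve 2 (λ x y → x :* y := x :* y :+ con (+ 0) :* (con (+ 0) :* con (+ 0))) refl x y
                     , solve 2 (λ x y → con (+ 0) := x :* con (+ 0) :+ con (+ 0) :* y) refl x y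
    ; 0-homo = D.refl
    ; 1-homo = D.refl
    }

  dual-* : ∀ x y → x D.* y D.≈ (proj₁ x * proj₁ y , proj₁ x * proj₂ y + proj₂ x * proj₁ y)
  dual-* (a , b) (c , d) = solve 4 (λ a b c d → a :* c :+ con (+ 0) :* (b :* d) := a :* c) refl a b c d , refl

  dual-^ : ∀ x m → (x , 1#) FD.^ suc m D.≈ (x ^ suc m , suc m · x ^ m)
  dual-^ x zero    = solve 1 (λ x → x :* con (+ 1) :+ con (+ 0) :* (con (+ 1) :* con (+ 0)) := x :* con (+ 1)) refl x
                   , solve 1 (λ x → x :* con (+ 0) :+ con (+ 1) :* con (+ 1) := con (+ 1) :+ con (+ 0)) refl x
  dual-^ x (suc m) = D.trans (D.*-congˡ {x , 1#} (dual-^ x m)) (D.trans (dual-* (x , 1#) (x ^ suc m , suc m · x ^ m))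
    (refl , trans (+-comm _ _) (+-cong (*-identityˡ _) (×-comm-* (suc m) x (x ^ m)))))
    where open import Algebra.Properties.Semiring.Mult semiring using (×-comm-*)

  proj₁-es : ∀ {m} (a : Fin m → D.Carrier) k → proj₁ (ED.es a k) ≈ es (proj₁ ∘ a) k
  proj₁-es {zero}  a zero    = refl
  proj₁-es {zero}  a (suc k) = refl
  proj₁-es {suc m} a zero    = proj₁-es (a ∘ suc) zero
  proj₁-es {suc m} a (suc k) = +-cong (proj₁-es (a ∘ suc) (suc k))
    (-‿cong (trans (proj₁ (dual-* (a zero) (ED.es (a ∘ suc) k))) (*-congˡ (proj₁-es (a ∘ suc) k))))

  powerSum : ∀ {m} → (Fin m → Carrier) → (Fin m → Carrier) → Series
  powerSum x u k = ⅀.sum (λ j → x j ^ k * u j)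

  -- The expansion of the sum of xⱼuⱼT/(1 - xⱼT). Its constant term is 0, unlike that of `powerSum`,
  -- which is the sum of the uⱼ.
  logDerivative : ∀ {m} → (Fin m → Carrier) → (Fin m → Carrier) → Series
  logDerivative x u zero    = 0#
  logDerivative x u (suc k) = powerSum x u (suc k)

  -- The ε-part of ∏ⱼ (1 - aⱼ T) is the product times its logarithmic derivative.
  proj₂-es : ∀ {m} (a : Fin m → D.Carrier) (u : Fin m → Carrier) → (∀ j → proj₂ (a j) ≈ - (proj₁ (a j) * u j)) →
             ∀ k → proj₂ (ED.es a k) ≈ (es (proj₁ ∘ a) ⊛ logDerivative (proj₁ ∘ a) u) k
  proj₂-es {zero}  a u au zero    = sym (zeroʳ _)
  proj₂-es {zero}  a u au (suc k) = sym (trans (const-⊛ 1# (logDerivative (proj₁ ∘ a) u) (suc k)) (trans (*-congˡ refl) (zeroʳ _)))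
  proj₂-es {suc m} a u au k = trans (step k) (sym (rhs k))
    where
    open import Relation.Binary.Reasoning.Setoid setoid
    x = proj₁ (a zero)
    as = a ∘ suc
    E = es (proj₁ ∘ as)
    G = logDerivative (proj₁ ∘ as) (u ∘ suc)
    -- The geometric series of xuT/(1 - xT), so that multiplication by `factor x` leaves the single
    -- term xuT.
    g : Series
    g zero    = 0#
    g (suc k) = x ^ suc k * u zero
    fg : factor x ⊛ g ≋ shift (const (x * u zero))
    fg zero          = zeroʳ _
    fg (suc zero)    = trans (factor-⊛ x g 0) (solve 2 (λ x u → (x :* con (+ 1)) :* u :- x :* con (+ 0) := x :* u) refl x (u zero))
    fg (suc (suc k)) = trans (factor-⊛ x g (suc k)) (solve 3 (λ x y u → (x :* y) :* u :- x :* (y :* u) := con (+ 0)) refl x (x ^ suc k) (u zero))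
    Σg : logDerivative (proj₁ ∘ a) u ≋ G ⊞ g
    Σg zero    = sym (+-identityˡ _)
    Σg (suc k) = +-comm _ _
    E2 : Series
    E2 k = proj₂ (ED.es as k)
    module SR = CommutativeRing seriesRing
    IH : E2 ≋ E ⊛ G
    IH = proj₂-es as (u ∘ suc) (au ∘ suc)
    step : ∀ k → proj₂ (ED.es a k) ≈ ((factor x ⊛ (E ⊛ G)) ⊞ shift ((x * u zero) • E)) k
    step zero    = trans (IH 0) (sym (trans (+-identityʳ _) (*-identityˡ _)))
    step (suc k) = begin
      E2 (suc k) + - (proj₁ (a zero) * E2 k + proj₂ (a zero) * proj₁ (ED.es as k))
        ≈⟨ +-cong (IH (suc k)) (-‿cong (+-cong (*-congˡ (IH k)) (*-cong (au zero) (proj₁-es as k)))) ⟩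
      (E ⊛ G) (suc k) + - (x * (E ⊛ G) k + - (x * u zero) * E k)
        ≈⟨ solve 5 (λ A x B u C → A :+ :- (x :* B :+ :- (x :* u) :* C) := (A :- x :* B) :+ (x :* u) :* C) refl _ _ _ _ _ ⟩
      ((E ⊛ G) (suc k) - x * (E ⊛ G) k) + (x * u zero) * E k
        ≈⟨ +-congʳ (factor-⊛ x (E ⊛ G) k) ⟨
      (factor x ⊛ (E ⊛ G)) (suc k) + (x * u zero) * E k ∎
    rhs : es (proj₁ ∘ a) ⊛ logDerivative (proj₁ ∘ a) u ≋ (factor x ⊛ (E ⊛ G)) ⊞ shift ((x * u zero) • E)
    rhs = SR.trans (⊛-cong (es-suc (proj₁ ∘ a)) Σg)
      (SR.trans (SR.distribˡ (factor x ⊛ E) G g)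
      (SR.+-cong {(factor x ⊛ E) ⊛ G} {factor x ⊛ (E ⊛ G)} {(factor x ⊛ E) ⊛ g} (⊛-assoc (factor x) E G)
        (SR.trans (⊛-cong {g = g} (⊛-comm (factor x) E) SR.refl)
        (SR.trans (⊛-assoc E (factor x) g)
        (SR.trans (⊛-cong {f = E} SR.refl fg)
        (SR.trans (⊛-comm E (shift (const (x * u zero))))
        (SR.trans (shift-⊛ (const (x * u zero)) E) sh)))))))
      where
      sh : shift (const (x * u zero) ⊛ E) ≋ shift ((x * u zero) • E)
      sh zero    = refl
      sh (suc k) = const-⊛ (x * u zero) E k

  -- Since ε² = 0, the ε-part of ∏(xⱼ + ε) is the sum of the products omitting one factor, here
  -- written with the inverses uⱼ.
  dual-∏ : ∀ {m} (x u : Fin m → Carrier) → (∀ j → x j * u j ≈ 1#) →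
           ΠD.sum (λ j → x j , 1#) D.≈ (Π.sum x , Π.sum x * ⅀.sum u)
  dual-∏ {zero}  x u xu = refl , sym (zeroʳ _)
  dual-∏ {suc m} x u xu = D.trans (D.*-congˡ {x zero , 1#} (dual-∏ (x ∘ suc) (u ∘ suc) (xu ∘ suc)))
    (D.trans (dual-* (x zero , 1#) _) (refl , (begin
      x zero * (B * U) + 1# * B                ≈⟨ +-congˡ (*-congʳ (xu zero)) ⟨
      x zero * (B * U) + x zero * u zero * B   ≈⟨ solve 4 (λ x B U u → x :* (B :* U) :+ x :* u :* B := x :* B :* (u :+ U)) refl _ _ _ _ ⟩
      x zero * B * (u zero + U)                ∎)))
    where
    open import Relation.Binary.Reasoning.Setoid setoid
    B = Π.sum (x ∘ suc)
    U = ⅀.sum (u ∘ suc)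

  proj₁-∏ : ∀ {m} (x : Fin m → Carrier) → proj₁ (ΠD.sum (λ j → x j , 1#)) ≈ Π.sum x
  proj₁-∏ {zero}  x = refl
  proj₁-∏ {suc m} x = trans (proj₁ (dual-* (x zero , 1#) (ΠD.sum (λ j → x (suc j) , 1#)))) (*-congˡ (proj₁-∏ (x ∘ suc)))

  open Evaluation constants using () renaming (ev to evᴰ)
  open Evaluation (idMap R)

  derivative : Series → Series
  derivative f k = suc k · f (suc k)

  proj₁-ev : ∀ d f z → proj₁ (evᴰ d f (z , 1#)) ≈ ev d f z
  proj₁-ev zero    f z = refl
  proj₁-ev (suc d) f z = +-congˡ (trans (proj₁ (dual-* (z , 1#) (evᴰ d (tail f) (z , 1#)))) (*-congˡ (proj₁-ev d (tail f) z)))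

  -- f(z + ε) = f(z) + f′(z) ε. Derivatives of products and of symmetric functions are thus obtained
  -- by evaluating these over the dual numbers.
  proj₂-ev : ∀ d f z → proj₂ (evᴰ (suc d) f (z , 1#)) ≈ ev d (derivative f) z
  proj₂-ev zero    f z = solve 2 (λ z a → con (+ 0) :+ (z :* con (+ 0) :+ con (+ 1) :* a) := a :+ con (+ 0)) refl z (f 1)
  proj₂-ev (suc d) f z = begin
    0# + (z * proj₂ (evᴰ (suc d) (tail f) (z , 1#)) + 1# * proj₁ (evᴰ (suc d) (tail f) (z , 1#)))
      ≈⟨ +-congˡ (+-cong (*-congˡ (proj₂-ev d (tail f) z)) (*-congˡ (proj₁-ev (suc d) (tail f) z))) ⟩
    0# + (z * ev d (derivative (tail f)) z + 1# * (f 1 + z * ev d (tail (tail f)) z))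
      ≈⟨ solve 4 (λ z A a B → con (+ 0) :+ (z :* A :+ con (+ 1) :* (a :+ z :* B)) := (a :+ con (+ 0)) :+ z :* (B :+ A)) refl _ _ _ _ ⟩
    (f 1 + 0#) + z * (ev d (tail (tail f)) z + ev d (derivative (tail f)) z)
      ≈⟨ +-congˡ (*-congˡ (ev-⊞ d (tail (tail f)) (derivative (tail f)) z)) ⟨
    (f 1 + 0#) + z * ev d (tail (derivative f)) z ∎
    where open import Relation.Binary.Reasoning.Setoid setoid

-- B has degree N and e has degree at most n(q - 1). With N + q = n(q + 1) the total is 2nq - q.
degree-identity : ∀ {N q n r D} → N ℕ.+ q ≡ n ℕ.* suc q → suc r ≡ q → D ≡ N ℕ.+ n ℕ.* r → D ℕ.+ q ≡ 2 ℕ.* n ℕ.* q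
degree-identity {N} {q} {n} {r} N+q ≡.refl ≡.refl = ℕ.+-cancelʳ-≡ n _ _ (≡.trans (shuffle N n r)
    (≡.trans (≡.cong (ℕ._+ n ℕ.* suc r) N+q) (shuffle′ n (suc r))))
  where
  shuffle : ∀ N n r → N ℕ.+ n ℕ.* r ℕ.+ suc r ℕ.+ n ≡ N ℕ.+ suc r ℕ.+ n ℕ.* suc r
  shuffle = solve-∀
  shuffle′ : ∀ n q → n ℕ.* suc q ℕ.+ n ℕ.* q ≡ 2 ℕ.* n ℕ.* q ℕ.+ n
  shuffle′ = solve-∀

-- After adding 3q to both sides the claim reads 2(n + 1)q < 3n(q + 1).
degree<3N : ∀ N q n′ D → N ℕ.+ q ≡ suc n′ ℕ.* suc q → D ℕ.+ q ≡ 2 ℕ.* suc n′ ℕ.* q → 2 ℕ.≤ n′ → D ℕ.< N ℕ.* 3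
degree<3N N q n′ D N+q D+q 2≤n′ = ℕ.+-cancelʳ-< (3 ℕ.* q) D (N ℕ.* 3) (begin-strict
  D ℕ.+ 3 ℕ.* q                                   ≡⟨ shuffle₁ D q ⟩
  D ℕ.+ q ℕ.+ 2 ℕ.* q                             ≡⟨ ≡.cong (ℕ._+ 2 ℕ.* q) D+q ⟩
  2 ℕ.* suc n′ ℕ.* q ℕ.+ 2 ℕ.* q                  ≤⟨ ℕ.+-monoʳ-≤ (2 ℕ.* suc n′ ℕ.* q) (ℕ.*-monoˡ-≤ q 2≤n′) ⟩
  2 ℕ.* suc n′ ℕ.* q ℕ.+ n′ ℕ.* q                 <⟨ ℕ.m<m+n _ (s≤s z≤n) ⟩
  2 ℕ.* suc n′ ℕ.* q ℕ.+ n′ ℕ.* q ℕ.+ (suc (2 ℕ.+ 3 ℕ.* n′ ℕ.+ q)) ≡⟨ shuffle₂ n′ q ⟩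
  suc n′ ℕ.* suc q ℕ.* 3                          ≡⟨ ≡.cong (ℕ._* 3) N+q ⟨
  (N ℕ.+ q) ℕ.* 3                                 ≡⟨ shuffle₃ N q ⟩
  N ℕ.* 3 ℕ.+ 3 ℕ.* q                             ∎)
  where
  open ℕ.≤-Reasoning
  shuffle₁ : ∀ D q → D ℕ.+ 3 ℕ.* q ≡ D ℕ.+ q ℕ.+ 2 ℕ.* q
  shuffle₁ = solve-∀
  shuffle₂ : ∀ n′ q → 2 ℕ.* suc n′ ℕ.* q ℕ.+ n′ ℕ.* q ℕ.+ (suc (2 ℕ.+ 3 ℕ.* n′ ℕ.+ q)) ≡ suc n′ ℕ.* suc q ℕ.* 3
  shuffle₂ = solve-∀
  shuffle₃ : ∀ N q → (N ℕ.+ q) ℕ.* 3 ≡ N ℕ.* 3 ℕ.+ 3 ℕ.* q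
  shuffle₃ = solve-∀

-- The derivative of B e then has degree below q², so vanishing at all q² points of the plane makes
-- it the zero polynomial.
degree≤q² : ∀ D q n ρ → D ℕ.+ q ≡ 2 ℕ.* n ℕ.* q → ρ ℕ.* n ≡ q → 3 ℕ.≤ ρ → D ℕ.≤ q ℕ.* q
degree≤q² D q n ρ D+q ρn≡q 3≤ρ = ℕ.+-cancelʳ-≤ q D (q ℕ.* q) (ℕ.≤-trans (ℕ.≤-reflexive D+q) (ℕ.≤-trans
  (ℕ.*-monoˡ-≤ q (ℕ.≤-trans (ℕ.*-monoˡ-≤ n (ℕ.≤-trans (s≤s (s≤s z≤n)) 3≤ρ)) (ℕ.≤-reflexive ρn≡q))) (ℕ.m≤m+n _ q)))

-- Nonexistence of maximal arcs in odd characteristic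

module BallBlokhuis {c ℓ} {L : CommutativeRing c ℓ} {q n′ : ℕ} (arc : MaximalArc L q n′)
  (e : ℕ) (n≡p^e : suc n′ ≡ MaximalArc.p arc ℕ.^ e) (3≤p : 3 ℕ.≤ MaximalArc.p arc) where
  open CommutativeRing L hiding (zero)
  open Secants arc
  open PowerSeries L
  open Degree L
  open Evaluation (idMap L)
  open SeriesPowers L
  open ElementarySymmetric L
  open RootProducts L isFiniteField
  open DualNumbers L
  open Frobenius L
  open IntegerSolver L
  open import Algebra.Properties.Ring ring using (+-inverseʳ-unique; -0#≈0#; x∙y⁻¹≈ε⇒x≈y)
  open import Relation.Binary.Reasoning.Setoid setoid
  private
    module D where
      open CommutativeRing dualRing public
      open Frobenius dualRing public
    module ED = ElementarySymmetric dualRing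
    module ES = ElementarySymmetric seriesRing
    module EvD = Evaluation constants
    module SymD = SymmetricEvaluation constants
    module Sym = SymmetricEvaluation (idMap L)
    module ΠD = Sum D.*-commutativeMonoid

  one-^ : ∀ m → 1# ^ m ≈ 1#
  one-^ zero    = refl
  one-^ (suc m) = trans (*-identityˡ _) (one-^ m)

  ^n-∤ : ∀ f k → ¬ (n ∣ k) → (f S.^ n) k ≈ 0#
  ^n-∤ f k = ≡.subst (λ m → ¬ (m ∣ k) → (f S.^ m) k ≈ 0#) (≡.sym n≡p^e) (^p^e-∤ prime char e f k)

  ^n-n : ∀ f → (f S.^ n) n ≈ f 1 ^ n
  ^n-n f = ≡.subst (λ m → (f S.^ m) m ≈ f 1 ^ m) (≡.sym n≡p^e) (^p^e-n prime char e f)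

  sum-^n : ∀ {m} (f : Fin m → Carrier) → ⅀.sum f ^ n ≈ ⅀.sum (λ i → f i ^ n)
  sum-^n f = ≡.subst (λ m → ⅀.sum f ^ m ≈ ⅀.sum (λ i → f i ^ m)) (≡.sym n≡p^e) (sum-^ prime char e f)

  add-^n : ∀ x y → (x + y) ^ n ≈ x ^ n + y ^ n
  add-^n x y = ≡.subst (λ m → (x + y) ^ m ≈ x ^ m + y ^ m) (≡.sym n≡p^e) (frobeniusᵉ prime char e x y)

  neg-^n : ∀ x → (- x) ^ n ≈ - (x ^ n)
  neg-^n x = ≡.subst (λ m → (- x) ^ m ≈ - (x ^ m)) (≡.sym n≡p^e) (frobeniusᵉ-neg prime char e x)

  p^-injective : ∀ e′ {m} → m ≡ p ℕ.^ e′ → ∀ x y → x ^ m ≈ y ^ m → x ≈ y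
  p^-injective e′ {m} ≡.refl x y eq with (x - y) ≈? 0#
  ... | yes d = x∙y⁻¹≈ε⇒x≈y _ _ d
  ... | no d  = contradiction (trans (frobeniusᵉ-sub prime char e′ x y) (trans (+-congʳ eq) (-‿inverseʳ _))) (^-≉0 m d)

  p∣q : p ∣ q
  p∣q = go h q≡p^h
    where
    go : ∀ h → q ≡ p ℕ.^ h → p ∣ q
    go zero    e = contradiction n<q (≡.subst (λ z → ¬ (n ℕ.< z)) (≡.sym e) λ { (s≤s ()) })
    go (suc h) e = ≡.subst (p ∣_) (≡.sym e) (m∣m*n (p ℕ.^ h))

  q·≈0 : ∀ x → q · x ≈ 0#
  q·≈0 x = p∣⇒·≈0 prime char x p∣q

  -- The points are grouped by their line through z. A point equal to z has slope 0 and contributes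
  -- the factor 1.
  es-slope : ∀ z → es (slope z) S.≈ ΠS.sum (λ i → factor (dir i) S.^ onLine z i)
  es-slope z = S.trans (es-∏ (slope z)) (S.trans (ΠS.sum-cong-≋ split)
    (S.trans (ΠS.∑-comm (λ j i → factor (dir i) S.^ ⟨ slope z j ≈? dir i ⟩))
             (ΠS.sum-cong-≋ (λ i → MC.∑-indicator (λ j → slope z j ≈? dir i) (factor (dir i))))))
    where
    module MC = MonoidCount S.*-commutativeMonoid
    other : ∀ j i → ¬ (slope z j ≈ dir i) → factor (dir i) S.^ ⟨ slope z j ≈? dir i ⟩ S.≈ S.1#
    other j i ne with slope z j ≈? dir i
    ... | yes e = contradiction e ne
    ... | no _  = S.refl
    split : ∀ j → factor (slope z j) S.≈ ΠS.sum (λ i → factor (dir i) S.^ ⟨ slope z j ≈? dir i ⟩)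
    split j with z ≈? b j
    ... | yes e = S.trans (factor-0 (slope-self e)) (S.sym (S.trans
          (ΠS.sum-cong-≋ (λ i → other j i (λ e′ → dir≉0 i (trans (sym e′) (slope-self e))))) (ΠS.sum-replicate-zero (suc q))))
    ... | no ne with slope-class z j ne
    ...   | i , e = S.trans (factor-cong e) (S.trans (this (slope z j ≈? dir i)) (S.sym (MC.∑-single _ i
              (λ i′ i′≢i → other j i′ (λ e′ → i′≢i (dir-injective _ _ (trans (sym e′) e)))))))
      where
      this : (d : Dec (slope z j ≈ dir i)) → factor (dir i) S.≈ factor (dir i) S.^ ⟨ d ⟩
      this (yes _) = S.sym (S.*-identityʳ (factor (dir i)))
      this (no ne) = contradiction e ne

  dirInv : Fin (suc q) → Carrier
  dirInv i = dir i ^ q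

  dir*dirInv≈1⇒≈ : ∀ i j → dir i * dirInv j ≈ 1# → dir i ≈ dir j
  dir*dirInv≈1⇒≈ i j eq = begin
    dir i                        ≈⟨ *-identityʳ _ ⟨
    dir i * 1#                   ≈⟨ *-congˡ (dir^ j) ⟨
    dir i * (dir j * dirInv j)   ≈⟨ solve 3 (λ a b c → a :* (b :* c) := b :* (a :* c)) refl _ _ _ ⟩
    dir j * (dir i * dirInv j)   ≈⟨ *-congˡ eq ⟩
    dir j * 1#                   ≈⟨ *-identityʳ _ ⟩
    dir j                        ∎

  dirInv-injective : ∀ i j → dirInv i ≈ dirInv j → i ≡ j
  dirInv-injective i j eq = dir-injective i j (dir*dirInv≈1⇒≈ i j (trans (*-congˡ (sym eq)) (dir^ i)))

  dirInv^ : ∀ i → dirInv i ^ suc q ≈ 1#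
  dirInv^ i = begin
    (dir i ^ q) ^ suc q     ≈⟨ ^-assocʳ (dir i) q (suc q) ⟩
    dir i ^ (q ℕ.* suc q)   ≡⟨ ≡.cong (dir i ^_) (ℕ.*-comm q (suc q)) ⟩
    dir i ^ (suc q ℕ.* q)   ≈⟨ ^-assocʳ (dir i) (suc q) q ⟨
    (dir i ^ suc q) ^ q     ≈⟨ ^-congˡ q (dir^ i) ⟩
    1# ^ q                  ≈⟨ one-^ q ⟩
    1#                      ∎

  Unital-resp : ∀ {m f g} → f S.≈ g → Unital m f → Unital m g
  Unital-resp eq u = unital (trans (sym (eq 0)) (at-0 u)) (λ k 0<k k<m → trans (sym (eq k)) (gap u k 0<k k<m))

  -- The directions are the (q + 1)-st roots of unity, so ∏(1 - dir T) is 1 - T^(q+1), which has the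
  -- same roots and constant term.
  es-dir : Unital (suc q) (es dir)
  es-dir = unital (es-0 dir) λ k 0<k k<q → begin
    es dir k            ≈⟨ *-identityˡ _ ⟨
    1# * es dir k       ≈⟨ *-congʳ f0 ⟨
    f 0 * es dir k      ≈⟨ fromRoots (suc q) f dir dirInv dir^ dirInv-injective root k (ℕ.<⇒≤ k<q) ⟨
    f k                 ≈⟨ +-cong (1-at k 0<k) (trans (*-congˡ (X^-lt (suc q) k k<q)) (zeroʳ _)) ⟩
    0# + 0#             ≈⟨ +-identityˡ _ ⟩
    0#                  ∎
    where
    f : Series
    f = S.1# ⊞ ((- 1#) • (X S.^ suc q))
    1-at : ∀ k → 0 ℕ.< k → S.1# k ≈ 0#
    1-at (suc k) _ = refl
    f0 : f 0 ≈ 1#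
    f0 = trans (+-congˡ (trans (*-congˡ (X^-lt (suc q) 0 (s≤s z≤n))) (zeroʳ _))) (+-identityʳ _)
    Deg≤-X : Deg≤ 1 X
    Deg≤-X (suc zero)    (s≤s ())
    Deg≤-X (suc (suc k)) _ = refl
    ev-X^ : ∀ y → ev (suc q) (X S.^ suc q) y ≈ y ^ suc q
    ev-X^ y = trans (reflexive (≡.cong (λ d → ev d (X S.^ suc q) y) (≡.sym (ℕ.*-identityʳ (suc q)))))
      (trans (ev-^ 1 (suc q) y Deg≤-X) (^-congˡ (suc q) (trans (+-identityˡ _) (*-identityʳ y))))
    root : ∀ i → ev (suc q) f (dirInv i) ≈ 0#
    root i = begin
      ev (suc q) f (dirInv i)
        ≈⟨ ev-⊞ (suc q) S.1# ((- 1#) • (X S.^ suc q)) (dirInv i) ⟩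
      ev (suc q) S.1# (dirInv i) + ev (suc q) ((- 1#) • (X S.^ suc q)) (dirInv i)
        ≈⟨ +-cong (ev-mono {suc q} {0} S.1# (dirInv i) z≤n 1-at) (trans (ev-• (suc q) (- 1#) (X S.^ suc q) (dirInv i)) (*-congˡ (trans (ev-X^ (dirInv i)) (dirInv^ i)))) ⟩
      1# + - 1# * 1#
        ≈⟨ solve 0 (con (+ 1) :+ (:- con (+ 1)) :* con (+ 1) := con (+ 0)) refl ⟩
      0# ∎

  ∑dir≈0 : ⅀.sum dir ≈ 0#
  ∑dir≈0 = begin
    ⅀.sum dir        ≈⟨ solve 1 (λ s → s := :- (:- s)) refl _ ⟩
    - (- ⅀.sum dir)  ≈⟨ -‿cong (es-1 dir) ⟨
    - es dir 1       ≈⟨ -‿cong (gap es-dir 1 (s≤s z≤n) (s≤s (ℕ.≤-trans (s≤s z≤n) (ℕ.<⇒≤ n<q)))) ⟩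
    - 0#             ≈⟨ -0#≈0# ⟩
    0#               ∎

  -- From an arc point every direction is seen `n′` times, so the product is the n′-th power of that
  -- for all directions.
  es-point : ∀ {z j} → z ≈ b j → Unital (suc q) (es (slope z))
  es-point {z} {j} eq = Unital-resp (S.sym (S.trans (es-cong {a = slope z} {slope (b j)} (λ j′ → ^-congˡ r (+-congʳ eq))) (S.trans (es-slope (b j))
      (S.trans (ΠS.sum-cong-≋ (λ i → S.^-congʳ (factor (dir i)) (onLine-point j i)))
      (S.trans (∏-^ (λ i → factor (dir i)) n′) (S.^-congˡ n′ (S.sym (es-∏ dir))))))))
    (Unital-^ n′ es-dir)

  secant? : ∀ z i → Dec (onLine z i ≡ n)
  secant? z i = onLine z i ℕ.≟ n

  secants : Carrier → Series
  secants z = ΠS.sum (λ i → factor (dir i) S.^ ⟨ secant? z i ⟩)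

  -- All multiplicities are 0 or n, so the product is an n-th power; as n is a power of p, it is a
  -- series in T^n.
  es-outside : ∀ {z} → Outside z → es (slope z) S.≈ secants z S.^ n
  es-outside {z} out = S.trans (es-slope z) (S.trans (ΠS.sum-cong-≋ (λ i → S.trans (S.^-congʳ (factor (dir i)) (mult i))
      (S.sym (S.^-assocʳ (factor (dir i)) ⟨ secant? z i ⟩ n)))) (∏-^ (λ i → factor (dir i) S.^ ⟨ secant? z i ⟩) n))
    where
    mult : ∀ i → onLine z i ≡ ⟨ secant? z i ⟩ ℕ.* n
    mult i with onLine-0∨n out i
    ... | inj₁ e = ≡.trans e (≡.sym (≡.cong (ℕ._* n) (⟨⟩-no (secant? z i) (λ e′ → case ≡.trans (≡.sym e) e′ of λ ()))))
    ... | inj₂ e = ≡.trans e (≡.sym (≡.trans (≡.cong (ℕ._* n) (⟨⟩-yes (secant? z i) e)) (ℕ.*-identityˡ n)))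

  outside? : ∀ z → (∃ λ j → z ≈ b j) ⊎ Outside z
  outside? z with any? (λ j → z ≈? b j)
  ... | yes p = inj₁ p
  ... | no ne = inj₂ (λ j e → ne (j , e))

  es-vanishes : ∀ z k → 0 ℕ.< k → k ℕ.≤ q → ¬ (n ∣ k) → es (slope z) k ≈ 0#
  es-vanishes z k 0<k k≤q n∤k with outside? z
  ... | inj₁ (j , eq) = gap (es-point eq) k 0<k (s≤s k≤q)
  ... | inj₂ out      = trans (es-outside out k) (^n-∤ (secants z) k n∤k)

  vanishing : ∀ d f → Deg≤ d f → d ℕ.< q ℕ.* q → (∀ z → ev d f z ≈ 0#) → ∀ k → f k ≈ 0#
  vanishing d f df d<q² root k with k ℕ.≤? d
  ... | yes k≤d = coeffs≈0 d f (λ i → enum (Fin.inject≤ i d<q²)) (λ i j eq → inject≤-injective d<q² d<q² i j (enum-injective eq)) (λ i → root _) k k≤d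
  ... | no k≰d  = df k (ℕ.≰⇒> k≰d)

  linear^r : Fin N → Series
  linear^r j = linear (- b j) S.^ r

  Deg≤-linear^r : ∀ j → Deg≤ r (linear^r j)
  Deg≤-linear^r j = ≡.subst (λ d → Deg≤ d (linear^r j)) (ℕ.*-identityʳ r) (Deg≤-^ {1} r (Deg≤-linear (- b j)))

  linear^r-lead : ∀ j → linear^r j r ≈ 1#
  linear^r-lead j = trans (reflexive (≡.cong (linear^r j) (≡.sym (ℕ.*-identityʳ r)))) (trans (^-lead {1} r (Deg≤-linear (- b j))) (one-^ r))

  symmetric : ℕ → Series
  symmetric = ES.es linear^r

  Deg≤-symmetric : ∀ k → Deg≤ (k ℕ.* r) (symmetric k)
  Deg≤-symmetric = Sym.Deg≤-es′ linear^r Deg≤-linear^r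

  ev-symmetric : ∀ k z → ev (k ℕ.* r) (symmetric k) z ≈ es (slope z) k
  ev-symmetric k z = trans (Sym.ev-es′ linear^r Deg≤-linear^r k z) (es-cong (λ j →
    trans (reflexive (≡.cong (λ d → ev d (linear^r j) z) (≡.sym (ℕ.*-identityʳ r))))
    (trans (ev-^ 1 r z (Deg≤-linear (- b j))) (^-congˡ r (trans (ev-linear (- b j) z) (+-comm _ _))))) k)

  -- For k ≤ q the degree k(q - 1) stays below q², so vanishing at every point of the plane becomes
  -- vanishing of all coefficients. Only in this form does it survive differentiation.
  symmetric-vanishes : ∀ k → 0 ℕ.< k → k ℕ.≤ q → ¬ (n ∣ k) → ∀ i → symmetric k i ≈ 0#
  symmetric-vanishes k 0<k k≤q n∤k = vanishing (k ℕ.* r) (symmetric k) (Deg≤-symmetric k)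
    (ℕ.≤-<-trans (ℕ.*-monoˡ-≤ r k≤q) (ℕ.*-monoʳ-< q {{ℕ.>-nonZero (ℕ.≤-<-trans z≤n n<q)}} (ℕ.≤-reflexive suc-r)))
    (λ z → trans (ev-symmetric k z) (es-vanishes z k 0<k k≤q n∤k))

  ev-skip : ∀ m d f y → (∀ k → k ℕ.< m → f k ≈ 0#) → ev (m ℕ.+ d) f y ≈ y ^ m * ev d (λ k → f (m ℕ.+ k)) y
  ev-skip zero    d f y z = sym (*-identityˡ _)
  ev-skip (suc m) d f y z = trans (+-cong (z 0 (s≤s z≤n)) (*-congˡ (ev-skip m d (tail f) y (λ k k<m → z (suc k) (s≤s k<m)))))
    (trans (+-identityˡ _) (sym (*-assoc _ _ _)))

  -- Horner's scheme is run in blocks of one coefficient followed by m zeros, which is why the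
  -- modulus is a successor.
  ev-compress : ∀ m ρ f y → (∀ k → k ℕ.≤ ρ ℕ.* suc m → ¬ (suc m ∣ k) → f k ≈ 0#) →
                ev (ρ ℕ.* suc m) f y ≈ ev ρ (λ l → f (l ℕ.* suc m)) (y ^ suc m)
  ev-compress m zero    f y z = refl
  ev-compress m (suc ρ) f y z = +-congˡ (begin
    y * ev (m ℕ.+ ρ ℕ.* suc m) (tail f) y
      ≈⟨ *-congˡ (ev-skip m (ρ ℕ.* suc m) (tail f) y (λ k k<m → z (suc k) (s≤s (ℕ.≤-trans (ℕ.<⇒≤ k<m) (ℕ.m≤m+n m _)))
           (λ d → ℕ.<⇒≱ (s≤s k<m) (∣⇒≤ d)))) ⟩
    y * (y ^ m * ev (ρ ℕ.* suc m) (λ k → f (suc m ℕ.+ k)) y)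
      ≈⟨ *-assoc _ _ _ ⟨
    y ^ suc m * ev (ρ ℕ.* suc m) (λ k → f (suc m ℕ.+ k)) y
      ≈⟨ *-congˡ (ev-compress m ρ (λ k → f (suc m ℕ.+ k)) y (λ k k≤ ∤k → z (suc m ℕ.+ k) (ℕ.+-monoʳ-≤ (suc m) k≤)
           (λ d → ∤k (∣m+n∣m⇒∣n d ∣-refl)))) ⟩
    y ^ suc m * ev ρ (λ l → f (suc m ℕ.+ l ℕ.* suc m)) (y ^ suc m) ∎)

  geometric : ℕ → Carrier → Carrier
  geometric d t = ev d (λ _ → 1#) t

  geometric-telescopes : ∀ d t → (1# - t) * geometric d t ≈ 1# - t ^ suc d
  geometric-telescopes zero    t = solve 1 (λ t → (con (+ 1) :- t) :* con (+ 1) := con (+ 1) :- t :* con (+ 1)) refl t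
  geometric-telescopes (suc d) t = begin
    (1# - t) * (1# + t * geometric d t)        ≈⟨ solve 2 (λ t g → (con (+ 1) :- t) :* (con (+ 1) :+ t :* g) := (con (+ 1) :- t) :+ t :* ((con (+ 1) :- t) :* g)) refl t _ ⟩
    (1# - t) + t * ((1# - t) * geometric d t)  ≈⟨ +-congˡ (*-congˡ (geometric-telescopes d t)) ⟩
    (1# - t) + t * (1# - t ^ suc d)            ≈⟨ solve 2 (λ t g → (con (+ 1) :- t) :+ t :* (con (+ 1) :- g) := con (+ 1) :- t :* g) refl t _ ⟩
    1# - t ^ suc (suc d)                       ∎

  geometric≈0 : ∀ {t} → ¬ (t ≈ 1#) → t ^ suc q ≈ 1# → geometric q t ≈ 0#
  geometric≈0 {t} t≉1 t^ = cancel (1# - t) _ (trans (geometric-telescopes q t) (trans (+-congˡ (-‿cong t^)) (-‿inverseʳ 1#)))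
    (λ e → t≉1 (sym (x∙y⁻¹≈ε⇒x≈y _ _ e)))

  ev-power : ∀ d x u y → ev d (λ k → x ^ k * u) y ≈ geometric d (x * y) * u
  ev-power zero    x u y = refl
  ev-power (suc d) x u y = begin
    1# * u + y * ev d (λ k → x ^ suc k * u) y         ≈⟨ +-congˡ (*-congˡ (trans (ev-cong d y (λ k → *-assoc _ _ _)) (trans (ev-• d x (λ k → x ^ k * u) y) (*-congˡ (ev-power d x u y))))) ⟩
    1# * u + y * (x * (geometric d (x * y) * u))      ≈⟨ solve 4 (λ u y x g → con (+ 1) :* u :+ y :* (x :* (g :* u)) := (con (+ 1) :+ (x :* y) :* g) :* u) refl u y x _ ⟩
    (1# + x * y * geometric d (x * y)) * u            ∎

  ev-powerSum : ∀ {m} d (x u : Fin m → Carrier) y → ev d (powerSum x u) y ≈ ⅀.sum (λ j → geometric d (x j * y) * u j)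
  ev-powerSum {zero}  d x u y = ev-zero d y (λ _ _ → refl)
  ev-powerSum {suc m} d x u y = trans (ev-⊞ d (λ k → x zero ^ k * u zero) (powerSum (x ∘ suc) (u ∘ suc)) y)
    (+-cong (ev-power d (x zero) (u zero) y) (ev-powerSum d (x ∘ suc) (u ∘ suc) y))

  linearᴰ : ∀ j z → EvD.ev 1 (linear (- b j)) (z , 1#) D.≈ (z - b j , 1#)
  linearᴰ j z = D.trans (EvD.ev-linear (- b j) (z , 1#)) (+-comm _ _ , +-identityˡ _)

  linear^rᴰ : ∀ j z → EvD.ev r (linear^r j) (z , 1#) D.≈ (z - b j , 1#) D.^ r
  linear^rᴰ j z = D.trans (D.reflexive (≡.cong (λ d → EvD.ev d (linear^r j) (z , 1#)) (≡.sym (ℕ.*-identityʳ r))))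
    (D.trans (EvD.ev-^ 1 r (z , 1#) (Deg≤-linear (- b j))) (D.^-congˡ r (linearᴰ j z)))

  r·x≈-x : ∀ x → r · x ≈ - x
  r·x≈-x x = +-inverseʳ-unique x (r · x) (≡.subst (λ m → m · x ≈ 0#) (≡.sym suc-r) (q·≈0 x))

  symmetricᴰ : ∀ k z → EvD.ev (k ℕ.* r) (symmetric k) (z , 1#) D.≈ ED.es (λ j → (z - b j , 1#) D.^ r) k
  symmetricᴰ k z = D.trans (SymD.ev-es′ linear^r Deg≤-linear^r k (z , 1#)) (ED.es-cong (λ j → linear^rᴰ j z) k)

  module AtOutside {z : Carrier} (out : Outside z) where

    u : Fin N → Carrier
    u j = proj₁ (inverse (z - b j) (sub≉0 (out j)))

    xu : ∀ j → (z - b j) * u j ≈ 1#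
    xu j = proj₂ (inverse (z - b j) (sub≉0 (out j)))

    -- (x + ε)^(q-1) has ε-part (q - 1) x^(q-2), and q - 1 is -1 in characteristic p. With u = 1/x
    -- this is the shape that `proj₂-es` requires.
    slopeᴰ : Fin N → D.Carrier
    slopeᴰ j = slope z j , - (slope z j * u j)

    ^rᴰ : ∀ j → (z - b j , 1#) D.^ r D.≈ slopeᴰ j
    ^rᴰ j = go r ≡.refl
      where
      x = z - b j
      go : ∀ m → m ≡ r → (x , 1#) D.^ m D.≈ (x ^ m , - (x ^ m * u j))
      go zero    e = contradiction (ℕ.≤-trans n<q (ℕ.≤-reflexive (≡.trans (≡.sym suc-r) (≡.cong suc (≡.sym e))))) λ { (s≤s ()) }
      go (suc m) e = D.trans (dual-^ x m) (refl , (begin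
        suc m · x ^ m             ≡⟨ ≡.cong (_· x ^ m) e ⟩
        r · x ^ m                 ≈⟨ r·x≈-x _ ⟩
        - (x ^ m)                 ≈⟨ -‿cong (trans (*-congʳ (xu j)) (*-identityˡ _)) ⟨
        - ((x * u j) * x ^ m)     ≈⟨ solve 3 (λ x u y → :- ((x :* u) :* y) := :- ((x :* y) :* u)) refl x (u j) (x ^ m) ⟩
        - (x ^ suc m * u j)       ∎))

    G : Series
    G = logDerivative (slope z) u

    symmetric′ : ∀ k → proj₂ (EvD.ev (k ℕ.* r) (symmetric k) (z , 1#)) ≈ (es (slope z) ⊛ G) k
    symmetric′ k = trans (proj₂ (symmetricᴰ k z)) (trans (proj₂ (ED.es-cong ^rᴰ k)) (proj₂-es slopeᴰ u (λ _ → refl) k))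

    product≈0 : ∀ k → 0 ℕ.< k → k ℕ.≤ q → ¬ (n ∣ k) → (es (slope z) ⊛ G) k ≈ 0#
    product≈0 k 0<k k≤q n∤k = trans (sym (symmetric′ k))
      (proj₂ (EvD.ev-zero (k ℕ.* r) (z , 1#) (λ i _ → symmetric-vanishes k 0<k k≤q n∤k i)))

    -- In a mixed term with i + j = k, either n does not divide i and the symmetric function
    -- vanishes, or n divides i, hence not j, and the induction applies. So `G k` equals the
    -- vanishing coefficient of the product.
    G-vanishes : ∀ k → k ℕ.≤ q → ¬ (n ∣ k) → G k ≈ 0#
    G-vanishes k = go k k ℕ.≤-refl
      where
      go : ∀ bd k → k ℕ.≤ bd → k ℕ.≤ q → ¬ (n ∣ k) → G k ≈ 0#
      go bd       zero    _    k≤q n∤k = refl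
      go (suc bd) (suc k) k≤bd k≤q n∤k = begin
        G (suc k)                       ≈⟨ *-identityˡ _ ⟨
        1# * G (suc k)                  ≈⟨ *-congʳ (es-0 (slope z)) ⟨
        es (slope z) 0 * G (suc k)      ≈⟨ ⊛-head (suc k) (es (slope z)) G mixed ⟨
        (es (slope z) ⊛ G) (suc k)      ≈⟨ product≈0 (suc k) (s≤s z≤n) k≤q n∤k ⟩
        0#                              ∎
        where
        mixed : ∀ i j → suc i ℕ.+ j ≡ suc k → es (slope z) (suc i) * G j ≈ 0#
        mixed i j e with n ∣? suc i
        ... | yes n∣i = trans (*-congˡ (go bd j (ℕ.≤-trans j≤k (ℕ.≤-pred k≤bd)) (ℕ.≤-trans j≤k (ℕ.<⇒≤ k≤q))
                          (λ n∣j → n∤k (≡.subst (n ∣_) e (∣m∣n⇒∣m+n n∣i n∣j))))) (zeroʳ _)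
          where
          j≤k : j ℕ.≤ k
          j≤k = ℕ.≤-trans (ℕ.m≤n+m j i) (ℕ.≤-reflexive (ℕ.suc-injective e))
        ... | no n∤i = trans (*-congʳ (es-vanishes z (suc i) (s≤s z≤n)
                          (ℕ.≤-trans (ℕ.≤-trans (ℕ.m≤m+n (suc i) j) (ℕ.≤-reflexive e)) k≤q) n∤i)) (zeroˡ _)

    symmetric′-n : proj₂ (EvD.ev (n ℕ.* r) (symmetric n) (z , 1#)) ≈ G n
    symmetric′-n = trans (symmetric′ n) (trans (⊛-head n (es (slope z)) G mixed) (trans (*-congʳ (es-0 (slope z))) (*-identityˡ _)))
      where
      mixed : ∀ i j → suc i ℕ.+ j ≡ n → es (slope z) (suc i) * G j ≈ 0#
      mixed i zero    e = zeroʳ _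
      mixed i (suc j) e = trans (*-congʳ (es-vanishes z (suc i) (s≤s z≤n) (ℕ.≤-trans (ℕ.<⇒≤ i<n) (ℕ.<⇒≤ n<q))
          (λ n∣i → ℕ.<⇒≱ i<n (∣⇒≤ n∣i)))) (zeroˡ _)
        where
        i<n : suc i ℕ.< n
        i<n = ℕ.≤-trans (ℕ.≤-trans (ℕ.≤-reflexive (ℕ.+-comm 1 (suc i))) (ℕ.+-monoʳ-≤ (suc i) (s≤s (z≤n {j})))) (ℕ.≤-reflexive e)

    -- `G` with the constant term restored: truncated at degree q, it now evaluates to a combination
    -- of complete geometric sums of q + 1 terms.
    P : Series
    P = powerSum (slope z) u

    P-vanishes : ∀ k → k ℕ.≤ q → ¬ (n ∣ k) → P k ≈ 0#
    P-vanishes zero    k≤q n∤k = contradiction (n ∣0) n∤k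
    P-vanishes (suc k) k≤q n∤k = G-vanishes (suc k) k≤q n∤k

    external? : ∀ i → Dec (onLine z i ≡ 0)
    external? i = onLine z i ℕ.≟ 0

    -- The ρ = q/n external lines through z account for all roots of Σₗ P (l n) Y^l.
    ρ : ℕ
    ρ = count external?

    external : Fin ρ → Fin (suc q)
    external = members external?

    secant+external : ∀ i → ⟨ external? i ⟩ ℕ.+ ⟨ secant? z i ⟩ ≡ 1
    secant+external i with onLine-0∨n out i
    ... | inj₁ e = ≡.cong₂ ℕ._+_ (⟨⟩-yes (external? i) e) (⟨⟩-no (secant? z i) (λ e′ → case ≡.trans (≡.sym e) e′ of λ ()))
    ... | inj₂ e = ≡.cong₂ ℕ._+_ (⟨⟩-no (external? i) (λ e′ → case ≡.trans (≡.sym e) e′ of λ ())) (⟨⟩-yes (secant? z i) e)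

    -- With n points on all q + 1 lines through z there would be n(q + 1) = N + q points. The q
    -- missing ones are n for each external line.
    ρ*n≡q : ρ ℕ.* n ≡ q
    ρ*n≡q = ℕ.+-cancelˡ-≡ N _ _ (≡.trans (≡.trans (≡.cong₂ ℕ._+_ (≡.sym (∑-onLine-outside out)) (≡.trans (ℕ.*-comm ρ n) (≡.sym (∑-*ˡ n (λ i → ⟨ external? i ⟩)))))
      (≡.trans (≡.sym (Σℕ.∑-distrib-+ (onLine z) (λ i → n ℕ.* ⟨ external? i ⟩)))
      (≡.trans (Σℕ.sum-cong-≗ total) (≡.trans (∑-const (suc q) n) (ℕ.*-comm (suc q) n))))) (≡.sym N+q≡n[q+1]))
      where
      total : ∀ i → onLine z i ℕ.+ n ℕ.* ⟨ external? i ⟩ ≡ n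
      total i with onLine-0∨n out i
      ... | inj₁ e = ≡.trans (≡.cong₂ (λ a b → a ℕ.+ n ℕ.* b) e (⟨⟩-yes (external? i) e)) (ℕ.*-identityʳ n)
      ... | inj₂ e = ≡.trans (≡.cong₂ (λ a b → a ℕ.+ n ℕ.* b) e (⟨⟩-no (external? i) (λ e′ → case ≡.trans (≡.sym e) e′ of λ ())))
                       (≡.trans (≡.cong (n ℕ.+_) (ℕ.*-zeroʳ n)) (ℕ.+-identityʳ n))

    -- If no arc point lies in direction i from z, each product of a slope with `dirInv i` is a (q +
    -- 1)-st root of unity other than 1, so its geometric sum is 0.
    P-root : ∀ i → onLine z i ≡ 0 → ev q P (dirInv i) ≈ 0#
    P-root i e = trans (ev-powerSum q (slope z) u (dirInv i)) (trans (⅀.sum-cong-≋ (λ j → term j (slope-class z j (out j)))) (⅀.sum-replicate-zero N))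
      where
      term : ∀ j → (∃ λ i′ → slope z j ≈ dir i′) → geometric q (slope z j * dirInv i) * u j ≈ 0#
      term j (i′ , s) = trans (*-congʳ (geometric≈0 t≉1 t^)) (zeroˡ _)
        where
        t≉1 : ¬ (slope z j * dirInv i ≈ 1#)
        t≉1 eq = contradiction (≡.trans (≡.sym e) (onLine-outside out {i} {j}
          (trans s (dir*dirInv≈1⇒≈ i′ i (trans (*-congʳ (sym s)) eq))))) λ ()
        t^ : (slope z j * dirInv i) ^ suc q ≈ 1#
        t^ = trans (^-congˡ (suc q) (*-congʳ s)) (trans (^-distrib-* (dir i′) (dirInv i) (suc q))
               (trans (*-cong (dir^ i′) (dirInv^ i)) (*-identityˡ 1#)))

    P⁽ⁿ⁾ : Series
    P⁽ⁿ⁾ l = P (l ℕ.* n)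

    x y : Fin ρ → Carrier
    x t = dir (external t) ^ n
    y t = dirInv (external t) ^ n

    P⁽ⁿ⁾-root : ∀ t → ev ρ P⁽ⁿ⁾ (y t) ≈ 0#
    P⁽ⁿ⁾-root t = trans (sym (ev-compress n′ ρ P (dirInv (external t)) (λ k k≤ → P-vanishes k (ℕ.≤-trans k≤ (ℕ.≤-reflexive ρ*n≡q)))))
      (trans (reflexive (≡.cong (λ d → ev d P (dirInv (external t))) ρ*n≡q)) (P-root (external t) (members-∈ external? t)))

    -- Up to degree q, `P` is a polynomial in T^n, of degree ρ in that variable. The external
    -- directions provide ρ distinct roots, so it is determined by them and by its constant term.
    Pₙ≈P₀*es : P n ≈ P 0 * es x 1
    Pₙ≈P₀*es = trans (reflexive (≡.cong P (≡.sym (ℕ.+-identityʳ n))))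
      (fromRoots ρ P⁽ⁿ⁾ x y xy (λ t t′ eq → members-injective external? t t′ (dirInv-injective _ _ (p^-injective e n≡p^e _ _ eq))) P⁽ⁿ⁾-root 1 1≤ρ)
      where
      xy : ∀ t → x t * y t ≈ 1#
      xy t = trans (sym (^-distrib-* (dir (external t)) (dirInv (external t)) n)) (trans (^-congˡ n (dir^ (external t))) (one-^ n))
      1≤ρ : 1 ℕ.≤ ρ
      1≤ρ = ℕ.n≢0⇒n>0 (λ ρ≡0 → ℕ.<⇒≢ (ℕ.≤-<-trans z≤n n<q) (≡.trans (≡.sym (≡.cong (ℕ._* n) ρ≡0)) ρ*n≡q))

    eₙ : Carrier
    eₙ = es (slope z) n

    -- The two summands are n-th powers of minus the sum of the external directions and of minus the
    -- sum of the secant ones. Frobenius adds them, and the sum of all directions is 0.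
    es+eₙ≈0 : es x 1 + eₙ ≈ 0#
    es+eₙ≈0 = begin
      es x 1 + eₙ
        ≈⟨ +-cong (trans (es-1 x) (-‿cong (sym (sum-^n (dir ∘ external))))) (trans (es-outside out n) (^n-n (secants z))) ⟩
      - (⅀.sum (dir ∘ external) ^ n) + secants z 1 ^ n
        ≈⟨ +-congʳ (neg-^n _) ⟨
      (- ⅀.sum (dir ∘ external)) ^ n + secants z 1 ^ n
        ≈⟨ add-^n _ _ ⟨
      (- ⅀.sum (dir ∘ external) + secants z 1) ^ n
        ≈⟨ ^-congˡ n cancelling ⟩
      0# ^ n
        ≈⟨ zeroˡ _ ⟩
      0# ∎
      where
      module MC = MonoidCount +-commutativeMonoid
      secants-1 : secants z 1 ≈ ⅀.sum (λ i → ⟨ secant? z i ⟩ · (- dir i))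
      secants-1 = trans (proj₂ (∏-unital-1 (λ i → factor (dir i) S.^ ⟨ secant? z i ⟩) (λ i → at-0 (Unital-^ ⟨ secant? z i ⟩ (u1 i)))))
        (⅀.sum-cong-≋ (λ i → Unital-^-coeff ⟨ secant? z i ⟩ (u1 i) 1 (s≤s z≤n) ℕ.≤-refl))
        where
        u1 : ∀ i → Unital 1 (factor (dir i))
        u1 i = unital refl λ { (suc k) _ (s≤s ()) }
      sum-neg : ∀ {m} (f : Fin m → Carrier) → - ⅀.sum f ≈ ⅀.sum (λ i → - f i)
      sum-neg {zero}  f = -0#≈0#
      sum-neg {suc m} f = trans (solve 2 (λ a s → :- (a :+ s) := :- a :+ :- s) refl _ _) (+-congˡ (sum-neg (f ∘ suc)))
      ·-neg : ∀ m a → - (m · a) ≈ m · (- a)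
      ·-neg zero    a = -0#≈0#
      ·-neg (suc m) a = trans (solve 2 (λ a s → :- (a :+ s) := :- a :+ :- s) refl _ _) (+-congˡ (·-neg m a))
      cancelling : - ⅀.sum (dir ∘ external) + secants z 1 ≈ 0#
      cancelling = begin
        - ⅀.sum (dir ∘ external) + secants z 1
          ≈⟨ +-cong (trans (-‿cong (MC.∑-members external? dir)) (sum-neg (λ i → ⟨ external? i ⟩ · dir i))) secants-1 ⟩
        ⅀.sum (λ i → - (⟨ external? i ⟩ · dir i)) + ⅀.sum (λ i → ⟨ secant? z i ⟩ · (- dir i))
          ≈⟨ ⅀.∑-distrib-+ (λ i → - (⟨ external? i ⟩ · dir i)) (λ i → ⟨ secant? z i ⟩ · (- dir i)) ⟨
        ⅀.sum (λ i → - (⟨ external? i ⟩ · dir i) + ⟨ secant? z i ⟩ · (- dir i))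
          ≈⟨ ⅀.sum-cong-≋ (λ i → trans (+-congʳ (·-neg ⟨ external? i ⟩ (dir i))) (trans (sym (×-homo-+ (- dir i) ⟨ external? i ⟩ ⟨ secant? z i ⟩))
               (trans (reflexive (≡.cong (_· (- dir i)) (secant+external i))) (+-identityʳ _)))) ⟩
        ⅀.sum (λ i → - dir i)
          ≈⟨ sum-neg dir ⟨
        - ⅀.sum dir
          ≈⟨ trans (-‿cong ∑dir≈0) -0#≈0# ⟩
        0# ∎

    -- As `G n` is e′(z) and `P 0` is B′(z)/B(z), this is the equation e′/e = -B′/B, cleared of
    -- denominators.
    Gₙ≈-P₀eₙ : G n ≈ - (P 0 * eₙ)
    Gₙ≈-P₀eₙ = trans Pₙ≈P₀*es (begin
      P 0 * es x 1                          ≈⟨ solve 3 (λ P a b → P :* a := P :* (a :+ b) :+ :- (P :* b)) refl (P 0) (es x 1) eₙ ⟩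
      P 0 * (es x 1 + eₙ) + - (P 0 * eₙ)    ≈⟨ +-congʳ (trans (*-congˡ es+eₙ≈0) (zeroʳ _)) ⟩
      0# + - (P 0 * eₙ)                     ≈⟨ +-identityˡ _ ⟩
      - (P 0 * eₙ)                          ∎)

    P₀≈∑u : P 0 ≈ ⅀.sum u
    P₀≈∑u = ⅀.sum-cong-≋ (λ j → *-identityˡ (u j))

  linears : Fin N → Series
  linears j = linear (- b j)

  Deg≤-linears : ∀ j → Deg≤ 1 (linears j)
  Deg≤-linears j = Deg≤-linear (- b j)

  -- H′ vanishes identically, so H is a polynomial in Z^p with too many roots for its degree.
  H : Series
  H = ΠS.sum linears ⊛ symmetric n

  deg : ℕ
  deg = N ℕ.* 1 ℕ.+ n ℕ.* r

  Deg≤-H : Deg≤ deg H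
  Deg≤-H = Deg≤-⊛ (Sym.Deg≤-∏ linears Deg≤-linears) (Deg≤-symmetric n)

  Hᴰ : ∀ z → EvD.ev deg H (z , 1#) D.≈ ΠD.sum (λ j → z - b j , 1#) D.* EvD.ev (n ℕ.* r) (symmetric n) (z , 1#)
  Hᴰ z = D.trans (EvD.ev-⊛ (N ℕ.* 1) (n ℕ.* r) (z , 1#) (Sym.Deg≤-∏ linears Deg≤-linears) (Deg≤-symmetric n))
    (D.*-congʳ {EvD.ev (n ℕ.* r) (symmetric n) (z , 1#)} (D.trans (SymD.ev-∏ linears Deg≤-linears (z , 1#)) (ΠD.sum-cong-≋ (λ j → linearᴰ j z))))

  symmetricᴰ-1 : ∀ z → proj₁ (EvD.ev (n ℕ.* r) (symmetric n) (z , 1#)) ≈ es (slope z) n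
  symmetricᴰ-1 z = trans (proj₁-ev (n ℕ.* r) (symmetric n) z) (ev-symmetric n z)

  ∏-point : ∀ {z j} → z ≈ b j → proj₁ (ΠD.sum (λ j → z - b j , 1#)) ≈ 0#
  ∏-point {z} {j} eq = trans (proj₁-∏ (λ j → z - b j)) (∏-zero (λ j → z - b j) j (trans (+-congʳ eq) (-‿inverseʳ _)))

  H-point : ∀ j → ev deg H (b j) ≈ 0#
  H-point j = trans (sym (proj₁-ev deg H (b j))) (trans (proj₁ (Hᴰ (b j))) (trans (proj₁ (dual-* (ΠD.sum (λ j′ → b j - b j′ , 1#)) _))
    (trans (*-congʳ (∏-point {b j} {j} refl)) (zeroˡ _))))

  -- At an arc point both B and e vanish, hence also B e′ + B′ e. Elsewhere the two terms cancel by
  -- `Gₙ≈-P₀eₙ`.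
  H′≈0 : ∀ z → proj₂ (EvD.ev deg H (z , 1#)) ≈ 0#
  H′≈0 z with outside? z
  ... | inj₁ (j , eq) = trans (proj₂ (Hᴰ z)) (trans (+-cong (trans (*-congʳ (∏-point eq)) (zeroˡ _))
      (trans (*-congˡ (trans (symmetricᴰ-1 z) (gap (es-point eq) n (s≤s z≤n) (s≤s (ℕ.<⇒≤ n<q))))) (zeroʳ _))) (+-identityˡ _))
  ... | inj₂ out = trans (proj₂ (Hᴰ z)) (begin
    proj₁ ΠL * proj₂ E + proj₂ ΠL * proj₁ E
      ≈⟨ +-cong (*-cong (proj₁ B) (trans symmetric′-n Gₙ≈-P₀eₙ)) (*-cong (proj₂ B) (symmetricᴰ-1 z)) ⟩
    Bz * - (P 0 * eₙ) + Bz * ⅀.sum u * eₙ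
      ≈⟨ +-congˡ (*-congʳ (*-congˡ P₀≈∑u)) ⟨
    Bz * - (P 0 * eₙ) + Bz * P 0 * eₙ
      ≈⟨ solve 3 (λ B P e → B :* :- (P :* e) :+ B :* P :* e := con (+ 0)) refl Bz (P 0) eₙ ⟩
    0# ∎)
    where
    open AtOutside out
    ΠL = ΠD.sum (λ j → z - b j , 1#)
    E = EvD.ev (n ℕ.* r) (symmetric n) (z , 1#)
    Bz = Π.sum (λ j → z - b j)
    B : ΠL D.≈ (Bz , Bz * ⅀.sum u)
    B = dual-∏ (λ j → z - b j) u xu

  deg+q : deg ℕ.+ q ≡ 2 ℕ.* n ℕ.* q
  deg+q = degree-identity {N} {q} {n} {r} N+q≡n[q+1] suc-r (≡.cong (ℕ._+ n ℕ.* r) (ℕ.*-identityʳ N))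

  cofactor : ∃ λ ρ → ρ ℕ.* n ≡ q × p ∣ ρ × 3 ℕ.≤ ρ
  cofactor = ρ , ≡.sym q≡ρn , go (proj₁ power) (proj₂ power)
    where
    ρ : ℕ
    ρ = quotient n∣q
    q≡ρn : q ≡ ρ ℕ.* n
    q≡ρn = _∣_.equality n∣q
    power : ∃ λ x → ρ ≡ p ℕ.^ x
    power = ∣p^h⇒power prime h (divides n (≡.trans (≡.sym q≡p^h) (≡.trans q≡ρn (ℕ.*-comm ρ n))))
    go : ∀ x → ρ ≡ p ℕ.^ x → p ∣ ρ × 3 ℕ.≤ ρ
    go zero    ρ≡ = contradiction n<q (ℕ.≤⇒≯ (ℕ.≤-reflexive (≡.trans q≡ρn (≡.trans (≡.cong (ℕ._* n) ρ≡) (ℕ.*-identityˡ n)))))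
    go (suc x) ρ≡ = ≡.subst (p ∣_) (≡.sym ρ≡) (m∣m*n (p ℕ.^ x)) ,
      ℕ.≤-trans 3≤p (ℕ.≤-trans (ℕ.m≤m*n p (p ℕ.^ x) {{ℕ.>-nonZero (ℕ.m^n>0 p {{prime⇒nonZero prime}} x)}}) (ℕ.≤-reflexive (≡.sym ρ≡)))

  deg≤q² : deg ℕ.≤ q ℕ.* q
  deg≤q² = degree≤q² deg q n (proj₁ cofactor) deg+q (proj₁ (proj₂ cofactor)) (proj₂ (proj₂ (proj₂ cofactor)))

  -- The derivative is the zero polynomial, so k · `H k` = 0, and k is invertible unless p divides
  -- it.
  H-∤ : ∀ k → k ℕ.≤ deg → ¬ (p ∣ k) → H k ≈ 0#
  H-∤ zero    _   p∤k = contradiction (p ∣0) p∤k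
  H-∤ (suc k) k<d p∤k = cancel (suc k · 1#) (H (suc k))
      (trans (×-assoc-* (suc k) 1# (H (suc k))) (trans (×-congʳ (suc k) (*-identityˡ _)) H′k)) (λ e → p∤k (char-∣ prime char e))
    where
    Deg≤-H′ : Deg≤ (ℕ.pred deg) (derivative H)
    Deg≤-H′ i d<i = trans (×-congʳ (suc i) (Deg≤-H (suc i) (s≤s d<i))) (·0 (suc i))
    H′k : suc k · H (suc k) ≈ 0#
    H′k = vanishing (ℕ.pred deg) (derivative H) Deg≤-H′ deg≤q² (λ z → trans (sym (proj₂-ev (ℕ.pred deg) H z)) (H′≈0 z)) k

  p∣deg : p ∣ deg
  p∣deg = ∣m+n∣m⇒∣n (≡.subst (p ∣_) (≡.trans (≡.sym deg+q) (ℕ.+-comm deg q)) (∣-trans p∣q (n∣m*n (2 ℕ.* n)))) p∣q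

  p′ : ℕ
  p′ = ℕ.pred p

  suc-p′ : suc p′ ≡ p
  suc-p′ = ℕ.suc-pred p {{prime⇒nonZero prime}}

  -- The degree of `H` as a polynomial in Z^p. From 3ε ≤ pε = deg < 3N it is smaller than the number
  -- of arc points.
  ε : ℕ
  ε = quotient p∣deg

  ε*p : ε ℕ.* suc p′ ≡ deg
  ε*p = ≡.trans (≡.cong (ε ℕ.*_) suc-p′) (≡.sym (_∣_.equality p∣deg))

  ε<N : ε ℕ.< N
  ε<N = ℕ.*-cancelʳ-< 3 ε N (ℕ.≤-<-trans (ℕ.≤-trans (ℕ.*-monoʳ-≤ ε 3≤p) (ℕ.≤-reflexive (≡.sym (_∣_.equality p∣deg)))) deg<3N)
    where
    deg<3N : deg ℕ.< N ℕ.* 3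
    deg<3N = degree<3N N q n′ deg N+q≡n[q+1] deg+q 2≤n′

  -- Taking p-th powers is injective, so the arc points give more than ε distinct roots in the
  -- variable Z^p.
  H-lead≈0 : H deg ≈ 0#
  H-lead≈0 = ≡.subst (λ d → H d ≈ 0#) ε*p (coeffs≈0 ε (λ l → H (l ℕ.* suc p′))
    (λ i → b (Fin.inject≤ i ε<N) ^ suc p′)
    (λ i j eq → inject≤-injective ε<N ε<N i j (b-injective _ _ (p^-injective 1 (≡.trans suc-p′ (≡.sym (ℕ.*-identityʳ p))) _ _ eq)))
    (λ i → trans (sym (ev-compress p′ ε H _ (λ k k≤ ∤k → H-∤ k (ℕ.≤-trans k≤ (ℕ.≤-reflexive ε*p)) (λ d → ∤k (≡.subst (_∣ k) (≡.sym suc-p′) d)))))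
      (trans (reflexive (≡.cong (λ d → ev d H (b (Fin.inject≤ i ε<N))) ε*p)) (H-point _))) ε ℕ.≤-refl)

  es-replicate : ∀ M a → es {M} (λ _ → a) S.≈ factor a S.^ M
  es-replicate M a = S.trans (es-∏ {M} (λ _ → a)) (ΠS.sum-replicate M)

  factor-^-coeff-1 : ∀ a m → (factor a S.^ m) 1 ≈ m · (- a)
  factor-^-coeff-1 a m = Unital-^-coeff m (unital refl λ { (suc k) _ (s≤s ()) }) 1 (s≤s z≤n) ℕ.≤-refl

  -- (1 - aT)^(mn) is the n-th power of 1 - maT + ..., and n is a power of p.
  es-replicate-n : ∀ M m a → M ≡ m ℕ.* n → es {M} (λ _ → a) n ≈ (m · (- a)) ^ n
  es-replicate-n .(m ℕ.* n) m a ≡.refl = trans (es-replicate (m ℕ.* n) a n) (trans (sym (S.^-assocʳ (factor a) m n n))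
    (trans (^n-n (factor a S.^ m)) (^-congˡ n (factor-^-coeff-1 a m))))

  H-lead : H deg ≈ es {N} (λ _ → 1#) n
  H-lead = trans (⊛-lead (Sym.Deg≤-∏ linears Deg≤-linears) (Deg≤-symmetric n))
    (trans (*-cong (Sym.∏-lead linears Deg≤-linears (λ _ → refl)) (Sym.es-lead linear^r Deg≤-linear^r n))
    (trans (*-identityˡ _) (es-cong linear^r-lead n)))

  N/n : ℕ
  N/n = quotient n∣N

  N≡N/n*n : N ≡ N/n ℕ.* n
  N≡N/n*n = _∣_.equality n∣N

  -- N/n + q/n = q + 1, and p divides both q/n and q; hence N/n is 1 modulo p.
  p∤N/n : ¬ (p ∣ N/n)
  p∤N/n p∣m = contradiction (∣⇒≤ (∣m+n∣m⇒∣n {p} {q} {1} (≡.subst (p ∣_) (≡.trans m+ρ (ℕ.+-comm 1 q))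
      (∣m∣n⇒∣m+n p∣m (proj₁ (proj₂ (proj₂ cofactor))))) p∣q)) (ℕ.<⇒≱ (ℕ.≤-trans (s≤s (s≤s z≤n)) 3≤p))
    where
    ρ = proj₁ cofactor
    m+ρ : N/n ℕ.+ ρ ≡ suc q
    m+ρ = ℕ.*-cancelʳ-≡ (N/n ℕ.+ ρ) (suc q) n (≡.trans (ℕ.*-distribʳ-+ n N/n ρ) (≡.trans (≡.cong₂ ℕ._+_ (≡.sym N≡N/n*n) (proj₁ (proj₂ cofactor)))
            (≡.trans N+q≡n[q+1] (ℕ.*-comm n (suc q)))))

  ·-neg-1 : ∀ m → - (m · (- 1#)) ≈ m · 1#
  ·-neg-1 zero    = -0#≈0#
  ·-neg-1 (suc m) = trans (solve 1 (λ s → :- (:- con (+ 1) :+ s) := con (+ 1) :+ :- s) refl _) (+-congˡ (·-neg-1 m))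

  H-lead≉0 : ¬ (H deg ≈ 0#)
  H-lead≉0 eq = ^-≉0 n (λ e0 → p∤N/n (char-∣ prime char (trans (sym (·-neg-1 N/n)) (trans (-‿cong e0) -0#≈0#))))
    (trans (sym (es-replicate-n N N/n 1# N≡N/n*n)) (trans (sym H-lead) eq))

  impossible : ⊥
  impossible = H-lead≉0 H-lead≈0

-- The affine plane as the field of order q²

module AffineArc {c ℓ} (F : CommutativeRing c ℓ) {q : ℕ} (FF : IsFiniteField F q)
  (δ : CommutativeRing.Carrier F)
  (nonsquare : ∀ x → ¬ CommutativeRing._≈_ F (CommutativeRing._*_ F x x) δ) where
  open CommutativeRing F hiding (zero)
  open FiniteField F FF
  open QuadraticExtension F FF δ nonsquare
  open Frobenius F
  open IntegerSolver F
  open import Relation.Binary.Reasoning.Setoid setoid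
  private
    module L where
      open CommutativeRing quadraticRing public
      open Frobenius quadraticRing public
    module LF = FiniteField quadraticRing quadraticField
    module SP = SeriesPowers quadraticRing
    module PS = PowerSeries quadraticRing
    module EL = Evaluation (idMap quadraticRing)

  scalar : Carrier → L.Carrier
  scalar a = a , 0#

  scalar-* : ∀ a x → scalar a L.* x L.≈ (a * proj₁ x , a * proj₂ x)
  scalar-* a (x , y) = solve 4 (λ a x y δ → a :* x :+ δ :* (con (+ 0) :* y) := a :* x) refl a x y δ
                     , solve 3 (λ a x y → a :* y :+ con (+ 0) :* x := a :* y) refl a x y

  scalar-^ : ∀ a m → scalar a L.^ m L.≈ scalar (a ^ m)
  scalar-^ a zero    = L.refl
  scalar-^ a (suc m) = L.trans (L.*-congˡ {scalar a} (scalar-^ a m)) (L.trans (scalar-* a (scalar (a ^ m))) (refl , zeroʳ a))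

  scalar-· : ∀ m → m L.· L.1# L.≈ scalar (m · 1#)
  scalar-· zero    = L.refl
  scalar-· (suc m) = L.trans (L.+-congˡ {L.1#} (scalar-· m)) (refl , +-identityˡ _)

  -- The q scalars are roots of X^q - X, so there are no others.
  ^q-fixed : ∀ x → x L.^ q L.≈ x → proj₂ x ≈ 0#
  ^q-fixed x x^q with proj₂ x ≈? 0#
  ... | yes e = e
  ... | no x∉F = contradiction (LF.top≈0 q f roots roots-inj root) top≉0
    where
    f : PS.Series
    f = (SP.X SP.S.^ q) PS.⊞ ((L.- L.1#) PS.• SP.X)
    X-high : ∀ k → 1 ℕ.< k → SP.X k L.≈ L.0#
    X-high (suc zero)    (s≤s ())
    X-high (suc (suc k)) _ = L.refl
    ev-X : ∀ y → EL.ev 1 SP.X y L.≈ y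
    ev-X y = L.trans (L.+-identityˡ _) (L.*-identityʳ y)
    top≉0 : ¬ (f q L.≈ L.0#)
    top≉0 e = LF.1≉0 (L.trans (L.sym (L.trans (L.+-cong (SP.X^-eq q) (L.trans (L.*-congˡ {L.- L.1#} (X-high q 1<q)) (L.zeroʳ _))) (L.+-identityʳ _))) e)
    roots : Fin (suc q) → L.Carrier
    roots zero    = x
    roots (suc t) = scalar (enum t)
    roots-inj : ∀ i j → roots i L.≈ roots j → i ≡ j
    roots-inj zero    zero    e = ≡.refl
    roots-inj zero    (suc j) e = contradiction (proj₂ e) x∉F
    roots-inj (suc i) zero    e = contradiction (sym (proj₂ e)) x∉F
    roots-inj (suc i) (suc j) e = ≡.cong suc (enum-injective (proj₁ e))
    value : ∀ y → EL.ev q f y L.≈ y L.^ q L.- y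
    value y = L.trans (EL.ev-⊞ q (SP.X SP.S.^ q) ((L.- L.1#) PS.• SP.X) y) (L.+-cong
      (L.trans (L.reflexive (≡.cong (λ d → EL.ev d (SP.X SP.S.^ q) y) (≡.sym (ℕ.*-identityʳ q))))
        (L.trans (EL.ev-^ 1 q y X-high) (L.^-congˡ q (ev-X y))))
      (L.trans (EL.ev-• q (L.- L.1#) SP.X y) (L.trans (L.*-congˡ {L.- L.1#} (L.trans (EL.ev-mono SP.X y (ℕ.<⇒≤ 1<q) X-high) (ev-X y))) (-1*x≈-x y))))
      where open import Algebra.Properties.Ring L.ring using (-1*x≈-x)
    root : ∀ i → EL.ev q f (roots i) L.≈ L.0#
    root i = L.trans (value (roots i)) (L.trans (L.+-congʳ (fixed i)) (L.-‿inverseʳ _))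
      where
      fixed : ∀ i → roots i L.^ q L.≈ roots i
      fixed zero    = x^q
      fixed (suc t) = L.trans (scalar-^ (enum t) q) (x^q≈x (enum t) , refl)

  -- The ratio of x and w is a (q - 1)-st root of unity, hence a scalar of the base field.
  parallelBy : ∀ x w v → w L.* v L.≈ L.1# → x L.^ (q ℕ.∸ 1) L.≈ w L.^ (q ℕ.∸ 1) →
               proj₁ x * proj₂ w ≈ proj₂ x * proj₁ w
  parallelBy x w v wv≈1 eq = begin
    proj₁ x * proj₂ w                     ≈⟨ *-congʳ (proj₁ x≈) ⟩
    (proj₁ ratio * proj₁ w) * proj₂ w     ≈⟨ solve 3 (λ t a b → (t :* a) :* b := (t :* b) :* a) refl _ _ _ ⟩
    (proj₁ ratio * proj₂ w) * proj₁ w     ≈⟨ *-congʳ (proj₂ x≈) ⟨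
    proj₂ x * proj₁ w                     ∎
    where
    ratio : L.Carrier
    ratio = x L.* v
    one-^ : ∀ m → L.1# L.^ m L.≈ L.1#
    one-^ zero    = L.refl
    one-^ (suc m) = L.trans (L.*-identityˡ _) (one-^ m)
    ratio^ : ratio L.^ (q ℕ.∸ 1) L.≈ L.1#
    ratio^ = L.trans (L.^-distrib-* x v (q ℕ.∸ 1)) (L.trans (L.*-congʳ {v L.^ (q ℕ.∸ 1)} eq)
      (L.trans (L.sym (L.^-distrib-* w v (q ℕ.∸ 1))) (L.trans (L.^-congˡ (q ℕ.∸ 1) wv≈1) (one-^ (q ℕ.∸ 1)))))
    ratio∈F : proj₂ ratio ≈ 0#
    ratio∈F = ^q-fixed ratio (L.trans (L.^-congʳ ratio (≡.sym suc[q∸1])) (L.trans (L.*-congˡ {ratio} ratio^) (L.*-identityʳ ratio)))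
    x≈ : x L.≈ (proj₁ ratio * proj₁ w , proj₁ ratio * proj₂ w)
    x≈ = L.trans (L.sym (L.*-identityʳ x)) (L.trans (L.*-congˡ {x} (L.trans (L.sym wv≈1) (L.*-comm w v)))
      (L.trans (L.sym (L.*-assoc x v w)) (L.trans (L.*-congʳ {w} {ratio} {scalar (proj₁ ratio)} (refl , ratio∈F)) (scalar-* (proj₁ ratio) w))))

  parallel : ∀ x w → ¬ (w L.≈ L.0#) → x L.^ (q ℕ.∸ 1) L.≈ w L.^ (q ℕ.∸ 1) → proj₁ x * proj₂ w ≈ proj₂ x * proj₁ w
  parallel x w w≉0 = parallelBy x w (proj₁ (LF.inverse w w≉0)) (proj₂ (LF.inverse w w≉0))

  direction : Fin (suc q) → L.Carrier
  direction zero    = 1# , 0#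
  direction (suc i) = enum i , 1#

  direction≉0 : ∀ i → ¬ (direction i L.≈ L.0#)
  direction≉0 zero    e = 1≉0 (proj₁ e)
  direction≉0 (suc i) e = 1≉0 (proj₂ e)

  slopeOf : Fin (suc q) → L.Carrier
  slopeOf i = direction i L.^ (q ℕ.∸ 1)

  slopeOf-injective : ∀ i j → slopeOf i L.≈ slopeOf j → i ≡ j
  slopeOf-injective i j eq = go i j (parallel (direction i) (direction j) (direction≉0 j) eq)
    where
    go : ∀ i j → proj₁ (direction i) * proj₂ (direction j) ≈ proj₂ (direction i) * proj₁ (direction j) → i ≡ j
    go zero    zero    e = ≡.refl
    go zero    (suc j) e = contradiction (trans (sym (*-identityˡ 1#)) (trans e (zeroˡ _))) 1≉0
    go (suc i) zero    e = contradiction (trans (sym (*-identityˡ 1#)) (trans (sym e) (zeroʳ _))) 1≉0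
    go (suc i) (suc j) e = ≡.cong suc (enum-injective (trans (sym (*-identityʳ _)) (trans e (*-identityˡ _))))

  slopeOf^ : ∀ i → slopeOf i L.^ suc q L.≈ L.1#
  slopeOf^ i = L.trans (L.^-assocʳ (direction i) (q ℕ.∸ 1) (suc q)) (L.trans (L.^-congʳ (direction i) exponent) (LF.fermat (direction≉0 i)))
    where
    exponent : (q ℕ.∸ 1) ℕ.* suc q ≡ q ℕ.* q ℕ.∸ 1
    exponent = go q 1<q
      where
      go : ∀ q → 1 ℕ.< q → (q ℕ.∸ 1) ℕ.* suc q ≡ q ℕ.* q ℕ.∸ 1
      go (suc m) _ = expand m
        where
        expand : ∀ m → m ℕ.* suc (suc m) ≡ m ℕ.+ m ℕ.* suc m
        expand = solve-∀

  slopeOf-scale : ∀ {u} t i → ¬ (t ≈ 0#) → u L.≈ (t * proj₁ (direction i) , t * proj₂ (direction i)) → u L.^ (q ℕ.∸ 1) L.≈ slopeOf i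
  slopeOf-scale t i t≉0 eq = L.trans (L.^-congˡ (q ℕ.∸ 1) (L.trans eq (L.sym (scalar-* t (direction i)))))
    (L.trans (L.^-distrib-* (scalar t) (direction i) (q ℕ.∸ 1))
    (L.trans (L.*-congʳ {slopeOf i} (L.trans (scalar-^ t (q ℕ.∸ 1)) (fermat t≉0 , refl))) (L.*-identityˡ (slopeOf i))))

  slopeOf-class : ∀ u → ¬ (u L.≈ L.0#) → ∃ λ i → u L.^ (q ℕ.∸ 1) L.≈ slopeOf i
  slopeOf-class (a , b) u≉0 with b ≈? 0#
  ... | yes b≈0 = zero , slopeOf-scale a zero (λ a≈0 → u≉0 (a≈0 , b≈0)) (sym (*-identityʳ a) , trans b≈0 (sym (zeroʳ a)))
  ... | no b≉0 with inverse b b≉0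
  ...   | b⁻¹ , bb⁻¹ = suc (index (a * b⁻¹)) , slopeOf-scale b (suc (index (a * b⁻¹))) b≉0
            (sym (trans (*-congˡ (enum-index (a * b⁻¹))) (trans (solve 3 (λ a b c → b :* (a :* c) := a :* (b :* c)) refl a b b⁻¹)
               (trans (*-congˡ bb⁻¹) (*-identityʳ a)))) , sym (*-identityʳ b))

  module _ {p h n′ : ℕ} (pp : Prime p) (char : p · 1# ≈ 0#) (q≡p^h : q ≡ p ℕ.^ h)
    (2≤n′ : 2 ℕ.≤ n′) (n<q : suc n′ ℕ.< q)
    (point : Fin (suc (n′ ℕ.* suc q)) → L.Carrier)
    (point-injective : ∀ i j → point i L.≈ point j → i ≡ j)
    (line : ∀ c₀ c₁ c₂ → ¬ (c₀ ≈ 0# × c₁ ≈ 0# × c₂ ≈ 0#) →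
            count (λ j → (c₀ + (c₁ * proj₁ (point j) + c₂ * proj₂ (point j))) ≈? 0#) ℕ.≤ suc n′) where

    arc : MaximalArc quadraticRing q n′
    arc = record
      { isFiniteField = quadraticField
      ; p = p ; h = h
      ; prime = pp
      ; char = L.trans (scalar-· p) (char , refl)
      ; q≡p^h = q≡p^h
      ; 2≤n′ = 2≤n′
      ; n<q = n<q
      ; b = point
      ; b-injective = point-injective
      ; dir = slopeOf
      ; dir-injective = slopeOf-injective
      ; dir^ = slopeOf^
      ; dir-of = slopeOf-class
      ; line-≤ = line-≤
      }
      where
      0^ : ∀ m → 0 ℕ.< m → L.0# L.^ m L.≈ L.0#
      0^ (suc m) _ = L.zeroˡ _
      line-≤ : ∀ j i → count (λ j′ → ((point j L.- point j′) L.^ (q ℕ.∸ 1)) LF.≈? slopeOf i) ℕ.≤ n′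
      -- The affine line carries at most n points, one of which is `point j` itself, with slope 0.
      -- This leaves `n′` for the given direction.
      line-≤ j i = ℕ.≤-pred (ℕ.≤-trans (ℕ.≤-reflexive (≡.sym (≡.cong₂ ℕ._+_ (count-unique (_≟ᶠ j) j ≡.refl (λ _ e → e)) ≡.refl)))
        (ℕ.≤-trans (ℕ.≤-reflexive (≡.sym (Σℕ.∑-distrib-+ (λ j′ → ⟨ j′ ≟ᶠ j ⟩) (λ j′ → ⟨ on j′ ⟩))))
        (ℕ.≤-trans (∑-mono-≤ (λ j′ → ⟨ j′ ≟ᶠ j ⟩ ℕ.+ ⟨ on j′ ⟩) _ bound) (line c₀ c₁ c₂ c≉0))))
        where
        on : ∀ j′ → Dec ((point j L.- point j′) L.^ (q ℕ.∸ 1) L.≈ slopeOf i)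
        on j′ = ((point j L.- point j′) L.^ (q ℕ.∸ 1)) LF.≈? slopeOf i
        w₁ = proj₁ (direction i)
        w₂ = proj₂ (direction i)
        y₀ = proj₁ (point j)
        z₀ = proj₂ (point j)
        -- Coefficients of the line through `point j` with direction vector (w₁, w₂).
        c₀ = w₂ * y₀ - w₁ * z₀
        c₁ = - w₂
        c₂ = w₁
        c≉0 : ¬ (c₀ ≈ 0# × c₁ ≈ 0# × c₂ ≈ 0#)
        c≉0 (_ , e₁ , e₂) = direction≉0 i (e₂ , trans (solve 1 (λ x → x := :- (:- x)) refl w₂) (trans (-‿cong e₁) -0#≈0#))
          where open import Algebra.Properties.Ring ring using (-0#≈0#)
        value : ∀ j′ → Carrier
        value j′ = c₀ + (c₁ * proj₁ (point j′) + c₂ * proj₂ (point j′))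
        value≈ : ∀ j′ → value j′ ≈ (y₀ - proj₁ (point j′)) * w₂ - (z₀ - proj₂ (point j′)) * w₁
        value≈ j′ = solve 6 (λ a b y z y′ z′ → (b :* y :- a :* z) :+ ((:- b) :* y′ :+ a :* z′) := (y :- y′) :* b :- (z :- z′) :* a) refl
                      w₁ w₂ y₀ z₀ (proj₁ (point j′)) (proj₂ (point j′))
        self : ∀ {j′} → j′ ≡ j → value j′ ≈ 0#
        self ≡.refl = trans (value≈ j) (solve 4 (λ a b y z → (y :- y) :* b :- (z :- z) :* a := con (+ 0)) refl w₁ w₂ y₀ z₀)
        other : ∀ j′ → (point j L.- point j′) L.^ (q ℕ.∸ 1) L.≈ slopeOf i → value j′ ≈ 0#
        other j′ e = trans (value≈ j′) (trans (+-congʳ (parallel (point j L.- point j′) (direction i) (direction≉0 i) e)) (-‿inverseʳ _))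
        bound : ∀ j′ → ⟨ j′ ≟ᶠ j ⟩ ℕ.+ ⟨ on j′ ⟩ ℕ.≤ ⟨ value j′ ≈? 0# ⟩
        bound j′ with j′ ≟ᶠ j
        ... | yes e = ℕ.≤-reflexive (≡.trans (≡.cong suc (⟨⟩-no (on j′) self∉)) (≡.sym (⟨⟩-yes (value j′ ≈? 0#) (self e))))
          where
          self∉ : ¬ ((point j L.- point j′) L.^ (q ℕ.∸ 1) L.≈ slopeOf i)
          self∉ s = LF.1≉0 (L.trans (L.sym (slopeOf^ i)) (L.trans (L.^-congˡ (suc q) (L.trans (L.sym s)
            (L.trans (L.^-congˡ (q ℕ.∸ 1) (L.trans (L.reflexive (≡.cong (λ k → point j L.- point k) e)) (L.-‿inverseʳ (point j)))) (0^ (q ℕ.∸ 1) (ℕ.m<n⇒0<n∸m 1<q))))) (L.zeroˡ _)))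
        ... | no _ = ⟨⟩-mono (on j′) (value j′ ≈? 0#) (other j′)

    noArc : ∀ {e} → suc n′ ≡ p ℕ.^ e → 3 ℕ.≤ p → ⊥
    noArc {e} n≡p^e 3≤p = BallBlokhuis.impossible arc e n≡p^e 3≤p

-- Arcs in the projective plane

∑-saturated-≥ : ∀ {m} (f : Fin m → ℕ) c → (∀ i → c ℕ.≤ f i) → Σℕ.sum f ℕ.≤ m ℕ.* c → ∀ i → f i ≡ c
∑-saturated-≥ {suc m} f c c≤f full i with f i ℕ.≟ c
... | yes e = e
... | no n  = contradiction full (ℕ.<⇒≱ (begin-strict
  c ℕ.+ m ℕ.* c                             ≤⟨ ℕ.+-monoʳ-≤ c (∑-≥-const _ c (λ j → c≤f (punchIn i j))) ⟩
  c ℕ.+ Σℕ.sum (λ j → f (punchIn i j))      <⟨ ℕ.+-monoˡ-< _ (ℕ.≤∧≢⇒< (c≤f i) (n ∘ ≡.sym)) ⟩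
  f i ℕ.+ Σℕ.sum (λ j → f (punchIn i j))    ≡⟨ Σℕ.sum-remove {i = i} f ⟨
  Σℕ.sum f                                  ∎))
  where open ℕ.≤-Reasoning

-- Meant for the lines through a point of an arc that is one point below the maximal size: a total
-- deficit of one singles out one line.
∑-defect-1 : ∀ {m} (f : Fin m → ℕ) c → (∀ i → f i ℕ.≤ suc c) → suc (Σℕ.sum f) ≡ m ℕ.* suc c →
             ∃ λ i → f i ≡ c × (∀ j → ¬ j ≡ i → f j ≡ suc c)
∑-defect-1 {suc m} f c f≤ def with any? (λ i → ¬? (f i ℕ.≟ suc c))
... | no none = contradiction (≡.trans def (≡.sym (≡.trans (Σℕ.sum-cong-≗ all) (∑-const (suc m) (suc c))))) (ℕ.1+n≢n)
  where
  all : ∀ i → f i ≡ suc c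
  all i with f i ℕ.≟ suc c
  ... | yes e = e
  ... | no n  = contradiction (i , n) none
... | yes (i , fi≢) = i , ℕ.≤-antisym fi≤c (ℕ.+-cancelʳ-≤ (m ℕ.* suc c) c (f i) (ℕ.≤-trans lower (ℕ.+-monoʳ-≤ (f i) rest≤))) , others
  where
  rest : ℕ
  rest = Σℕ.sum (λ j → f (punchIn i j))
  rest≤ : rest ℕ.≤ m ℕ.* suc c
  rest≤ = ∑-≤-const _ (suc c) (λ j → f≤ (punchIn i j))
  fi≤c : f i ℕ.≤ c
  fi≤c = ℕ.≤-pred (ℕ.≤∧≢⇒< (f≤ i) fi≢)
  total : suc (f i ℕ.+ rest) ≡ suc c ℕ.+ m ℕ.* suc c
  total = ≡.trans (≡.cong suc (≡.sym (Σℕ.sum-remove {i = i} f))) def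
  lower : c ℕ.+ m ℕ.* suc c ℕ.≤ f i ℕ.+ rest
  lower = ℕ.≤-reflexive (≡.sym (ℕ.suc-injective total))
  rest-full : m ℕ.* suc c ℕ.≤ rest
  rest-full = ℕ.+-cancelˡ-≤ c _ _ (ℕ.≤-trans lower (ℕ.+-monoˡ-≤ rest fi≤c))
  others : ∀ j → ¬ j ≡ i → f j ≡ suc c
  others j j≢i = ≡.trans (≡.cong f (≡.sym (punchIn-punchOut (j≢i ∘ ≡.sym))))
    (∑-saturated (λ k → f (punchIn i k)) (suc c) (λ k → f≤ (punchIn i k)) rest-full (punchOut (j≢i ∘ ≡.sym)))

count-find-not : ∀ {a m} {P : Fin m → Set a} (P? : ∀ i → Dec (P i)) → count P? ℕ.< m → ∃ λ i → ¬ P i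
count-find-not P? lt with any? (λ i → ¬? (P? i))
... | yes p = p
... | no none = contradiction (count-all P? all) (ℕ.<⇒≢ lt)
  where
  all : ∀ i → _
  all i with P? i
  ... | yes p = p
  ... | no n  = contradiction (i , n) none

module Plane {c ℓ} (F : CommutativeRing c ℓ) {q : ℕ} (FF : IsFiniteField F q) where
  open CommutativeRing F hiding (zero)
  open FiniteField F FF
  open IntegerSolver F
  open import Relation.Binary.Reasoning.Setoid setoid
  open import Algebra.Properties.Ring ring using (x∙y⁻¹≈ε⇒x≈y; -0#≈0#)

  -- Unnormalised homogeneous coordinates, used for points and for lines alike, so that every count
  -- can be dualised. Incidence is `_∙_` and projective equality is `_∥_`; the zero vector has to be
  -- excluded by hand.
  V : Set c
  V = Carrier × Carrier × Carrier

  infix 4 _≈ᵛ_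
  _≈ᵛ_ : V → V → Set ℓ
  (a₁ , a₂ , a₃) ≈ᵛ (b₁ , b₂ , b₃) = a₁ ≈ b₁ × a₂ ≈ b₂ × a₃ ≈ b₃

  0ᵛ : V
  0ᵛ = 0# , 0# , 0#

  infixl 7 _∙_
  _∙_ : V → V → Carrier
  (a₁ , a₂ , a₃) ∙ (b₁ , b₂ , b₃) = a₁ * b₁ + (a₂ * b₂ + a₃ * b₃)

  infixr 8 _⋆_
  _⋆_ : Carrier → V → V
  t ⋆ (a₁ , a₂ , a₃) = t * a₁ , t * a₂ , t * a₃

  infixl 6 _⊕_
  _⊕_ : V → V → V
  (a₁ , a₂ , a₃) ⊕ (b₁ , b₂ , b₃) = a₁ + b₁ , a₂ + b₂ , a₃ + b₃

  cross : V → V → V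
  cross (a₁ , a₂ , a₃) (b₁ , b₂ , b₃) = a₂ * b₃ - a₃ * b₂ , a₃ * b₁ - a₁ * b₃ , a₁ * b₂ - a₂ * b₁

  infix 4 _∥_
  _∥_ : V → V → Set ℓ
  a ∥ b = cross a b ≈ᵛ 0ᵛ

  _≈0ᵛ? : ∀ a → Dec (a ≈ᵛ 0ᵛ)
  (a₁ , a₂ , a₃) ≈0ᵛ? = (a₁ ≈? 0#) ×-dec ((a₂ ≈? 0#) ×-dec (a₃ ≈? 0#))

  _∥?_ : ∀ a b → Dec (a ∥ b)
  a ∥? b = cross a b ≈0ᵛ?

  ≈ᵛ-refl : ∀ {a} → a ≈ᵛ a
  ≈ᵛ-refl = refl , refl , refl

  ≈ᵛ-sym : ∀ {a b} → a ≈ᵛ b → b ≈ᵛ a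
  ≈ᵛ-sym (p , q , r) = sym p , sym q , sym r

  ≈ᵛ-trans : ∀ {a b d} → a ≈ᵛ b → b ≈ᵛ d → a ≈ᵛ d
  ≈ᵛ-trans (p , q , r) (p′ , q′ , r′) = trans p p′ , trans q q′ , trans r r′

  ∙-cong : ∀ {a a′ b b′} → a ≈ᵛ a′ → b ≈ᵛ b′ → a ∙ b ≈ a′ ∙ b′
  ∙-cong (p , q , r) (p′ , q′ , r′) = +-cong (*-cong p p′) (+-cong (*-cong q q′) (*-cong r r′))

  ⋆-cong : ∀ {t t′ a a′} → t ≈ t′ → a ≈ᵛ a′ → t ⋆ a ≈ᵛ t′ ⋆ a′
  ⋆-cong e (p , q , r) = *-cong e p , *-cong e q , *-cong e r

  ∙-comm : ∀ a b → a ∙ b ≈ b ∙ a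
  ∙-comm a b = +-cong (*-comm _ _) (+-cong (*-comm _ _) (*-comm _ _))

  ∙-⋆ʳ : ∀ a t b → a ∙ (t ⋆ b) ≈ t * (a ∙ b)
  ∙-⋆ʳ (a₁ , a₂ , a₃) t (b₁ , b₂ , b₃) =
    solve 7 (λ a b c t x y z → a :* (t :* x) :+ (b :* (t :* y) :+ c :* (t :* z)) := t :* (a :* x :+ (b :* y :+ c :* z))) refl a₁ a₂ a₃ t b₁ b₂ b₃

  ∙-⊕ʳ : ∀ a b d → a ∙ (b ⊕ d) ≈ a ∙ b + a ∙ d
  ∙-⊕ʳ (a₁ , a₂ , a₃) (b₁ , b₂ , b₃) (d₁ , d₂ , d₃) =
    solve 9 (λ a b c x y z u v w → a :* (x :+ u) :+ (b :* (y :+ v) :+ c :* (z :+ w))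
      := (a :* x :+ (b :* y :+ c :* z)) :+ (a :* u :+ (b :* v :+ c :* w))) refl a₁ a₂ a₃ b₁ b₂ b₃ d₁ d₂ d₃

  ∙-0ʳ : ∀ a {b} → b ≈ᵛ 0ᵛ → a ∙ b ≈ 0#
  ∙-0ʳ (a₁ , a₂ , a₃) e = trans (∙-cong {a₁ , a₂ , a₃} ≈ᵛ-refl e) (solve 3 (λ a b c → a :* con (+ 0) :+ (b :* con (+ 0) :+ c :* con (+ 0)) := con (+ 0)) refl a₁ a₂ a₃)

  ⋆-0 : ∀ {t} a → t ≈ 0# → t ⋆ a ≈ᵛ 0ᵛ
  ⋆-0 a e = trans (*-congʳ e) (zeroˡ _) , trans (*-congʳ e) (zeroˡ _) , trans (*-congʳ e) (zeroˡ _)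

  cross-∙ˡ : ∀ a b → a ∙ cross a b ≈ 0#
  cross-∙ˡ (a₁ , a₂ , a₃) (b₁ , b₂ , b₃) = solve 6 (λ a b c x y z → a :* (b :* z :- c :* y) :+ (b :* (c :* x :- a :* z) :+ c :* (a :* y :- b :* x)) := con (+ 0)) refl a₁ a₂ a₃ b₁ b₂ b₃

  cross-∙ʳ : ∀ a b → b ∙ cross a b ≈ 0#
  cross-∙ʳ (a₁ , a₂ , a₃) (b₁ , b₂ , b₃) = solve 6 (λ a b c x y z → x :* (b :* z :- c :* y) :+ (y :* (c :* x :- a :* z) :+ z :* (a :* y :- b :* x)) := con (+ 0)) refl a₁ a₂ a₃ b₁ b₂ b₃

  cross-cong : ∀ {a a′ b b′} → a ≈ᵛ a′ → b ≈ᵛ b′ → cross a b ≈ᵛ cross a′ b′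
  cross-cong (p , q , r) (p′ , q′ , r′) =
    +-cong (*-cong q r′) (-‿cong (*-cong r q′)) , +-cong (*-cong r p′) (-‿cong (*-cong p r′)) , +-cong (*-cong p q′) (-‿cong (*-cong q p′))

  ⋆-∥-⋆ : ∀ t s a → t ⋆ a ∥ s ⋆ a
  ⋆-∥-⋆ t s (a₁ , a₂ , a₃) = go a₂ a₃ , go a₃ a₁ , go a₁ a₂
    where
    go : ∀ x y → (t * x) * (s * y) - (t * y) * (s * x) ≈ 0#
    go x y = solve 4 (λ t s x y → (t :* x) :* (s :* y) :- (t :* y) :* (s :* x) := con (+ 0)) refl t s x y

  ∥-common : ∀ {a b t s d} → a ≈ᵛ t ⋆ d → b ≈ᵛ s ⋆ d → a ∥ b
  ∥-common {t = t} {s} {d} ea eb = ≈ᵛ-trans (cross-cong ea eb) (⋆-∥-⋆ t s d)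

  1⋆ : ∀ a → a ≈ᵛ 1# ⋆ a
  1⋆ a = sym (*-identityˡ _) , sym (*-identityˡ _) , sym (*-identityˡ _)

  ⋆⋆ : ∀ t s a → t ⋆ s ⋆ a ≈ᵛ (t * s) ⋆ a
  ⋆⋆ t s a = sym (*-assoc _ _ _) , sym (*-assoc _ _ _) , sym (*-assoc _ _ _)

  ⋆≉0 : ∀ {a b t} → ¬ (a ≈ᵛ 0ᵛ) → a ≈ᵛ t ⋆ b → ¬ (t ≈ 0#)
  ⋆≉0 {b = b} a≉0 e t≈0 = a≉0 (≈ᵛ-trans e (⋆-0 b t≈0))

  -- The two-dimensional space of functionals vanishing at P, or dually of points on the line P.
  record Pencil (P : V) : Set (c ⊔ ℓ) where
    field
      u w    : V
      P∙u    : P ∙ u ≈ 0#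
      P∙w    : P ∙ w ≈ 0#
      indep  : ∀ α β → α ⋆ u ⊕ β ⋆ w ≈ᵛ 0ᵛ → α ≈ 0# × β ≈ 0#
      cover  : ∀ a → P ∙ a ≈ 0# → ∃ λ α → ∃ λ β → a ≈ᵛ α ⋆ u ⊕ β ⋆ w
      meet   : ∀ x → x ∙ u ≈ 0# → x ∙ w ≈ 0# → ∃ λ t → x ≈ᵛ t ⋆ P
      ∥⇒∙u   : ∀ x → x ∥ P → x ∙ u ≈ 0# × x ∙ w ≈ 0#

  pencil₁ : ∀ P → ¬ (proj₁ P ≈ 0#) → Pencil P
  pencil₁ (a , b , d) a≉0 with inverse a a≉0
  ... | i , ai≈1 = record
    { u = - b , a , 0#
    ; w = - d , 0# , a
    ; P∙u = solve 3 (λ a b d → a :* :- b :+ (b :* a :+ d :* con (+ 0)) := con (+ 0)) refl a b d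
    ; P∙w = solve 3 (λ a b d → a :* :- d :+ (b :* con (+ 0) :+ d :* a) := con (+ 0)) refl a b d
    ; indep = λ α β (_ , e₂ , e₃) →
        cancel a α (trans (solve 3 (λ a α β → a :* α := α :* a :+ β :* con (+ 0)) refl a α β) e₂) a≉0 ,
        cancel a β (trans (solve 3 (λ a α β → a :* β := α :* con (+ 0) :+ β :* a) refl a α β) e₃) a≉0
    ; cover = λ (x , y , z) e → y * i , z * i ,
        (begin
          x                                           ≈⟨ solve 2 (λ x i → x := con (+ 1) :* x) refl x i ⟩
          1# * x                                      ≈⟨ *-congʳ ai≈1 ⟨
          (a * i) * x                                 ≈⟨ solve 7 (λ a b d x y z i → (a :* i) :* x := (a :* x :+ (b :* y :+ d :* z)) :* i :+ ((y :* i) :* :- b :+ (z :* i) :* :- d)) refl a b d x y z i ⟩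
          (a * x + (b * y + d * z)) * i + ((y * i) * - b + (z * i) * - d)  ≈⟨ trans (+-congʳ (trans (*-congʳ e) (zeroˡ i))) (+-identityˡ _) ⟩
          (y * i) * - b + (z * i) * - d               ∎) ,
        unit y z , trans (unit z y) (+-comm _ _)
    ; meet = λ (x , y , z) e₁ e₂ → x * i , unit₀ x ,
        (begin
          y                   ≈⟨ trans (sym (*-identityˡ y)) (*-congʳ (sym ai≈1)) ⟩
          (a * i) * y         ≈⟨ solve 6 (λ a b x y z i → (a :* i) :* y := (x :* :- b :+ (y :* a :+ z :* con (+ 0))) :* i :+ (x :* i) :* b) refl a b x y z i ⟩
          (x * - b + (y * a + z * 0#)) * i + (x * i) * b  ≈⟨ trans (+-congʳ (trans (*-congʳ e₁) (zeroˡ i))) (+-identityˡ _) ⟩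
          (x * i) * b         ∎) ,
        (begin
          z                   ≈⟨ trans (sym (*-identityˡ z)) (*-congʳ (sym ai≈1)) ⟩
          (a * i) * z         ≈⟨ solve 6 (λ a d x y z i → (a :* i) :* z := (x :* :- d :+ (y :* con (+ 0) :+ z :* a)) :* i :+ (x :* i) :* d) refl a d x y z i ⟩
          (x * - d + (y * 0# + z * a)) * i + (x * i) * d  ≈⟨ trans (+-congʳ (trans (*-congʳ e₂) (zeroˡ i))) (+-identityˡ _) ⟩
          (x * i) * d         ∎)
    ; ∥⇒∙u = λ (x , y , z) (_ , e₂ , e₃) →
        trans (solve 5 (λ a b x y z → x :* :- b :+ (y :* a :+ z :* con (+ 0)) := :- (x :* b :- y :* a)) refl a b x y z) (trans (-‿cong e₃) -0#≈0#) ,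
        trans (solve 5 (λ a d x y z → x :* :- d :+ (y :* con (+ 0) :+ z :* a) := z :* a :- x :* d) refl a d x y z) e₂
    }
    where
    unit : ∀ y z → y ≈ (y * i) * a + (z * i) * 0#
    unit y z = trans (trans (sym (*-identityʳ y)) (*-congˡ (sym ai≈1))) (solve 4 (λ a i y z → y :* (a :* i) := (y :* i) :* a :+ (z :* i) :* con (+ 0)) refl a i y z)
    unit₀ : ∀ x → x ≈ (x * i) * a
    unit₀ x = trans (trans (sym (*-identityʳ x)) (*-congˡ (sym ai≈1))) (solve 3 (λ a i x → x :* (a :* i) := (x :* i) :* a) refl a i x)

  rot rot⁻¹ : V → V
  rot (a , b , d) = b , d , a
  rot⁻¹ (a , b , d) = d , a , b

  rot-∙ : ∀ a b → rot a ∙ b ≈ a ∙ rot⁻¹ b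
  rot-∙ (a , b , d) (x , y , z) = solve 6 (λ a b d x y z → b :* x :+ (d :* y :+ a :* z) := a :* z :+ (b :* x :+ d :* y)) refl a b d x y z

  -- A cyclic shift brings a nonzero coordinate to the front, so that an explicit basis is needed in
  -- one case only.
  rotatePencil : ∀ P → Pencil (rot P) → Pencil P
  rotatePencil P pen = record
    { u = rot⁻¹ u ; w = rot⁻¹ w
    ; P∙u = trans (sym (rot-∙ P u)) P∙u
    ; P∙w = trans (sym (rot-∙ P w)) P∙w
    ; indep = λ α β (e₁ , e₂ , e₃) → indep α β (e₂ , e₃ , e₁)
    ; cover = λ a e → let α , β , e₁ , e₂ , e₃ = cover (rot a) (trans (rot-∙ P (rot a)) e) in α , β , e₃ , e₁ , e₂
    ; meet = λ x e₁ e₂ → let t , e₁ , e₂ , e₃ = meet (rot x) (trans (rot-∙ x u) e₁) (trans (rot-∙ x w) e₂) in t , e₃ , e₁ , e₂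
    ; ∥⇒∙u = λ x (e₁ , e₂ , e₃) → let d₁ , d₂ = ∥⇒∙u (rot x) (e₂ , e₃ , e₁) in trans (sym (rot-∙ x u)) d₁ , trans (sym (rot-∙ x w)) d₂
    }
    where open Pencil pen

  abstract
    pencil : ∀ P → ¬ (P ≈ᵛ 0ᵛ) → Pencil P
    pencil P@(a , b , d) P≉0 with a ≈? 0# | b ≈? 0# | d ≈? 0#
    ... | no a≉0 | _       | _       = pencil₁ P a≉0
    ... | yes _  | no b≉0  | _       = rotatePencil P (pencil₁ (rot P) b≉0)
    ... | yes _  | yes _   | no d≉0  = rotatePencil P (rotatePencil (rot P) (pencil₁ (rot (rot P)) d≉0))
    ... | yes e₁ | yes e₂  | yes e₃  = contradiction (e₁ , e₂ , e₃) P≉0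

  module OnPencil {P : V} (pen : Pencil P) where
    open Pencil pen public

    member : Fin (suc q) → V
    member zero    = u
    member (suc i) = w ⊕ enum i ⋆ u

    coordinates : Fin (suc q) → Carrier × Carrier
    coordinates zero    = 1# , 0#
    coordinates (suc i) = enum i , 1#

    member≈ : ∀ i → member i ≈ᵛ proj₁ (coordinates i) ⋆ u ⊕ proj₂ (coordinates i) ⋆ w
    member≈ zero    = go , go , go
      where
      go : ∀ {x y} → x ≈ 1# * x + 0# * y
      go {x} {y} = solve 2 (λ x y → x := con (+ 1) :* x :+ con (+ 0) :* y) refl x y
    member≈ (suc i) = go , go , go
      where
      go : ∀ {x y} → y + enum i * x ≈ enum i * x + 1# * y
      go {x} {y} = solve 3 (λ t x y → y :+ t :* x := t :* x :+ con (+ 1) :* y) refl (enum i) x y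

    coordinates≉0 : ∀ i → ¬ (proj₁ (coordinates i) ≈ 0# × proj₂ (coordinates i) ≈ 0#)
    coordinates≉0 zero    (e , _) = 1≉0 e
    coordinates≉0 (suc i) (_ , e) = 1≉0 e

    coordinates-unique : ∀ {t t′} i i′ → ¬ (t ≈ 0#) → t * proj₁ (coordinates i) ≈ t′ * proj₁ (coordinates i′) →
                         t * proj₂ (coordinates i) ≈ t′ * proj₂ (coordinates i′) → i ≡ i′
    coordinates-unique zero    zero     t≉0 e₁ e₂ = ≡.refl
    coordinates-unique zero    (suc i′) t≉0 e₁ e₂ = contradiction (trans (sym (*-identityʳ _)) (trans e₁
      (trans (*-congʳ (trans (sym (*-identityʳ _)) (trans (sym e₂) (zeroʳ _)))) (zeroˡ _)))) t≉0
    coordinates-unique (suc i) zero     t≉0 e₁ e₂ = contradiction (trans (sym (*-identityʳ _)) (trans e₂ (zeroʳ _))) t≉0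
    coordinates-unique {t} {t′} (suc i) (suc i′) t≉0 e₁ e₂ = ≡.cong suc (enum-injective (*-cancelʳ-≉0 t≉0
      (trans (*-comm _ _) (trans e₁ (trans (*-congʳ (trans (sym (*-identityʳ t′)) (trans (sym e₂) (*-identityʳ t)))) (*-comm _ _))))))

    member-unique : ∀ {x t t′} i i′ → ¬ (t ≈ 0#) → x ≈ᵛ t ⋆ member i → x ≈ᵛ t′ ⋆ member i′ → i ≡ i′
    member-unique {x} {t} {t′} i i′ t≉0 e e′ = coordinates-unique i i′ t≉0 (x∙y⁻¹≈ε⇒x≈y _ _ (proj₁ both)) (x∙y⁻¹≈ε⇒x≈y _ _ (proj₂ both))
      where
      α = proj₁ (coordinates i)
      β = proj₂ (coordinates i)
      α′ = proj₁ (coordinates i′)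
      β′ = proj₂ (coordinates i′)
      same : ∀ x m m′ a b → x ≈ t * m → x ≈ t′ * m′ → m ≈ α * a + β * b → m′ ≈ α′ * a + β′ * b →
             (t * α - t′ * α′) * a + (t * β - t′ * β′) * b ≈ 0#
      same x m m′ a b p p′ r r′ = begin
        (t * α - t′ * α′) * a + (t * β - t′ * β′) * b
          ≈⟨ solve 8 (λ t s α α′ β β′ a b → (t :* α :- s :* α′) :* a :+ (t :* β :- s :* β′) :* b := t :* (α :* a :+ β :* b) :- s :* (α′ :* a :+ β′ :* b)) refl t t′ α α′ β β′ a b ⟩
        t * (α * a + β * b) - t′ * (α′ * a + β′ * b)
          ≈⟨ +-cong (*-congˡ r) (-‿cong (*-congˡ r′)) ⟨
        t * m - t′ * m′
          ≈⟨ +-cong p (-‿cong p′) ⟨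
        x - x
          ≈⟨ -‿inverseʳ x ⟩
        0# ∎
      both : t * α - t′ * α′ ≈ 0# × t * β - t′ * β′ ≈ 0#
      both = indep (t * α - t′ * α′) (t * β - t′ * β′)
        ( same _ _ _ _ _ (proj₁ e) (proj₁ e′) (proj₁ (member≈ i)) (proj₁ (member≈ i′))
        , same _ _ _ _ _ (proj₁ (proj₂ e)) (proj₁ (proj₂ e′)) (proj₁ (proj₂ (member≈ i))) (proj₁ (proj₂ (member≈ i′)))
        , same _ _ _ _ _ (proj₂ (proj₂ e)) (proj₂ (proj₂ e′)) (proj₂ (proj₂ (member≈ i))) (proj₂ (proj₂ (member≈ i′))))

    member≉0 : ∀ i → ¬ (member i ≈ᵛ 0ᵛ)
    member≉0 i e = coordinates≉0 i (indep _ _ (≈ᵛ-trans (≈ᵛ-sym (member≈ i)) e))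

    P∙member : ∀ i → P ∙ member i ≈ 0#
    P∙member zero    = P∙u
    P∙member (suc i) = trans (∙-⊕ʳ P w (enum i ⋆ u)) (trans (+-cong P∙w (trans (∙-⋆ʳ P (enum i) u) (trans (*-congˡ P∙u) (zeroʳ _)))) (+-identityˡ _))

    ∙member-suc : ∀ x i → x ∙ member (suc i) ≈ x ∙ w + enum i * (x ∙ u)
    ∙member-suc x i = trans (∙-⊕ʳ x w (enum i ⋆ u)) (+-congˡ (∙-⋆ʳ x (enum i) u))

    coverMember : ∀ a → ¬ (a ≈ᵛ 0ᵛ) → P ∙ a ≈ 0# → ∃ λ i → ∃ λ t → ¬ (t ≈ 0#) × a ≈ᵛ t ⋆ member i
    coverMember a a≉0 e with cover a e
    ... | α , β , eq with β ≈? 0#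
    ...   | yes β≈0 = zero , α , ⋆≉0 {b = u} a≉0 eq′ , eq′
      where
      go : ∀ {x y} → α * x + β * y ≈ α * x
      go = trans (+-congˡ (trans (*-congʳ β≈0) (zeroˡ _))) (+-identityʳ _)
      eq′ : a ≈ᵛ α ⋆ u
      eq′ = ≈ᵛ-trans eq (go , go , go)
    ...   | no β≉0 with inverse β β≉0
    ...     | i , βi≈1 = suc (index (α * i)) , β , β≉0 , ≈ᵛ-trans eq (go , go , go)
      where
      go : ∀ {x y} → α * x + β * y ≈ β * (y + enum (index (α * i)) * x)
      go {x} {y} = begin
        α * x + β * y                               ≈⟨ +-congʳ (trans (sym (*-identityˡ _)) (*-congʳ (sym βi≈1))) ⟩
        (β * i) * (α * x) + β * y                   ≈⟨ solve 5 (λ α β i x y → (β :* i) :* (α :* x) :+ β :* y := β :* (y :+ (α :* i) :* x)) refl α β i x y ⟩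
        β * (y + (α * i) * x)                       ≈⟨ *-congˡ (+-congˡ (*-congʳ (enum-index (α * i)))) ⟨
        β * (y + enum (index (α * i)) * x)          ∎

    -- By `meet` this says that x is a multiple of P, possibly zero.
    Both : V → Set ℓ
    Both x = x ∙ u ≈ 0# × x ∙ w ≈ 0#

    both? : ∀ x → Dec (Both x)
    both? x = ((x ∙ u) ≈? 0#) ×-dec ((x ∙ w) ≈? 0#)

    zeros : V → ℕ
    zeros x = count (λ i → (x ∙ member i) ≈? 0#)

    zeros-both : ∀ x → Both x → zeros x ≡ suc q
    zeros-both x (e₁ , e₂) = count-all (λ i → (x ∙ member i) ≈? 0#) λ where
      zero    → e₁
      (suc i) → trans (∙member-suc x i) (trans (+-cong e₂ (trans (*-congˡ e₁) (zeroʳ _))) (+-identityˡ _))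

    zeros-one : ∀ x → ¬ Both x → zeros x ≡ 1
    zeros-one x nb = go ((x ∙ u) ≈? 0#)
      where
      go : Dec (x ∙ u ≈ 0#) → zeros x ≡ 1
      go (yes e₁) = count-unique (λ i → (x ∙ member i) ≈? 0#) zero e₁ λ where
        zero    _ → ≡.refl
        (suc i) e → contradiction (e₁ , (begin
          x ∙ w                        ≈⟨ trans (+-congˡ (trans (*-congˡ e₁) (zeroʳ (enum i)))) (+-identityʳ _) ⟨
          x ∙ w + enum i * (x ∙ u)     ≈⟨ ∙member-suc x i ⟨
          x ∙ member (suc i)           ≈⟨ e ⟩
          0#                           ∎)) nb
      go (no n₁) = count-unique (λ i → (x ∙ member i) ≈? 0#) (suc t) root λ where
          zero    e → contradiction e n₁
          (suc i) e → ≡.cong suc (enum-injective (*-cancelʳ-≉0 n₁ (begin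
            enum i * (x ∙ u)                       ≈⟨ solve 2 (λ a b → a := (b :+ a) :- b) refl _ (x ∙ w) ⟩
            (x ∙ w + enum i * (x ∙ u)) - x ∙ w     ≈⟨ +-congʳ (trans (sym (∙member-suc x i)) (trans e (sym (trans (sym (∙member-suc x t)) root)))) ⟩
            (x ∙ w + enum t * (x ∙ u)) - x ∙ w     ≈⟨ solve 2 (λ a b → (b :+ a) :- b := a) refl _ (x ∙ w) ⟩
            enum t * (x ∙ u)                       ∎)))
        where
        v : Carrier
        v = proj₁ (inverse (x ∙ u) n₁)
        t : Fin q
        t = index (- (x ∙ w) * v)
        root : x ∙ member (suc t) ≈ 0#
        root = begin
          x ∙ member (suc t)                      ≈⟨ ∙member-suc x t ⟩
          x ∙ w + enum t * (x ∙ u)                ≈⟨ +-congˡ (*-congʳ (enum-index _)) ⟩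
          x ∙ w + (- (x ∙ w) * v) * (x ∙ u)       ≈⟨ solve 3 (λ w v u → w :+ (:- w :* v) :* u := w :- w :* (u :* v)) refl (x ∙ w) v (x ∙ u) ⟩
          x ∙ w - (x ∙ w) * ((x ∙ u) * v)         ≈⟨ +-congˡ (-‿cong (trans (*-congˡ (proj₂ (inverse (x ∙ u) n₁))) (*-identityʳ _))) ⟩
          x ∙ w - x ∙ w                           ≈⟨ -‿inverseʳ _ ⟩
          0#                                      ∎

    zeros≡ : ∀ x → zeros x ≡ 1 ℕ.+ q ℕ.* ⟨ both? x ⟩
    zeros≡ x with both? x
    ... | yes b = ≡.trans (zeros-both x b) (≡.cong suc (≡.sym (ℕ.*-identityʳ q)))
    ... | no nb = ≡.trans (zeros-one x nb) (≡.cong suc (≡.sym (ℕ.*-zeroʳ q)))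

  ∥⇒scale : ∀ {x Q} → ¬ (Q ≈ᵛ 0ᵛ) → x ∥ Q → ∃ λ t → x ≈ᵛ t ⋆ Q
  ∥⇒scale {x} {Q} Q≉0 p = Pencil.meet pen x (proj₁ kills) (proj₂ kills)
    where
    pen : Pencil Q
    pen = pencil Q Q≉0
    kills : x ∙ Pencil.u pen ≈ 0# × x ∙ Pencil.w pen ≈ 0#
    kills = Pencil.∥⇒∙u pen x p

  cnt : ∀ {M} → (Fin M → V) → V → ℕ
  cnt v a = count (λ j → (v j ∙ a) ≈? 0#)

  cnt-scale : ∀ {M} (v : Fin M → V) {a t b} → ¬ (t ≈ 0#) → a ≈ᵛ t ⋆ b → cnt v a ≡ cnt v b
  cnt-scale v {a} {t} {b} t≉0 eq = count-cong (λ j → (v j ∙ a) ≈? 0#) (λ j → (v j ∙ b) ≈? 0#)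
    (λ j e → cancel t _ (trans (sym (val j)) e) t≉0) (λ j e → trans (val j) (trans (*-congˡ e) (zeroʳ t)))
    where
    val : ∀ j → v j ∙ a ≈ t * (v j ∙ b)
    val j = trans (∙-cong {v j} ≈ᵛ-refl eq) (∙-⋆ʳ (v j) t b)

  module _ {P : V} (pen : Pencil P) where
    open OnPencil pen

    -- A multiple of P lies on all q + 1 lines of the pencil, any other vector on exactly one.
    pencil-sum : ∀ {M} (v : Fin M → V) → Σℕ.sum (λ i → cnt v (member i)) ≡ M ℕ.+ q ℕ.* count (λ j → both? (v j))
    pencil-sum {M} v = ≡.trans (Σℕ.∑-comm (λ i j → ⟨ (v j ∙ member i) ≈? 0# ⟩)) (≡.trans (Σℕ.sum-cong-≗ (λ j → zeros≡ (v j)))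
      (≡.trans (Σℕ.∑-distrib-+ {M} (λ _ → 1) (λ j → q ℕ.* ⟨ both? (v j) ⟩))
        (≡.cong₂ ℕ._+_ (≡.trans (∑-const M 1) (ℕ.*-identityʳ M)) (∑-*ˡ q (λ j → ⟨ both? (v j) ⟩)))))

    member-∥-unique : ∀ {x} → ¬ (x ≈ᵛ 0ᵛ) → ∀ i i′ → x ∥ member i → x ∥ member i′ → i ≡ i′
    member-∥-unique {x} x≉0 i i′ p p′ =
      member-unique i i′ (⋆≉0 {b = member i} x≉0 (proj₂ s)) (proj₂ s) (proj₂ s′)
      where
      s : ∃ λ t → x ≈ᵛ t ⋆ member i
      s = ∥⇒scale (member≉0 i) p
      s′ : ∃ λ t → x ≈ᵛ t ⋆ member i′
      s′ = ∥⇒scale (member≉0 i′) p′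

    points-on-line : ∀ {M} (v : Fin M → V) → (∀ j → ¬ (v j ≈ᵛ 0ᵛ)) →
                     Σℕ.sum (λ i → count (λ j → v j ∥? member i)) ℕ.≤ cnt v P
    points-on-line v v≉0 = ℕ.≤-trans (ℕ.≤-reflexive (Σℕ.∑-comm (λ i j → ⟨ v j ∥? member i ⟩))) (∑-mono-≤ _ _ bound)
      where
      bound : ∀ j → count (λ i → v j ∥? member i) ℕ.≤ ⟨ (v j ∙ P) ≈? 0# ⟩
      bound j with (v j ∙ P) ≈? 0#
      ... | yes _ = count-≤1 (λ i → v j ∥? member i) (member-∥-unique (v≉0 j))
      ... | no n  = ℕ.≤-reflexive (count-none (λ i → v j ∥? member i) (λ i p → n (on i (∥⇒scale (member≉0 i) p))))
        where
        on : ∀ i → (∃ λ t → v j ≈ᵛ t ⋆ member i) → v j ∙ P ≈ 0#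
        on i (t , eq) = trans (∙-comm (v j) P) (trans (∙-cong {P} ≈ᵛ-refl eq) (trans (∙-⋆ʳ P t (member i)) (trans (*-congˡ (P∙member i)) (zeroʳ t))))

count≤1⇒unique : ∀ {a m} {P : Fin m → Set a} (P? : ∀ i → Dec (P i)) → count P? ℕ.≤ 1 → ∀ i j → P i → P j → i ≡ j
count≤1⇒unique {m = suc m} P? c≤1 zero    zero    pi pj = ≡.refl
count≤1⇒unique {m = suc m} P? c≤1 (suc i) (suc j) pi pj =
  ≡.cong suc (count≤1⇒unique (P? ∘ suc) (ℕ.≤-trans (ℕ.m≤n+m _ ⟨ P? zero ⟩) c≤1) i j pi pj)
count≤1⇒unique {m = suc m} P? c≤1 zero    (suc j) pi pj = contradiction c≤1 (ℕ.<⇒≱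
  (ℕ.≤-trans (ℕ.≤-reflexive (≡.cong suc (≡.sym (⟨⟩-yes (P? zero) pi)))) (ℕ.≤-trans (ℕ.≤-reflexive (ℕ.+-comm 1 _)) (ℕ.+-monoʳ-≤ ⟨ P? zero ⟩ (count-≥1 (P? ∘ suc) j pj)))))
count≤1⇒unique {m = suc m} P? c≤1 (suc i) zero    pi pj = ≡.sym (count≤1⇒unique P? c≤1 zero (suc i) pj pi)

another : ∀ {m} → 1 ℕ.< m → (i : Fin m) → ∃ λ j → ¬ j ≡ i
another (s≤s (s≤s _)) zero    = suc zero , λ ()
another (s≤s (s≤s _)) (suc i) = zero , λ ()

-- Two equal points would force 2q ≤ n(q + 1) - n′(q + 1) = q + 1.
multiplicity≤1 : ∀ n′ q N μ → n′ ℕ.* suc q ℕ.≤ N → N ℕ.+ q ℕ.* μ ℕ.≤ suc q ℕ.* suc n′ → 1 ℕ.< q → μ ℕ.≤ 1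
multiplicity≤1 n′ q N μ big bound 1<q = ℕ.≮⇒≥ λ 2≤μ → ℕ.<⇒≱ (begin-strict
    suc q                       <⟨ ℕ.+-monoˡ-< q 1<q ⟩
    q ℕ.+ q                     ≡⟨ ≡.trans (≡.cong (q ℕ.+_) (≡.sym (ℕ.+-identityʳ q))) (ℕ.*-comm 2 q) ⟩
    q ℕ.* 2                     ≤⟨ ℕ.*-monoʳ-≤ q 2≤μ ⟩
    q ℕ.* μ                     ∎) qμ≤
  where
  open ℕ.≤-Reasoning
  qμ≤ : q ℕ.* μ ℕ.≤ suc q
  qμ≤ = ℕ.+-cancelˡ-≤ (n′ ℕ.* suc q) _ _ (ℕ.≤-trans (ℕ.+-monoˡ-≤ (q ℕ.* μ) big) (ℕ.≤-trans bound (ℕ.≤-reflexive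
    (≡.trans (ℕ.*-suc (suc q) n′) (≡.trans (ℕ.+-comm (suc q) _) (≡.cong (ℕ._+ suc q) (ℕ.*-comm (suc q) n′)))))))

module PlaneArcs {c ℓ} (F : CommutativeRing c ℓ) {q : ℕ} (FF : IsFiniteField F q)
  (n′ : ℕ) (2≤n′ : 2 ℕ.≤ n′) (n<q : suc n′ ℕ.< q) where
  open CommutativeRing F hiding (zero)
  open FiniteField F FF
  open Plane F FF

  n : ℕ
  n = suc n′

  -- A family rather than a set: projected columns might coincide or vanish. That they do not is
  -- derived later from the size.
  IsArc : ∀ {N} → (Fin N → V) → Set (c ⊔ ℓ)
  IsArc v = ∀ a → ¬ (a ≈ᵛ 0ᵛ) → cnt v a ℕ.≤ n

  e₁ : V
  e₁ = 1# , 0# , 0#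

  e₁≉0 : ¬ (e₁ ≈ᵛ 0ᵛ)
  e₁≉0 (e , _) = 1≉0 e

  self-∙ : ∀ {P} (pen : Pencil P) {x} → x ≈ᵛ P → OnPencil.Both pen x
  self-∙ pen {x} e = trans (∙-cong {x} e ≈ᵛ-refl) (Pencil.P∙u pen) , trans (∙-cong {x} e ≈ᵛ-refl) (Pencil.P∙w pen)

  ∙-comm₀ : ∀ {a b} → a ∙ b ≈ 0# → b ∙ a ≈ 0#
  ∙-comm₀ {a} {b} e = trans (∙-comm b a) e

  unscale-∙ : ∀ {x t Q} a → ¬ (t ≈ 0#) → x ≈ᵛ t ⋆ Q → a ∙ x ≈ 0# → a ∙ Q ≈ 0#
  unscale-∙ {x} {t} {Q} a t≉0 e z = cancel t _ (trans (sym (∙-⋆ʳ a t Q)) (trans (sym (∙-cong {a} ≈ᵛ-refl e)) z)) t≉0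

  both⇒∥ : ∀ {P} (pen : Pencil P) {x} → OnPencil.Both pen x → x ∥ P
  both⇒∥ {P} pen {x} (d₁ , d₂) with Pencil.meet pen x d₁ d₂
  ... | t , e = ∥-common e (1⋆ P)

  module Arc {N : ℕ} (big : n′ ℕ.* suc q ℕ.≤ N) (v : Fin N → V) (arc : IsArc v) where

    pencil-bound : ∀ {P} (pen : Pencil P) → N ℕ.+ q ℕ.* count (λ j → OnPencil.both? pen (v j)) ℕ.≤ suc q ℕ.* n
    pencil-bound pen = ℕ.≤-trans (ℕ.≤-reflexive (≡.sym (pencil-sum pen v)))
      (∑-≤-const _ n (λ i → arc (OnPencil.member pen i) (OnPencil.member≉0 pen i)))

    both≤1 : ∀ {P} (pen : Pencil P) → count (λ j → OnPencil.both? pen (v j)) ℕ.≤ 1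
    both≤1 pen = multiplicity≤1 n′ q N _ big (pencil-bound pen) 1<q

    both-unique : ∀ {P} (pen : Pencil P) i j → OnPencil.Both pen (v i) → OnPencil.Both pen (v j) → i ≡ j
    both-unique pen = count≤1⇒unique (λ j → OnPencil.both? pen (v j)) (both≤1 pen)

    1<N : 1 ℕ.< N
    1<N = ℕ.≤-trans (ℕ.≤-trans 2≤n′ (ℕ.m≤m*n n′ (suc q))) big

    -- A zero vector is a multiple of every point, so it would give another member multiplicity 2.
    -- For projected columns this means that none lies in the centre of projection.
    v≉0 : ∀ j → ¬ (v j ≈ᵛ 0ᵛ)
    v≉0 j vj≈0 with another 1<N j
    ... | j′ , j′≢j with v j′ ≈0ᵛ?
    ...   | yes vj′≈0 = j′≢j (both-unique pen j′ j (zero-both vj′≈0) (zero-both vj≈0))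
      where
      pen = pencil e₁ e₁≉0
      zero-both : ∀ {x} → x ≈ᵛ 0ᵛ → OnPencil.Both pen x
      zero-both {x} e = ∙-comm₀ {Pencil.u pen} (∙-0ʳ _ e) , ∙-comm₀ {Pencil.w pen} (∙-0ʳ _ e)
    ...   | no vj′≉0 = j′≢j (both-unique pen j′ j (self-∙ pen ≈ᵛ-refl) (zero-both vj≈0))
      where
      pen = pencil (v j′) vj′≉0
      zero-both : ∀ {x} → x ≈ᵛ 0ᵛ → OnPencil.Both pen x
      zero-both {x} e = ∙-comm₀ {Pencil.u pen} (∙-0ʳ _ e) , ∙-comm₀ {Pencil.w pen} (∙-0ʳ _ e)

    penAt : ∀ j → Pencil (v j)
    penAt j = pencil (v j) (v≉0 j)

    ∥-unique : ∀ i j → v i ∥ v j → i ≡ j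
    ∥-unique i j p = both-unique (penAt j) i j (Pencil.∥⇒∙u (penAt j) (v i) p) (self-∙ (penAt j) ≈ᵛ-refl)

    both-at : ∀ j → count (λ j′ → OnPencil.both? (penAt j) (v j′)) ≡ 1
    both-at j = ℕ.≤-antisym (both≤1 (penAt j)) (count-≥1 (λ j′ → OnPencil.both? (penAt j) (v j′)) j (self-∙ (penAt j) ≈ᵛ-refl))

    ∑-at : ∀ j → Σℕ.sum (λ i → cnt v (OnPencil.member (penAt j) i)) ≡ N ℕ.+ q
    ∑-at j = ≡.trans (pencil-sum (penAt j) v) (≡.cong (N ℕ.+_) (≡.trans (≡.cong (q ℕ.*_) (both-at j)) (ℕ.*-identityʳ q)))

    size≤ : N ℕ.≤ suc (n′ ℕ.* suc q)
    size≤ = ℕ.+-cancelʳ-≤ q _ _ (ℕ.≤-trans (ℕ.≤-reflexive (≡.sym (∑-at j₀))) (ℕ.≤-trans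
        (∑-≤-const _ n (λ i → arc (OnPencil.member (penAt j₀) i) (OnPencil.member≉0 (penAt j₀) i)))
        (ℕ.≤-reflexive (≡.trans (ℕ.*-comm (suc q) n) (≡.cong suc (ℕ.+-comm q _))))))
      where
      j₀ : Fin N
      j₀ = Fin.fromℕ< (ℕ.<⇒≤ 1<N)

    μ : V → ℕ
    μ Q = count (λ j → v j ∥? Q)

    outside-sum : ∀ {Q} (pen : Pencil Q) → μ Q ≡ 0 → Σℕ.sum (λ i → cnt v (OnPencil.member pen i)) ≡ N
    outside-sum {Q} pen μ≡0 = ≡.trans (pencil-sum pen v) (≡.trans (≡.cong (λ z → N ℕ.+ q ℕ.* z)
        (ℕ.n≤0⇒n≡0 (ℕ.≤-trans (count-mono (λ j → OnPencil.both? pen (v j)) (λ j → v j ∥? Q) (λ j → both⇒∥ pen)) (ℕ.≤-reflexive μ≡0))))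
      (≡.trans (≡.cong (N ℕ.+_) (ℕ.*-zeroʳ q)) (ℕ.+-identityʳ N)))

    not-both : ∀ {Q} (pen : Pencil Q) → μ Q ≡ 0 → ∀ j → ¬ OnPencil.Both pen (v j)
    not-both {Q} pen μ≡0 j b = contradiction (≡.subst (1 ℕ.≤_) μ≡0 (count-≥1 (λ j → v j ∥? Q) j (both⇒∥ pen b))) λ ()

    abstract
      outside-exists : ∃ λ Q → ¬ (Q ≈ᵛ 0ᵛ) × μ Q ≡ 0
      outside-exists with any? (λ i → μ (OnPencil.member (pencil e₁ e₁≉0) i) ℕ.≟ 0)
      ... | yes (i , e) = OnPencil.member (pencil e₁ e₁≉0) i , OnPencil.member≉0 (pencil e₁ e₁≉0) i , e
      ... | no none = contradiction (ℕ.≤-trans (ℕ.≤-trans (ℕ.≤-reflexive (≡.sym (ℕ.*-identityʳ (suc q))))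
          (∑-≥-const _ 1 (λ i → ℕ.n≢0⇒n>0 (λ e → none (i , e))))) (ℕ.≤-trans (points-on-line (pencil e₁ e₁≉0) v v≉0) (arc e₁ e₁≉0)))
          (ℕ.<⇒≱ (ℕ.m≤n⇒m≤1+n n<q))

-- After division by n′ the left side exceeds the right one by (n′ - 1)(q - n′), which is positive.
shortLineBound : ∀ n′ q → 2 ℕ.≤ n′ → suc n′ ℕ.< q →
  suc q ℕ.* (suc n′ ℕ.* n′) ℕ.≤ n′ ℕ.* suc q ℕ.+ q ℕ.* n′ ℕ.+ n′ ℕ.* n′ ℕ.* n′ → ⊥
shortLineBound (suc m) q (s≤s (s≤s z≤n)) n<q bound = ℕ.<⇒≱ larger (ℕ.*-cancelʳ-≤ _ _ (suc m) (ℕ.≤-trans (ℕ.≤-reflexive (lhs m q)) (ℕ.≤-trans bound (ℕ.≤-reflexive (rhs m q)))))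
  where
  open ℕ.≤-Reasoning
  lhs : ∀ m q → suc q ℕ.* suc (suc m) ℕ.* suc m ≡ suc q ℕ.* (suc (suc m) ℕ.* suc m)
  lhs = solve-∀
  rhs : ∀ m q → suc m ℕ.* suc q ℕ.+ q ℕ.* suc m ℕ.+ suc m ℕ.* suc m ℕ.* suc m ≡ (suc q ℕ.+ q ℕ.+ suc m ℕ.* suc m) ℕ.* suc m
  rhs = solve-∀
  expand : ∀ m q → suc q ℕ.+ q ℕ.+ (m ℕ.* q ℕ.+ suc m) ≡ suc q ℕ.* suc (suc m)
  expand = solve-∀
  square : ∀ m → suc m ℕ.* suc m ≡ m ℕ.* suc m ℕ.+ suc m
  square = solve-∀
  larger : suc q ℕ.+ q ℕ.+ suc m ℕ.* suc m ℕ.< suc q ℕ.* suc (suc m)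
  larger = begin-strict
    suc q ℕ.+ q ℕ.+ suc m ℕ.* suc m              ≡⟨ ≡.cong (suc q ℕ.+ q ℕ.+_) (square m) ⟩
    suc q ℕ.+ q ℕ.+ (m ℕ.* suc m ℕ.+ suc m)      <⟨ ℕ.+-monoʳ-< (suc q ℕ.+ q) (ℕ.+-monoˡ-< (suc m) (ℕ.*-monoʳ-< m (ℕ.<-trans (ℕ.n<1+n (suc m)) n<q))) ⟩
    suc q ℕ.+ q ℕ.+ (m ℕ.* q ℕ.+ suc m)          ≡⟨ expand m q ⟩
    suc q ℕ.* suc (suc m)                        ∎

-- Completing an arc that is one point short

module Extension {c ℓ} (F : CommutativeRing c ℓ) {q : ℕ} (FF : IsFiniteField F q)
  (n′ : ℕ) (2≤n′ : 2 ℕ.≤ n′) (n<q : suc n′ ℕ.< q) where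
  open CommutativeRing F hiding (zero)
  open FiniteField F FF
  open Plane F FF
  open PlaneArcs F FF n′ 2≤n′ n<q

  N : ℕ
  N = n′ ℕ.* suc q

  0<n′ : 0 ℕ.< n′
  0<n′ = ℕ.<⇒≤ 2≤n′

  module _ (v : Fin N → V) (arc : IsArc v) where
    open Arc ℕ.≤-refl v arc

    abstract
      short : ∀ j → ∃ λ i → cnt v (OnPencil.member (penAt j) i) ≡ n′ × (∀ i′ → ¬ i′ ≡ i → cnt v (OnPencil.member (penAt j) i′) ≡ n)
      short j = ∑-defect-1 _ n′ (λ i → arc (OnPencil.member (penAt j) i) (OnPencil.member≉0 (penAt j) i))
        (≡.trans (≡.cong suc (∑-at j)) (≡.trans (≡.sym (ℕ.+-suc N q)) (≡.trans (ℕ.+-comm N (suc q)) (≡.trans (≡.cong (suc q ℕ.+_) (ℕ.*-comm n′ (suc q))) (≡.sym (ℕ.*-suc (suc q) n′))))))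

    -- The unique (n-1)-secant through v j.
    ℓ[_] : Fin N → V
    ℓ[ j ] = OnPencil.member (penAt j) (proj₁ (short j))

    ℓ≉0 : ∀ j → ¬ (ℓ[ j ] ≈ᵛ 0ᵛ)
    ℓ≉0 j = OnPencil.member≉0 (penAt j) (proj₁ (short j))

    v∙ℓ : ∀ j → v j ∙ ℓ[ j ] ≈ 0#
    v∙ℓ j = OnPencil.P∙member (penAt j) (proj₁ (short j))

    cnt-ℓ : ∀ j → cnt v ℓ[ j ] ≡ n′
    cnt-ℓ j = proj₁ (proj₂ (short j))

    through : ∀ j a → ¬ (a ≈ᵛ 0ᵛ) → v j ∙ a ≈ 0# → cnt v a ≡ n ⊎ (∃ λ t → ¬ (t ≈ 0#) × a ≈ᵛ t ⋆ ℓ[ j ])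
    through j a a≉0 va with OnPencil.coverMember (penAt j) a a≉0 va
    ... | i , t , t≉0 , eq with i ≟ᶠ proj₁ (short j)
    ...   | yes e = inj₂ (t , t≉0 , ≡.subst (λ i → a ≈ᵛ t ⋆ OnPencil.member (penAt j) i) e eq)
    ...   | no i≢ = inj₁ (≡.trans (cnt-scale v t≉0 eq) (proj₂ (proj₂ (short j)) i i≢))

    n≢n′ : ¬ n ≡ n′
    n≢n′ = ℕ.1+n≢n

    short-through : ∀ j a → ¬ (a ≈ᵛ 0ᵛ) → cnt v a ≡ n′ → v j ∙ a ≈ 0# → ∃ λ t → ¬ (t ≈ 0#) × a ≈ᵛ t ⋆ ℓ[ j ]
    short-through j a a≉0 cnt≡ va with through j a a≉0 va
    ... | inj₁ e = contradiction (≡.trans (≡.sym e) cnt≡) n≢n′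
    ... | inj₂ s = s

    cnt-cases : ∀ a → ¬ (a ≈ᵛ 0ᵛ) → cnt v a ≡ 0 ⊎ cnt v a ≡ n′ ⊎ cnt v a ≡ n
    cnt-cases a a≉0 with cnt v a ℕ.≟ 0
    ... | yes e = inj₁ e
    ... | no ≢0 with count-find (λ j → (v j ∙ a) ≈? 0#) (ℕ.n≢0⇒n>0 ≢0)
    ...   | j , e with through j a a≉0 e
    ...     | inj₁ e′ = inj₂ (inj₂ e′)
    ...     | inj₂ (t , t≉0 , eq) = inj₂ (inj₁ (≡.trans (cnt-scale v t≉0 eq) (cnt-ℓ j)))

    -- The family of short lines, taken as points of the dual plane. Each short line occurs in it
    -- once for each of its `n′` arc points.
    κ : V → ℕ
    κ = cnt ℓ[_]

    κ-short : ∀ {a Q} → ¬ (a ≈ᵛ 0ᵛ) → cnt v a ≡ n′ → a ∙ Q ≈ 0# → n′ ℕ.≤ κ Q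
    κ-short {a} {Q} a≉0 cnt≡ aQ = ℕ.≤-trans (ℕ.≤-reflexive (≡.sym cnt≡))
      (count-mono (λ j → (v j ∙ a) ≈? 0#) (λ j → (ℓ[ j ] ∙ Q) ≈? 0#) λ j va →
        let t , t≉0 , eq = short-through j a a≉0 cnt≡ va
        in ∙-comm₀ {Q} (unscale-∙ Q t≉0 eq (∙-comm₀ {a} aQ)))

    module _ {a : V} (a≉0 : ¬ (a ≈ᵛ 0ᵛ)) where
      open OnPencil (pencil a a≉0)

      -- An n-secant is no short line, so each entry of the family meets it in exactly one point;
      -- the average of `κ` along it is n′.
      ∑κ-long : cnt v a ≡ n → Σℕ.sum (λ i → κ (member i)) ≡ N
      ∑κ-long cnt≡ = ≡.trans (pencil-sum (pencil a a≉0) ℓ[_]) (≡.trans (≡.cong (λ z → N ℕ.+ q ℕ.* z)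
          (count-none (λ j → both? ℓ[ j ]) none)) (≡.trans (≡.cong (N ℕ.+_) (ℕ.*-zeroʳ q)) (ℕ.+-identityʳ N)))
        where
        none : ∀ j → ¬ Both ℓ[ j ]
        none j (d₁ , d₂) with meet ℓ[ j ] d₁ d₂
        ... | t , eq = n≢n′ (≡.trans (≡.sym cnt≡) (≡.trans (≡.sym (cnt-scale v (⋆≉0 {b = a} (ℓ≉0 j) eq) eq)) (cnt-ℓ j)))

      ℓ∥-count : count (λ j → both? ℓ[ j ]) ℕ.≤ cnt v a
      ℓ∥-count = count-mono (λ j → both? ℓ[ j ]) (λ j → (v j ∙ a) ≈? 0#) λ j (d₁ , d₂) →
        let t , eq = meet ℓ[ j ] d₁ d₂ in unscale-∙ (v j) (⋆≉0 {b = a} (ℓ≉0 j) eq) eq (v∙ℓ j)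

      ∑κ-short : cnt v a ≡ n′ → Σℕ.sum (λ i → κ (member i)) ℕ.≤ N ℕ.+ q ℕ.* n′
      ∑κ-short cnt≡ = ℕ.≤-trans (ℕ.≤-reflexive (pencil-sum (pencil a a≉0) ℓ[_]))
        (ℕ.+-monoʳ-≤ N (ℕ.*-monoʳ-≤ q (ℕ.≤-trans ℓ∥-count (ℕ.≤-reflexive cnt≡))))

    module Outside {Q : V} (Q≉0 : ¬ (Q ≈ᵛ 0ᵛ)) (μ≡0 : μ Q ≡ 0) where
      open OnPencil (pencil Q Q≉0)

      short? : ∀ i → Dec (cnt v (member i) ≡ n′)
      short? i = cnt v (member i) ℕ.≟ n′

      external? : ∀ i → Dec (cnt v (member i) ≡ 0)
      external? i = cnt v (member i) ℕ.≟ 0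

      x₀ x₁ : ℕ
      x₀ = count external?
      x₁ = count short?

      -- The lines through Q fall short of n(q + 1) points by q + 1 in total: an external line by n,
      -- a short line by 1, the others not at all.
      n*x₀+x₁ : n ℕ.* x₀ ℕ.+ x₁ ≡ suc q
      n*x₀+x₁ = ℕ.+-cancelˡ-≡ N _ _ (≡.trans (≡.cong (ℕ._+ (n ℕ.* x₀ ℕ.+ x₁)) (≡.sym (outside-sum (pencil Q Q≉0) μ≡0)))
        (≡.trans (≡.cong (λ z → Σℕ.sum (λ i → cnt v (member i)) ℕ.+ (z ℕ.+ x₁)) (≡.sym (∑-*ˡ n (λ i → ⟨ external? i ⟩))))
        (≡.trans (≡.cong (Σℕ.sum (λ i → cnt v (member i)) ℕ.+_) (≡.sym (Σℕ.∑-distrib-+ (λ i → n ℕ.* ⟨ external? i ⟩) (λ i → ⟨ short? i ⟩))))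
        (≡.trans (≡.sym (Σℕ.∑-distrib-+ (λ i → cnt v (member i)) (λ i → n ℕ.* ⟨ external? i ⟩ ℕ.+ ⟨ short? i ⟩)))
        (≡.trans (Σℕ.sum-cong-≗ deficit) (≡.trans (∑-const (suc q) n) (≡.trans (ℕ.*-comm (suc q) n) (ℕ.+-comm (suc q) N))))))))
        where
        deficit : ∀ i → cnt v (member i) ℕ.+ (n ℕ.* ⟨ external? i ⟩ ℕ.+ ⟨ short? i ⟩) ≡ n
        deficit i with cnt-cases (member i) (member≉0 i)
        ... | inj₁ e = ≡.trans (≡.cong₂ (λ x y → cnt v (member i) ℕ.+ (n ℕ.* x ℕ.+ y)) (⟨⟩-yes (external? i) e) (⟨⟩-no (short? i) (λ e′ → ℕ.<⇒≢ 0<n′ (≡.trans (≡.sym e) e′))))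
              (≡.trans (≡.cong₂ ℕ._+_ e (ℕ.+-identityʳ _)) (ℕ.*-identityʳ n))
        ... | inj₂ (inj₁ e) = ≡.trans (≡.cong₂ (λ x y → cnt v (member i) ℕ.+ (n ℕ.* x ℕ.+ y)) (⟨⟩-no (external? i) (λ e′ → ℕ.<⇒≢ 0<n′ (≡.trans (≡.sym e′) e))) (⟨⟩-yes (short? i) e))
              (≡.trans (≡.cong₂ (λ x y → x ℕ.+ (y ℕ.+ 1)) e (ℕ.*-zeroʳ n)) (ℕ.+-comm n′ 1))
        ... | inj₂ (inj₂ e) = ≡.trans (≡.cong₂ (λ x y → cnt v (member i) ℕ.+ (n ℕ.* x ℕ.+ y)) (⟨⟩-no (external? i) (λ e′ → ℕ.1+n≢0 (≡.trans (≡.sym e) e′))) (⟨⟩-no (short? i) (λ e′ → n≢n′ (≡.trans (≡.sym e) e′))))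
              (≡.trans (≡.cong₂ (λ x y → x ℕ.+ (y ℕ.+ 0)) e (ℕ.*-zeroʳ n)) (ℕ.+-identityʳ n))

      n′*x₁≤κ : n′ ℕ.* x₁ ℕ.≤ κ Q
      n′*x₁≤κ = ℕ.≤-trans (ℕ.≤-reflexive (≡.trans (≡.sym (∑-*ˡ n′ (λ i → ⟨ short? i ⟩))) (Σℕ.sum-cong-≗ weight)))
        (ℕ.≤-trans (ℕ.≤-reflexive (Σℕ.∑-comm (λ i j → ⟨ short? i ⟩ ℕ.* ⟨ (v j ∙ member i) ≈? 0# ⟩))) (∑-mono-≤ _ _ bound))
        where
        weight : ∀ i → n′ ℕ.* ⟨ short? i ⟩ ≡ Σℕ.sum (λ j → ⟨ short? i ⟩ ℕ.* ⟨ (v j ∙ member i) ≈? 0# ⟩)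
        weight i = ≡.trans (go (short? i)) (≡.sym (∑-*ˡ ⟨ short? i ⟩ (λ j → ⟨ (v j ∙ member i) ≈? 0# ⟩)))
          where
          go : (d : Dec (cnt v (member i) ≡ n′)) → n′ ℕ.* ⟨ d ⟩ ≡ ⟨ d ⟩ ℕ.* cnt v (member i)
          go (yes e) = ≡.trans (ℕ.*-identityʳ n′) (≡.trans (≡.sym e) (≡.sym (ℕ.*-identityˡ _)))
          go (no _)  = ℕ.*-zeroʳ n′
        bound : ∀ j → Σℕ.sum (λ i → ⟨ short? i ⟩ ℕ.* ⟨ (v j ∙ member i) ≈? 0# ⟩) ℕ.≤ ⟨ (ℓ[ j ] ∙ Q) ≈? 0# ⟩
        bound j = go ((ℓ[ j ] ∙ Q) ≈? 0#)
          where
          ≤1 : ∀ {a} {P : Set a} (d : Dec P) m → ⟨ d ⟩ ℕ.* m ℕ.≤ m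
          ≤1 (yes _) m = ℕ.≤-reflexive (ℕ.*-identityˡ m)
          ≤1 (no _)  m = z≤n
          go : (d : Dec (ℓ[ j ] ∙ Q ≈ 0#)) → Σℕ.sum (λ i → ⟨ short? i ⟩ ℕ.* ⟨ (v j ∙ member i) ≈? 0# ⟩) ℕ.≤ ⟨ d ⟩
          go (yes _) = ℕ.≤-trans (∑-mono-≤ _ (λ i → ⟨ (v j ∙ member i) ≈? 0# ⟩) (λ i → ≤1 (short? i) _))
                         (ℕ.≤-reflexive (zeros-one (v j) (not-both (pencil Q Q≉0) μ≡0 j)))
          go (no ℓQ≉0) = ℕ.≤-reflexive (∑-zero _ (λ i → none i (short? i) ((v j ∙ member i) ≈? 0#)))
            where
            none : ∀ i (d : Dec (cnt v (member i) ≡ n′)) (d′ : Dec (v j ∙ member i ≈ 0#)) → ⟨ d ⟩ ℕ.* ⟨ d′ ⟩ ≡ 0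
            none i (no _)  _       = ≡.refl
            none i (yes _) (no _)  = ≡.refl
            none i (yes e) (yes z) = let t , t≉0 , eq = short-through j (member i) (member≉0 i) e z
                                     in contradiction (∙-comm₀ {Q} (unscale-∙ Q t≉0 eq (P∙member i))) ℓQ≉0

    module ShortLine (n∣q+1 : n ∣ suc q) (j₀ : Fin N) where
      private
        module O = OnPencil (pencil ℓ[ j₀ ] (ℓ≉0 j₀))

      member : Fin (suc q) → V
      member = O.member

      short-member : ∀ i (e : μ (member i) ≡ 0) → 0 ℕ.< Outside.x₁ (O.member≉0 i) e
      short-member i e = count-≥1 (Outside.short? (O.member≉0 i) e) (proj₁ cov)
          (≡.trans (≡.sym (cnt-scale v (proj₁ (proj₂ (proj₂ cov))) (proj₂ (proj₂ (proj₂ cov))))) (cnt-ℓ j₀))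
        where
        cov : ∃ λ k → ∃ λ t → ¬ (t ≈ 0#) × ℓ[ j₀ ] ≈ᵛ t ⋆ OnPencil.member (pencil (member i) (O.member≉0 i)) k
        cov = OnPencil.coverMember (pencil (member i) (O.member≉0 i)) ℓ[ j₀ ] (ℓ≉0 j₀) (∙-comm₀ {ℓ[ j₀ ]} (O.P∙member i))

      n≤x₁ : ∀ i (e : μ (member i) ≡ 0) → n ℕ.≤ Outside.x₁ (O.member≉0 i) e
      n≤x₁ i e = ∣⇒≤ {{ℕ.>-nonZero (short-member i e)}}
        (∣m+n∣m⇒∣n (≡.subst (n ∣_) (≡.sym (Outside.n*x₀+x₁ (O.member≉0 i) e)) n∣q+1) (m∣m*n (Outside.x₀ (O.member≉0 i) e)))

      -- Off the arc the number of short lines is a positive multiple of n, so `κ` is at least n n′.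
      -- At an arc point only κ ≥ n′ is known, and the term with n′² makes up the difference.
      pointwise : ∀ i m → μ (member i) ≡ m → n ℕ.* n′ ℕ.≤ κ (member i) ℕ.+ n′ ℕ.* n′ ℕ.* μ (member i)
      pointwise i (suc m) e = ℕ.+-mono-≤ (κ-short (ℓ≉0 j₀) (cnt-ℓ j₀) (O.P∙member i))
        (ℕ.≤-trans (ℕ.m≤m*n (n′ ℕ.* n′) (suc m)) (ℕ.≤-reflexive (≡.cong (n′ ℕ.* n′ ℕ.*_) (≡.sym e))))
      pointwise i zero    e = ℕ.≤-trans (ℕ.≤-trans (ℕ.≤-reflexive (ℕ.*-comm n n′))
        (ℕ.≤-trans (ℕ.*-monoʳ-≤ n′ (n≤x₁ i e)) (Outside.n′*x₁≤κ (O.member≉0 i) e))) (ℕ.m≤m+n _ _)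

      ∑μ≤n′ : Σℕ.sum (λ i → μ (member i)) ℕ.≤ n′
      ∑μ≤n′ = ℕ.≤-trans (points-on-line (pencil ℓ[ j₀ ] (ℓ≉0 j₀)) v v≉0) (ℕ.≤-reflexive (cnt-ℓ j₀))

      impossible : ⊥
      impossible = shortLineBound n′ q 2≤n′ n<q (ℕ.≤-trans (ℕ.≤-reflexive (≡.sym (∑-const (suc q) (n ℕ.* n′))))
        (ℕ.≤-trans (∑-mono-≤ (λ _ → n ℕ.* n′) (λ i → κ (member i) ℕ.+ n′ ℕ.* n′ ℕ.* μ (member i)) (λ i → pointwise i (μ (member i)) ≡.refl))
        (ℕ.≤-trans (ℕ.≤-reflexive (≡.trans (Σℕ.∑-distrib-+ (λ i → κ (member i)) (λ i → n′ ℕ.* n′ ℕ.* μ (member i)))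
            (≡.cong (Σℕ.sum (λ i → κ (member i)) ℕ.+_) (∑-*ˡ (n′ ℕ.* n′) (λ i → μ (member i))))))
          (ℕ.+-mono-≤ (∑κ-short (ℓ≉0 j₀) (cnt-ℓ j₀)) (ℕ.*-monoʳ-≤ (n′ ℕ.* n′) ∑μ≤n′)))))

    abstract
      j₀ : Fin N
      j₀ = Fin.fromℕ< (ℕ.<⇒≤ 1<N)

    n∤q+1 : ¬ (n ∣ suc q)
    n∤q+1 n∣q+1 = ShortLine.impossible n∣q+1 j₀

    -- An arc point lies on its own short line. Off the arc, having no short line would give n x₀ =
    -- q + 1, which `n∤q+1` excludes.
    n′≤κ : ∀ Q → ¬ (Q ≈ᵛ 0ᵛ) → n′ ℕ.≤ κ Q
    n′≤κ Q Q≉0 = go (μ Q) ≡.refl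
      where
      go : ∀ m → μ Q ≡ m → n′ ℕ.≤ κ Q
      go (suc m) e with count-find (λ j → v j ∥? Q) (ℕ.≤-trans (s≤s z≤n) (ℕ.≤-reflexive (≡.sym e)))
      ... | j , p with ∥⇒scale Q≉0 p
      ...   | t , eq = κ-short (ℓ≉0 j) (cnt-ℓ j) (unscale-∙ ℓ[ j ] (⋆≉0 {b = Q} (v≉0 j) eq) eq (∙-comm₀ {v j} (v∙ℓ j)))
      go zero e = off (x₁ ℕ.≟ 0)
        where
        open Outside Q≉0 e
        off : Dec (x₁ ≡ 0) → n′ ℕ.≤ κ Q
        off (yes x₁≡0) = contradiction (divides x₀ (≡.trans (≡.sym n*x₀+x₁) (≡.trans (≡.cong (n ℕ.* x₀ ℕ.+_) x₁≡0) (≡.trans (ℕ.+-identityʳ _) (ℕ.*-comm n x₀))))) n∤q+1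
        off (no x₁≢0)  = κ-short (OnPencil.member≉0 (pencil Q Q≉0) (proj₁ i)) (proj₂ i) (∙-comm₀ {Q} (OnPencil.P∙member (pencil Q Q≉0) (proj₁ i)))
          where
          i : ∃ λ i → cnt v (OnPencil.member (pencil Q Q≉0) i) ≡ n′
          i = count-find short? (ℕ.n≢0⇒n>0 x₁≢0)

    module Meeting (j₁ : Fin N) (∦ : ¬ (ℓ[ j₁ ] ∥ ℓ[ j₀ ])) (Q : V) (Q≉0 : ¬ (Q ≈ᵛ 0ᵛ))
      (on₁ : ℓ[ j₁ ] ∙ Q ≈ 0#) (on₀ : ℓ[ j₀ ] ∙ Q ≈ 0#) where

      on : ∀ j j′ → v j ∙ ℓ[ j′ ] ≈ 0# → ∃ λ t → ¬ (t ≈ 0#) × ℓ[ j′ ] ≈ᵛ t ⋆ ℓ[ j ]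
      on j j′ z = short-through j ℓ[ j′ ] (ℓ≉0 j′) (cnt-ℓ j′) z

      hit : ∀ j j′ → v j ∙ ℓ[ j′ ] ≈ 0# → ℓ[ j′ ] ∙ Q ≈ 0# → ℓ[ j ] ∙ Q ≈ 0#
      hit j j′ z zQ = ∙-comm₀ {Q} (unscale-∙ Q (proj₁ (proj₂ (on j j′ z))) (proj₂ (proj₂ (on j j′ z))) (∙-comm₀ {ℓ[ j′ ]} zQ))

      disjoint : ∀ j → v j ∙ ℓ[ j₁ ] ≈ 0# → v j ∙ ℓ[ j₀ ] ≈ 0# → ⊥
      disjoint j z z′ = ∦ (∥-common (proj₂ (proj₂ (on j j₁ z))) (proj₂ (proj₂ (on j j₀ z′))))

      pointwise : ∀ j (d : Dec (v j ∙ ℓ[ j₁ ] ≈ 0#)) (d′ : Dec (v j ∙ ℓ[ j₀ ] ≈ 0#)) (d″ : Dec (ℓ[ j ] ∙ Q ≈ 0#)) → ⟨ d ⟩ ℕ.+ ⟨ d′ ⟩ ℕ.≤ ⟨ d″ ⟩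
      pointwise j (yes z) (yes z′) _       = contradiction z′ (disjoint j z)
      pointwise j (no _)  (no _)   _       = z≤n
      pointwise j (yes z) (no _)   (no nz) = contradiction (hit j j₁ z on₁) nz
      pointwise j (no _)  (yes z′) (no nz) = contradiction (hit j j₀ z′ on₀) nz
      pointwise j (yes _) (no _)   (yes _) = ℕ.≤-refl
      pointwise j (no _)  (yes _)  (yes _) = ℕ.≤-refl

      2n′≤κ : n′ ℕ.+ n′ ℕ.≤ κ Q
      2n′≤κ = ℕ.≤-trans (ℕ.≤-reflexive (≡.sym (≡.cong₂ ℕ._+_ (cnt-ℓ j₁) (cnt-ℓ j₀))))
        (ℕ.≤-trans (ℕ.≤-reflexive (≡.sym (Σℕ.∑-distrib-+ (λ j → ⟨ (v j ∙ ℓ[ j₁ ]) ≈? 0# ⟩) (λ j → ⟨ (v j ∙ ℓ[ j₀ ]) ≈? 0# ⟩))))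
        (∑-mono-≤ (λ j → ⟨ (v j ∙ ℓ[ j₁ ]) ≈? 0# ⟩ ℕ.+ ⟨ (v j ∙ ℓ[ j₀ ]) ≈? 0# ⟩) (λ j → ⟨ (ℓ[ j ] ∙ Q) ≈? 0# ⟩)
          (λ j → pointwise j ((v j ∙ ℓ[ j₁ ]) ≈? 0#) ((v j ∙ ℓ[ j₀ ]) ≈? 0#) ((ℓ[ j ] ∙ Q) ≈? 0#))))

      -- Along an n-secant the values of `κ` are at least n′ with average n′, so all equal n′; at Q
      -- the value is at least 2n′.
      no-long : ∀ a → ¬ (a ≈ᵛ 0ᵛ) → Q ∙ a ≈ 0# → ¬ cnt v a ≡ n
      no-long a a≉0 Qa long = ℕ.<⇒≢ (ℕ.<-≤-trans (ℕ.m<m+n n′ 0<n′) (ℕ.≤-trans 2n′≤κ (ℕ.≤-reflexive (cnt-scale ℓ[_] (proj₁ (proj₂ (proj₂ cov))) (proj₂ (proj₂ (proj₂ cov)))))))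
          (≡.sym (∑-saturated-≥ (λ i → κ (OnPencil.member (pencil a a≉0) i)) n′ (λ i → n′≤κ (OnPencil.member (pencil a a≉0) i) (OnPencil.member≉0 (pencil a a≉0) i))
            (ℕ.≤-reflexive (≡.trans (∑κ-long a≉0 long) (ℕ.*-comm n′ (suc q)))) (proj₁ cov)))
        where
        cov : ∃ λ i → ∃ λ t → ¬ (t ≈ 0#) × Q ≈ᵛ t ⋆ OnPencil.member (pencil a a≉0) i
        cov = OnPencil.coverMember (pencil a a≉0) Q Q≉0 (∙-comm₀ {Q} Qa)

      extends : ∀ a → ¬ (a ≈ᵛ 0ᵛ) → (d : Dec (Q ∙ a ≈ 0#)) → ⟨ d ⟩ ℕ.+ cnt v a ℕ.≤ n
      extends a a≉0 (no _)   = arc a a≉0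
      extends a a≉0 (yes Qa) = ℕ.≤∧≢⇒< (arc a a≉0) (no-long a a≉0 Qa)

    -- At most `n′` of the N arc points can have the line `ℓ[ j₀ ]` as their short line.
    otherShortLine : ∃ λ j → ¬ (ℓ[ j ] ∥ ℓ[ j₀ ])
    otherShortLine = proj₁ other , λ p → proj₂ other (Pencil.∥⇒∙u (pencil ℓ[ j₀ ] (ℓ≉0 j₀)) ℓ[ proj₁ other ] p)
      where
      other : ∃ λ j → ¬ OnPencil.Both (pencil ℓ[ j₀ ] (ℓ≉0 j₀)) ℓ[ j ]
      other = count-find-not (λ j → OnPencil.both? (pencil ℓ[ j₀ ] (ℓ≉0 j₀)) ℓ[ j ])
        (ℕ.≤-<-trans (ℓ∥-count (ℓ≉0 j₀)) (ℕ.≤-<-trans (ℕ.≤-reflexive (cnt-ℓ j₀))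
          (ℕ.m<m*n n′ (suc q) {{ℕ.>-nonZero 0<n′}} (s≤s (ℕ.≤-trans (s≤s z≤n) (ℕ.<⇒≤ n<q))))))

    -- Two different (n-1)-secants meet in a point on no n-secant, so that point can be added.
    extension : ∃ λ Q → ∀ a → ¬ (a ≈ᵛ 0ᵛ) → ⟨ (Q ∙ a) ≈? 0# ⟩ ℕ.+ cnt v a ℕ.≤ n
    extension = Q , λ a a≉0 → Meeting.extends j₁ (proj₂ otherShortLine) Q (proj₂ otherShortLine)
        (cross-∙ˡ ℓ[ j₁ ] ℓ[ j₀ ]) (cross-∙ʳ ℓ[ j₁ ] ℓ[ j₀ ]) a a≉0 ((Q ∙ a) ≈? 0#)
      where
      j₁ : Fin N
      j₁ = proj₁ otherShortLine
      Q : V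
      Q = cross ℓ[ j₁ ] ℓ[ j₀ ]

-- Maximal arcs: from the projective to the affine plane

module MaximalPlaneArc {c ℓ} (F : CommutativeRing c ℓ) {q : ℕ} (FF : IsFiniteField F q)
  (n′ : ℕ) (2≤n′ : 2 ℕ.≤ n′) (n<q : suc n′ ℕ.< q) where
  open CommutativeRing F hiding (zero)
  open FiniteField F FF
  open Plane F FF
  open PlaneArcs F FF n′ 2≤n′ n<q
  open FieldOrder F FF using (order≡p^h; nonsquare)
  open Frobenius F
  open IntegerSolver F
  open import Relation.Binary.Reasoning.Setoid setoid

  N : ℕ
  N = suc (n′ ℕ.* suc q)

  N+q : N ℕ.+ q ≡ suc q ℕ.* n
  N+q = ≡.trans (≡.cong suc (ℕ.+-comm (n′ ℕ.* suc q) q)) (ℕ.*-comm n (suc q))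

  module _ (v : Fin N → V) (arc : IsArc v) where
    open Arc (ℕ.n≤1+n _) v arc

    full : ∀ j a → ¬ (a ≈ᵛ 0ᵛ) → v j ∙ a ≈ 0# → cnt v a ≡ n
    full j a a≉0 va = ≡.trans (cnt-scale v (proj₁ (proj₂ (proj₂ cov))) (proj₂ (proj₂ (proj₂ cov))))
      (∑-saturated (λ i → cnt v (OnPencil.member (penAt j) i)) n (λ i → arc (OnPencil.member (penAt j) i) (OnPencil.member≉0 (penAt j) i))
        (ℕ.≤-reflexive (≡.trans (≡.sym N+q) (≡.sym (∑-at j)))) (proj₁ cov))
      where
      cov : ∃ λ i → ∃ λ t → ¬ (t ≈ 0#) × a ≈ᵛ t ⋆ OnPencil.member (penAt j) i
      cov = OnPencil.coverMember (penAt j) a a≉0 va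

    cnt-0∨n : ∀ a → ¬ (a ≈ᵛ 0ᵛ) → cnt v a ≡ 0 ⊎ cnt v a ≡ n
    cnt-0∨n a a≉0 = go (cnt v a ℕ.≟ 0)
      where
      go : Dec (cnt v a ≡ 0) → cnt v a ≡ 0 ⊎ cnt v a ≡ n
      go (yes e) = inj₁ e
      go (no ≢0) = let j , e = count-find (λ j → (v j ∙ a) ≈? 0#) (ℕ.n≢0⇒n>0 ≢0) in inj₂ (full j a a≉0 e)

    module _ {Q : V} (Q≉0 : ¬ (Q ≈ᵛ 0ᵛ)) (μ≡0 : μ Q ≡ 0) where
      open OnPencil (pencil Q Q≉0)

      n∣N : n ∣ N
      n∣N = ≡.subst (n ∣_) (outside-sum (pencil Q Q≉0) μ≡0) (∑-∣ n (λ i → cnt v (member i)) λ i → go i (cnt-0∨n (member i) (member≉0 i)))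
        where
        go : ∀ i → cnt v (member i) ≡ 0 ⊎ cnt v (member i) ≡ n → n ∣ cnt v (member i)
        go i (inj₁ e) = ≡.subst (n ∣_) (≡.sym e) (n ∣0)
        go i (inj₂ e) = ≡.subst (n ∣_) (≡.sym e) ∣-refl

      abstract
        externalMember : ∃ λ i → cnt v (member i) ≡ 0
        externalMember = go (any? (λ i → cnt v (member i) ℕ.≟ 0))
          where
          go : Dec (∃ λ i → cnt v (member i) ≡ 0) → ∃ λ i → cnt v (member i) ≡ 0
          go (yes p)   = p
          go (no none) = contradiction (≡.trans N≡ (≡.sym N+q)) (ℕ.<⇒≢ (ℕ.m<m+n N (ℕ.<-trans (s≤s z≤n) 1<q)))
            where
            all-n : ∀ i → cnt v (member i) ≡ n
            all-n i with cnt-0∨n (member i) (member≉0 i)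
            ... | inj₁ e = contradiction (i , e) none
            ... | inj₂ e = e
            N≡ : N ≡ suc q ℕ.* n
            N≡ = ≡.trans (≡.sym (outside-sum (pencil Q Q≉0) μ≡0)) (≡.trans (Σℕ.sum-cong-≗ all-n) (∑-const (suc q) n))

    -- Needed already in the projective plane: it makes n a power of the characteristic, which
    -- settles characteristic 2 before a nonsquare has to be chosen.
    n∣q : n ∣ q
    n∣q = let Q , Q≉0 , μ≡0 = outside-exists in
      ∣m+n∣m⇒∣n (≡.subst (n ∣_) (≡.sym N+q) (n∣m*n (suc q))) (n∣N Q≉0 μ≡0)

    externalLine : ∃ λ a → ¬ (a ≈ᵛ 0ᵛ) × (∀ j → ¬ (v j ∙ a ≈ 0#))
    externalLine = let Q , Q≉0 , μ≡0 = outside-exists ; i , e = externalMember Q≉0 μ≡0 in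
      OnPencil.member (pencil Q Q≉0) i , OnPencil.member≉0 (pencil Q Q≉0) i ,
      λ j z → contradiction (≡.subst (1 ℕ.≤_) e (count-≥1 (λ j → (v j ∙ OnPencil.member (pencil Q Q≉0) i) ≈? 0#) j z)) λ ()

    -- The external line `a` becomes the line at infinity: vectors are scaled to v ∙ a = 1, and as
    -- the first coordinate of `a` is nonzero, the last two coordinates of v determine the first.
    module Affine (a : V) (a₁≉0 : ¬ (proj₁ a ≈ 0#)) (external : ∀ j → ¬ (v j ∙ a ≈ 0#)) where

      s s⁻¹ : Fin N → Carrier
      s j = v j ∙ a
      s⁻¹ j = proj₁ (inverse (s j) (external j))

      ss⁻¹ : ∀ j → s j * s⁻¹ j ≈ 1#
      ss⁻¹ j = proj₂ (inverse (s j) (external j))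

      point : Fin N → Carrier × Carrier
      point j = proj₁ (proj₂ (v j)) * s⁻¹ j , proj₂ (proj₂ (v j)) * s⁻¹ j

      first : ∀ j → proj₁ a * (proj₁ (v j) * s⁻¹ j) ≈ 1# - (proj₁ (proj₂ a) * proj₁ (point j) + proj₂ (proj₂ a) * proj₂ (point j))
      first j = begin
        a₁ * (x * i)                                              ≈⟨ solve 7 (λ a b d x y z i → a :* (x :* i) := (x :* a :+ (y :* b :+ z :* d)) :* i :- (b :* (y :* i) :+ d :* (z :* i))) refl a₁ a₂ a₃ x y z i ⟩
        (x * a₁ + (y * a₂ + z * a₃)) * i - (a₂ * (y * i) + a₃ * (z * i))   ≈⟨ +-congʳ (ss⁻¹ j) ⟩
        1# - (a₂ * (y * i) + a₃ * (z * i))                        ∎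
        where
        a₁ = proj₁ a
        a₂ = proj₁ (proj₂ a)
        a₃ = proj₂ (proj₂ a)
        x = proj₁ (v j)
        y = proj₁ (proj₂ (v j))
        z = proj₂ (proj₂ (v j))
        i = s⁻¹ j

      point-injective : ∀ i j → (proj₁ (point i) ≈ proj₁ (point j)) × (proj₂ (point i) ≈ proj₂ (point j)) → i ≡ j
      point-injective i j (e₂ , e₃) = ∥-unique i j (∥-common (recover i) (≈ᵛ-trans (recover j) (⋆-cong refl (≈ᵛ-sym normalised))))
        where
        normalised : s⁻¹ i ⋆ v i ≈ᵛ s⁻¹ j ⋆ v j
        normalised = swap (*-cancelʳ-≉0 a₁≉0 (trans (*-comm _ _) (trans (trans (first i) (trans (+-congˡ (-‿cong (+-cong (*-congˡ e₂) (*-congˡ e₃)))) (sym (first j)))) (*-comm _ _)))) , swap e₂ , swap e₃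
          where
          swap : ∀ {x y i j} → x * i ≈ y * j → i * x ≈ j * y
          swap e = trans (*-comm _ _) (trans e (*-comm _ _))
        recover : ∀ j → v j ≈ᵛ s j ⋆ s⁻¹ j ⋆ v j
        recover j = ≈ᵛ-trans (1⋆ (v j)) (≈ᵛ-trans (⋆-cong (sym (ss⁻¹ j)) ≈ᵛ-refl) (≈ᵛ-sym (⋆⋆ (s j) (s⁻¹ j) (v j))))

      line : ∀ c₀ c₁ c₂ → ¬ (c₀ ≈ 0# × c₁ ≈ 0# × c₂ ≈ 0#) →
             count (λ j → (c₀ + (c₁ * proj₁ (point j) + c₂ * proj₂ (point j))) ≈? 0#) ℕ.≤ n
      line c₀ c₁ c₂ c≉0 = ℕ.≤-trans (count-mono (λ j → (c₀ + (c₁ * proj₁ (point j) + c₂ * proj₂ (point j))) ≈? 0#) (λ j → (v j ∙ f) ≈? 0#) on)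
          (arc f f≉0)
        where
        -- The affine functional is made homogeneous by letting `a`, which is 1 on the scaled
        -- vectors, stand for the constant.
        f : V
        f = c₀ ⋆ a ⊕ (0# , c₁ , c₂)
        f≉0 : ¬ (f ≈ᵛ 0ᵛ)
        f≉0 (d₁ , d₂ , d₃) = c≉0 (c₀≈0 , kill d₂ , kill d₃)
          where
          c₀≈0 : c₀ ≈ 0#
          c₀≈0 = cancel (proj₁ a) c₀ (trans (*-comm _ _) (trans (sym (+-identityʳ _)) d₁)) a₁≉0
          kill : ∀ {x y} → c₀ * x + y ≈ 0# → y ≈ 0#
          kill {x} {y} d = trans (sym (trans (+-congʳ (trans (*-congʳ c₀≈0) (zeroˡ x))) (+-identityˡ y))) d
        on : ∀ j → c₀ + (c₁ * proj₁ (point j) + c₂ * proj₂ (point j)) ≈ 0# → v j ∙ f ≈ 0#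
        on j e = begin
          v j ∙ f                                          ≈⟨ solve 9 (λ x y z a b d c₀ c₁ c₂ → x :* (c₀ :* a :+ con (+ 0)) :+ (y :* (c₀ :* b :+ c₁) :+ z :* (c₀ :* d :+ c₂))
                                                                := (x :* a :+ (y :* b :+ z :* d)) :* c₀ :+ con (+ 1) :* (c₁ :* y :+ c₂ :* z)) refl
                                                                (proj₁ (v j)) y z (proj₁ a) (proj₁ (proj₂ a)) (proj₂ (proj₂ a)) c₀ c₁ c₂ ⟩
          s j * c₀ + 1# * (c₁ * y + c₂ * z)                ≈⟨ +-congˡ (*-congʳ (ss⁻¹ j)) ⟨
          s j * c₀ + (s j * s⁻¹ j) * (c₁ * y + c₂ * z)     ≈⟨ solve 7 (λ s i c₀ c₁ c₂ y z → s :* c₀ :+ (s :* i) :* (c₁ :* y :+ c₂ :* z) := s :* (c₀ :+ (c₁ :* (y :* i) :+ c₂ :* (z :* i)))) refl (s j) (s⁻¹ j) c₀ c₁ c₂ y z ⟩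
          s j * (c₀ + (c₁ * (y * s⁻¹ j) + c₂ * (z * s⁻¹ j)))   ≈⟨ trans (*-congˡ e) (zeroʳ _) ⟩
          0#                                               ∎
          where
          y = proj₁ (proj₂ (v j))
          z = proj₂ (proj₂ (v j))

  rotate-arc : ∀ {M} {v : Fin M → V} → IsArc v → IsArc (rot ∘ v)
  rotate-arc {v = v} arc a@(x , y , z) a≉0 = ℕ.≤-trans (count-mono (λ j → (rot (v j) ∙ a) ≈? 0#) (λ j → (v j ∙ rot⁻¹ a) ≈? 0#)
    (λ j e → trans (sym (rot-∙ (v j) a)) e)) (arc (rot⁻¹ a) (λ (e₁ , e₂ , e₃) → a≉0 (e₂ , e₃ , e₁)))

  rotate-external : ∀ {M} {v : Fin M → V} {a} → (∀ j → ¬ (v j ∙ a ≈ 0#)) → ∀ j → ¬ (rot (v j) ∙ rot a ≈ 0#)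
  rotate-external {v = v} {a} ext j e = ext j (trans (sym (rot-∙ (v j) (rot a))) e)

  module _ (¬2 : ¬ (IsPowerOf2 n × IsPowerOf2 q)) where

    noMaximalArc-char : (v : Fin N → V) (arc : IsArc v) (a : V) → ¬ (proj₁ a ≈ 0#) → (∀ j → ¬ (v j ∙ a ≈ 0#)) →
                        ∀ p h e → Prime p → p · 1# ≈ 0# → q ≡ p ℕ.^ h → n ≡ p ℕ.^ e → Dec (p ≡ 2) → ⊥
    noMaximalArc-char v arc a a₁≉0 ext p h e pp char q≡ n≡ (yes p≡2) =
      ¬2 ((e , ≡.trans n≡ (≡.cong (ℕ._^ e) p≡2)) , (h , ≡.trans q≡ (≡.cong (ℕ._^ h) p≡2)))
    noMaximalArc-char v arc a a₁≉0 ext p h e pp char q≡ n≡ (no p≢2) =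
      AffineArc.noArc F FF (proj₁ δ) (proj₂ δ) {p} {h} {n′} pp char q≡ 2≤n′ n<q point point-injective line {e} n≡ 3≤p
      where
      open Affine v arc a a₁≉0 ext
      3≤p : 3 ℕ.≤ p
      3≤p = ℕ.≤∧≢⇒< (ℕ.nonTrivial⇒n>1 p {{prime⇒nonTrivial pp}}) (p≢2 ∘ ≡.sym)
      2≉0 : ¬ (1# + 1# ≈ 0#)
      2≉0 e = ℕ.<⇒≱ 3≤p (∣⇒≤ (char-∣ pp char {2} (trans (+-congˡ (+-identityʳ 1#)) e)))
      δ : ∃ λ δ → ∀ x → ¬ (x * x ≈ δ)
      δ = nonsquare 2≉0

    noMaximalArc₁ : (v : Fin N → V) (arc : IsArc v) (a : V) → ¬ (proj₁ a ≈ 0#) → (∀ j → ¬ (v j ∙ a ≈ 0#)) → ⊥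
    noMaximalArc₁ v arc a a₁≉0 ext =
      let p , pp , char = characteristic
          h , q≡ = order≡p^h pp char
          e , n≡ = ∣p^h⇒power pp h (≡.subst (n ∣_) q≡ (n∣q v arc))
      in noMaximalArc-char v arc a a₁≉0 ext p h e pp char q≡ n≡ (p ℕ.≟ 2)

    noMaximalArc : (v : Fin N → V) → IsArc v → ⊥
    noMaximalArc v arc = let a , a≉0 , ext = externalLine v arc in go a a≉0 ext
      where
      go : (a : V) → ¬ (a ≈ᵛ 0ᵛ) → (∀ j → ¬ (v j ∙ a ≈ 0#)) → ⊥
      go a@(x , y , z) a≉0 ext with x ≈? 0# | y ≈? 0# | z ≈? 0#
      ... | no x≉0 | _      | _      = noMaximalArc₁ v arc a x≉0 ext
      ... | yes _  | no y≉0 | _      = noMaximalArc₁ (rot ∘ v) (rotate-arc {v = v} arc) (rot a) y≉0 (rotate-external {v = v} {a} ext)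
      ... | yes _  | yes _  | no z≉0 = noMaximalArc₁ (rot ∘ rot ∘ v) (rotate-arc {v = rot ∘ v} (rotate-arc {v = v} arc)) (rot (rot a)) z≉0
                                         (rotate-external {v = rot ∘ v} {rot a} (rotate-external {v = v} {a} ext))
      ... | yes e₁ | yes e₂ | yes e₃ = a≉0 (e₁ , e₂ , e₃)

    -- With exactly n′(q + 1) points the arc is first extended; with more, `size≤` leaves only the
    -- maximal size.
    noLargeArc : ∀ {M} → n′ ℕ.* suc q ℕ.≤ M → (v : Fin M → V) → IsArc v → ⊥
    noLargeArc {M} big v arc with ℕ.m≤n⇒m<n∨m≡n big
    ... | inj₂ ≡.refl = noMaximalArc v⁺ arc⁺
      where
      ext : ∃ λ Q → ∀ a → ¬ (a ≈ᵛ 0ᵛ) → ⟨ (Q ∙ a) ≈? 0# ⟩ ℕ.+ cnt v a ℕ.≤ n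
      ext = Extension.extension F FF n′ 2≤n′ n<q v arc
      v⁺ : Fin N → V
      v⁺ zero    = proj₁ ext
      v⁺ (suc j) = v j
      arc⁺ : IsArc v⁺
      arc⁺ a a≉0 = proj₂ ext a a≉0
    ... | inj₁ big′ = noMaximalArc (v ∘ Fin.cast N≡M) (λ a a≉0 → ≡.subst (λ m → (e : N ≡ m) → (w : Fin m → V) → IsArc w → cnt (w ∘ Fin.cast e) a ℕ.≤ n) N≡M
          (λ e w arc-w → ℕ.≤-trans (ℕ.≤-reflexive (Σℕ.sum-cong-≗ (λ j → ≡.cong (λ k → ⟨ (w k ∙ a) ≈? 0# ⟩) (cast-is-id e j)))) (arc-w a a≉0)) N≡M v arc)
      where
      N≡M : N ≡ M
      N≡M = ℕ.≤-antisym big′ (Arc.size≤ big v arc)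

-- Linear codes

∑-split : ∀ a {b} (f : Fin (a ℕ.+ b) → ℕ) → Σℕ.sum f ≡ Σℕ.sum (λ i → f (i ↑ˡ b)) ℕ.+ Σℕ.sum (λ i → f (a ↑ʳ i))
∑-split zero    f = ≡.refl
∑-split (suc a) f = ≡.trans (≡.cong (f zero ℕ.+_) (∑-split a (f ∘ suc))) (≡.sym (ℕ.+-assoc (f zero) _ _))

funToFin-cong : ∀ {m n} {f g : Fin m → Fin n} → (∀ i → f i ≡ g i) → funToFin f ≡ funToFin g
funToFin-cong {zero}  e = ≡.refl
funToFin-cong {suc m} e = ≡.cong₂ combine (e zero) (funToFin-cong (e ∘ suc))

∑-partition : ∀ {a m} {P : Fin m → Set a} (P? : ∀ i → Dec (P i)) (f : Fin m → ℕ) →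
              Σℕ.sum (λ i → f (members P? i)) ℕ.+ Σℕ.sum (λ i → f (members (¬? ∘ P?) i)) ≡ Σℕ.sum f
∑-partition P? f = ≡.trans (≡.cong₂ ℕ._+_ (MC.∑-members P? f) (MC.∑-members (¬? ∘ P?) f))
  (≡.trans (≡.sym (Σℕ.∑-distrib-+ (λ i → ⟨ P? i ⟩ · f i) (λ i → ⟨ ¬? (P? i) ⟩ · f i))) (Σℕ.sum-cong-≗ (λ i → go (P? i) (f i))))
  where
  module MC = MonoidCount ℕ.+-0-commutativeMonoid
  open import Algebra.Properties.Monoid.Mult (CommutativeMonoid.monoid ℕ.+-0-commutativeMonoid) using () renaming (_×_ to _·_)
  go : ∀ {a} {Q : Set a} (d : Dec Q) x → ⟨ d ⟩ · x ℕ.+ ⟨ ¬? d ⟩ · x ≡ x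
  go (yes _) x = ≡.trans (ℕ.+-identityʳ _) (ℕ.+-identityʳ x)
  go (no _)  x = ℕ.+-identityʳ x

count-complement : ∀ {a m} {P : Fin m → Set a} (P? : ∀ i → Dec (P i)) → count P? ℕ.+ count (¬? ∘ P?) ≡ m
count-complement {m = m} P? = ≡.trans (≡.sym (Σℕ.∑-distrib-+ (λ i → ⟨ P? i ⟩) (λ i → ⟨ ¬? (P? i) ⟩)))
  (≡.trans (Σℕ.sum-cong-≗ (λ i → go (P? i))) (≡.trans (∑-const m 1) (ℕ.*-identityʳ m)))
  where
  go : ∀ {a} {Q : Set a} (d : Dec Q) → ⟨ d ⟩ ℕ.+ ⟨ ¬? d ⟩ ≡ 1
  go (yes _) = ≡.refl
  go (no _)  = ≡.refl

members-surjective : ∀ {a m} {P : Fin m → Set a} (P? : ∀ i → Dec (P i)) j → P j → ∃ λ i → members P? i ≡ j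
members-surjective {m = suc m} P? zero    pj with P? zero
... | yes _ = zero , ≡.refl
... | no n  = contradiction pj n
members-surjective {m = suc m} P? (suc j) pj with P? zero
... | yes _ = let i , e = members-surjective (P? ∘ suc) j pj in suc i , ≡.cong suc e
... | no _  = let i , e = members-surjective (P? ∘ suc) j pj in i , ≡.cong suc e

module LinearAlgebra {c ℓ} (F : CommutativeRing c ℓ) {q : ℕ} (FF : IsFiniteField F q) where
  open CommutativeRing F hiding (zero)
  open FiniteField F FF
  open Codes F FF hiding (_≈?_)
  open IntegerSolver F
  open import Algebra.Properties.Semiring.Sum semiring using (sum; sum-cong-≋; ∑-comm; *-distribˡ-sum; *-distribʳ-sum; sum-replicate-zero)
  open import Algebra.Properties.Ring ring using (x∙y⁻¹≈ε⇒x≈y)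
  open import Relation.Binary.Reasoning.Setoid setoid

  dot : ∀ {m} → Vector m → Vector m → Carrier
  dot x y = sum (λ i → x i * y i)

  dot-sub : ∀ {m} (a x y : Vector m) → dot a (λ i → x i - y i) ≈ dot a x - dot a y
  dot-sub {zero}  a x y = sym (-‿inverseʳ 0#)
  dot-sub {suc m} a x y = trans (+-congˡ (dot-sub (a ∘ suc) (x ∘ suc) (y ∘ suc)))
    (solve 5 (λ a x y u v → a :* (x :- y) :+ (u :- v) := (a :* x :+ u) :- (a :* y :+ v)) refl _ _ _ _ _)

  nonzeroEntry : ∀ {m} (x : Vector m) → ¬ IsZero x → ∃ λ i → ¬ (x i ≈ 0#)
  nonzeroEntry x x≉0 = ¬∀⟶∃¬ _ _ (λ i → x i ≈? 0#) x≉0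

  abstract
    -- Pigeonhole: q^r vectors but only q^m values, so two vectors have the same image.
    solveSystem : ∀ {m r} → m ℕ.< r → (A : Fin m → Vector r) → ∃ λ x → ¬ IsZero x × (∀ i → dot (A i) x ≈ 0#)
    solveSystem {m} {r} m<r A with pigeonhole (ℕ.^-monoʳ-< q 1<q m<r) image
      where
      image : Fin (q ℕ.^ r) → Fin (q ℕ.^ m)
      image t = funToFin (λ i → index (dot (A i) (λ j → enum (finToFun t j))))
    ... | t , t′ , t<t′ , same = (λ j → x j - x′ j) , nonzero , λ i → trans (dot-sub (A i) x x′) (trans (+-congʳ (equal i)) (-‿inverseʳ _))
      where
      x x′ : Vector r
      x j = enum (finToFun t j)
      x′ j = enum (finToFun t′ j)
      equal : ∀ i → dot (A i) x ≈ dot (A i) x′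
      equal i = trans (sym (enum-index _)) (trans (reflexive (≡.cong enum (≡.trans (≡.sym (finToFun-funToFin (λ i → index (dot (A i) x)) i))
        (≡.trans (≡.cong (λ z → finToFun z i) same) (finToFun-funToFin (λ i → index (dot (A i) x′)) i))))) (enum-index _))
      nonzero : ¬ IsZero (λ j → x j - x′ j)
      nonzero z = <⇒≢ᶠ t<t′ (≡.trans (≡.sym (funToFin-finToFin {r} {q} t)) (≡.trans (funToFin-cong (λ j → enum-injective (x∙y⁻¹≈ε⇒x≈y _ _ (z j)))) (funToFin-finToFin {r} {q} t′)))

  unit : ∀ {r} → Fin r → Vector r
  unit i j with j ≟ᶠ i
  ... | yes _ = 1#
  ... | no _  = 0#

  dot-unit : ∀ {r} (i : Fin r) x → dot (unit i) x ≈ x i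
  dot-unit i x = trans (MC.∑-single (λ j → unit i j * x j) i off) at
    where
    module MC = MonoidCount +-commutativeMonoid
    off : ∀ j → ¬ j ≡ i → unit i j * x j ≈ 0#
    off j j≢i with j ≟ᶠ i
    ... | yes e = contradiction e j≢i
    ... | no _  = zeroˡ _
    at : unit i i * x i ≈ x i
    at with i ≟ᶠ i
    ... | yes _ = *-identityˡ _
    ... | no n  = contradiction ≡.refl n

  addEquation : ∀ {m r} → Vector r → (Fin m → Vector r) → Fin (suc m) → Vector r
  addEquation a A zero    = a
  addEquation a A (suc i) = A i

  -- Solutions in echelon form, hence independent.
  record TwoSolutions {m r} (A : Fin m → Vector r) : Set (c ⊔ ℓ) where
    field
      x₁ x₂   : Vector r
      pivot₁  : Fin r
      x₁-sol  : ∀ i → dot (A i) x₁ ≈ 0#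
      x₂-sol  : ∀ i → dot (A i) x₂ ≈ 0#
      x₁-piv  : ¬ (x₁ pivot₁ ≈ 0#)
      x₂-piv  : x₂ pivot₁ ≈ 0#
      x₂≉0    : ¬ IsZero x₂

  -- The second solution satisfies one more equation, the vanishing at the pivot of the first; this
  -- is the extra unit in the bound.
  twoSolutions : ∀ {m r} → suc m ℕ.< r → (A : Fin m → Vector r) → TwoSolutions A
  twoSolutions {m} {r} lt A = record
    { x₁ = x₁ ; x₂ = proj₁ second ; pivot₁ = i₁ ; x₁-sol = proj₂ (proj₂ first) ; x₂-sol = proj₂ (proj₂ second) ∘ suc
    ; x₁-piv = proj₂ piv ; x₂-piv = trans (sym (dot-unit i₁ (proj₁ second))) (proj₂ (proj₂ second) zero) ; x₂≉0 = proj₁ (proj₂ second) }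
    where
    first : ∃ λ x → ¬ IsZero x × (∀ i → dot (A i) x ≈ 0#)
    first = solveSystem (ℕ.<⇒≤ lt) A
    x₁ : Vector r
    x₁ = proj₁ first
    piv : ∃ λ i → ¬ (x₁ i ≈ 0#)
    piv = nonzeroEntry x₁ (proj₁ (proj₂ first))
    i₁ : Fin r
    i₁ = proj₁ piv
    second : ∃ λ x → ¬ IsZero x × (∀ i → dot (addEquation (unit i₁) A i) x ≈ 0#)
    second = solveSystem lt (addEquation (unit i₁) A)

  record ThreeSolutions {m r} (A : Fin m → Vector r) : Set (c ⊔ ℓ) where
    field
      x₁ x₂ x₃ : Vector r
      x₁-sol  : ∀ i → dot (A i) x₁ ≈ 0#
      x₂-sol  : ∀ i → dot (A i) x₂ ≈ 0#
      x₃-sol  : ∀ i → dot (A i) x₃ ≈ 0#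
      indep   : ∀ a b d → IsZero (λ i → a * x₁ i + (b * x₂ i + d * x₃ i)) → a ≈ 0# × b ≈ 0# × d ≈ 0#

  extendSolutions : ∀ {m r} (A : Fin m → Vector r) (x₁ : Vector r) → (∀ i → dot (A i) x₁ ≈ 0#) →
                    ∀ i₁ → ¬ (x₁ i₁ ≈ 0#) → TwoSolutions (addEquation (unit i₁) A) → ThreeSolutions A
  extendSolutions A x₁ sol₁ i₁ piv two = record
    { x₁ = x₁ ; x₂ = T.x₁ ; x₃ = T.x₂ ; x₁-sol = sol₁ ; x₂-sol = T.x₁-sol ∘ suc ; x₃-sol = T.x₂-sol ∘ suc ; indep = indep }
    where
    module T = TwoSolutions two
    x₂-i₁ : T.x₁ i₁ ≈ 0#
    x₂-i₁ = trans (sym (dot-unit i₁ T.x₁)) (T.x₁-sol zero)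
    x₃-i₁ : T.x₂ i₁ ≈ 0#
    x₃-i₁ = trans (sym (dot-unit i₁ T.x₂)) (T.x₂-sol zero)
    kill : ∀ {x y} → y ≈ 0# → x + y ≈ 0# → x ≈ 0#
    kill e z = trans (sym (trans (+-congˡ e) (+-identityʳ _))) z
    killˡ : ∀ {x y} → x ≈ 0# → x + y ≈ 0# → y ≈ 0#
    killˡ e z = trans (sym (trans (+-congʳ e) (+-identityˡ _))) z
    0* : ∀ {x y} → x ≈ 0# → x * y ≈ 0#
    0* e = trans (*-congʳ e) (zeroˡ _)
    *0 : ∀ {x y} → y ≈ 0# → x * y ≈ 0#
    *0 e = trans (*-congˡ e) (zeroʳ _)
    indep : ∀ a b d → IsZero (λ i → a * x₁ i + (b * T.x₁ i + d * T.x₂ i)) → a ≈ 0# × b ≈ 0# × d ≈ 0#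
    indep a b d z = a≈0 , b≈0 , d≈0
      where
      a≈0 : a ≈ 0#
      a≈0 = cancel (x₁ i₁) a (trans (*-comm _ _) (kill (trans (+-cong (*0 x₂-i₁) (*0 x₃-i₁)) (+-identityˡ _)) (z i₁))) piv
      rest : ∀ i → b * T.x₁ i + d * T.x₂ i ≈ 0#
      rest i = killˡ (0* a≈0) (z i)
      b≈0 : b ≈ 0#
      b≈0 = cancel (T.x₁ T.pivot₁) b (trans (*-comm _ _) (kill (*0 T.x₂-piv) (rest T.pivot₁))) T.x₁-piv
      d≈0 : d ≈ 0#
      d≈0 = let i , x₃i≉0 = nonzeroEntry T.x₂ T.x₂≉0 in cancel (T.x₂ i) d (trans (*-comm _ _) (killˡ (0* b≈0) (rest i))) x₃i≉0

  threeSolutions : ∀ {m r} → suc (suc m) ℕ.< r → (A : Fin m → Vector r) → ThreeSolutions A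
  threeSolutions {m} {r} lt A = extend (solveSystem (ℕ.<⇒≤ (ℕ.<⇒≤ lt)) A)
    where
    extend : (∃ λ x → ¬ IsZero x × (∀ i → dot (A i) x ≈ 0#)) → ThreeSolutions A
    extend (x , x≉0 , sol) = let i , piv = nonzeroEntry x x≉0 in
      extendSolutions A x sol i piv (twoSolutions lt (addEquation (unit i) A))

  sumF≡sum : ∀ {m} (f : Fin m → Carrier) → sumF f ≡ sum f
  sumF≡sum {zero}  f = ≡.refl
  sumF≡sum {suc m} f = ≡.cong (λ z → f zero + z) (sumF≡sum (f ∘ suc))

  weight≡count : ∀ {m} (x : Vector m) → weight x ≡ count (λ j → ¬? (x j ≈? 0#))
  weight≡count {zero}  x = ≡.refl
  weight≡count {suc m} x with x zero ≈? 0#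
  ... | yes _ = weight≡count (x ∘ suc)
  ... | no _  = ≡.cong suc (weight≡count (x ∘ suc))

  zeroCount : ∀ {m} → Vector m → ℕ
  zeroCount x = count (λ j → x j ≈? 0#)

  zeroCount+weight : ∀ {m} (x : Vector m) → zeroCount x ℕ.+ weight x ≡ m
  zeroCount+weight x = ≡.trans (≡.cong (zeroCount x ℕ.+_) (weight≡count x)) (count-complement (λ j → x j ≈? 0#))

  ∑-swap : ∀ {m r} (x : Vector m) (G : Fin m → Fin r → Carrier) (y : Vector r) →
           sum (λ i → x i * sum (λ j → G i j * y j)) ≈ sum (λ j → sum (λ i → x i * G i j) * y j)
  ∑-swap x G y = begin
    sum (λ i → x i * sum (λ j → G i j * y j))      ≈⟨ sum-cong-≋ (λ i → *-distribˡ-sum (x i) (λ j → G i j * y j)) ⟩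
    sum (λ i → sum (λ j → x i * (G i j * y j)))    ≈⟨ ∑-comm (λ i j → x i * (G i j * y j)) ⟩
    sum (λ j → sum (λ i → x i * (G i j * y j)))    ≈⟨ sum-cong-≋ (λ j → trans (sum-cong-≋ (λ i → sym (*-assoc (x i) (G i j) (y j)))) (sym (*-distribʳ-sum (y j) (λ i → x i * G i j)))) ⟩
    sum (λ j → sum (λ i → x i * G i j) * y j)      ∎

  sum-zero : ∀ {m} (f : Fin m → Carrier) → (∀ i → f i ≈ 0#) → sum f ≈ 0#
  sum-zero {m} f z = trans (sum-cong-≋ z) (sum-replicate-zero m)

  -- A linear relation makes one condition redundant, at any index where its coefficient is nonzero.
  -- It is applied once to columns and once to rows.
  lastTerm : ∀ {m} (x s : Vector m) o → ¬ (x o ≈ 0#) → (∀ i → ¬ i ≡ o → x i * s i ≈ 0#) → dot x s ≈ 0# → s o ≈ 0#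
  lastTerm x s o xo≉0 off total = cancel (x o) (s o) (trans (sym (MC.∑-single (λ i → x i * s i) o off)) total) xo≉0
    where module MC = MonoidCount +-commutativeMonoid

-- A lower bound for the weight of dual words

module ShortDualWord {c ℓ} (F : CommutativeRing c ℓ) {q : ℕ} (FF : IsFiniteField F q) where
  open CommutativeRing F hiding (zero)
  open FiniteField F FF
  open Codes F FF hiding (_≈?_)
  open LinearAlgebra F FF
  open Plane F FF using (V; 0ᵛ; _≈ᵛ_; _∙_; cnt)
  open import Algebra.Properties.Semiring.Sum semiring using (sum; sum-cong-≋; ∑-distrib-+; *-distribˡ-sum)
  open IntegerSolver F

  module _ {k n s : ℕ} (G : Matrix k n)
    (2≤s : 2 ℕ.≤ s) (s+1<q : suc s ℕ.< q) (¬2 : ¬ (IsPowerOf2 (suc s) × IsPowerOf2 q))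
    (zeros≤ : ∀ w → ¬ IsZero w → suc (zeroCount (encode G w)) ℕ.≤ k ℕ.+ s)
    (y : Vector n) (dual : DualCode G y) where

    -- `T` lists the support of the dual word, the first e entries of `Z` are the columns added to
    -- it, and the other M are projected. Only sums over columns matter, so the partition is stated
    -- through sums.
    module Project {t′ e M : ℕ} (T : Fin (suc t′) → Fin n) (Z : Fin (e ℕ.+ M) → Fin n)
      (partition : ∀ (f : Fin n → ℕ) → Σℕ.sum (f ∘ T) ℕ.+ Σℕ.sum (f ∘ Z) ≡ Σℕ.sum f)
      (pivot : ¬ (y (T zero) ≈ 0#)) (support : ∀ j → ¬ (y j ≈ 0#) → ∃ λ t → T t ≡ j)
      (k≡ : suc t′ ℕ.+ e ℕ.+ 2 ≡ k) (big : s ℕ.* suc q ℕ.≤ M) where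

      -- The first support column is left out because the dual word forces the value there. The k -
      -- 2 chosen columns thus cost k - 3 equations, leaving three independent functionals.
      columns : Fin (t′ ℕ.+ e) → Fin n
      columns i = [ T ∘ suc , (λ z → Z (z ↑ˡ M)) ]′ (splitAt t′ i)

      columns-↑ˡ : ∀ i → columns (i ↑ˡ e) ≡ T (suc i)
      columns-↑ˡ i = ≡.cong [ T ∘ suc , (λ z → Z (z ↑ˡ M)) ]′ (splitAt-↑ˡ t′ i e)

      columns-↑ʳ : ∀ z → columns (t′ ↑ʳ z) ≡ Z (z ↑ˡ M)
      columns-↑ʳ z = ≡.cong [ T ∘ suc , (λ z → Z (z ↑ˡ M)) ]′ (splitAt-↑ʳ t′ e z)

      A : Fin (t′ ℕ.+ e) → Vector k
      A i l = G l (columns i)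

      value : Vector k → Fin n → Carrier
      value x j = dot (λ l → G l j) x

      module _ (x : Vector k) (sol : ∀ i → dot (A i) x ≈ 0#) where

        value-suc : ∀ i → value x (T (suc i)) ≈ 0#
        value-suc i = ≡.subst (λ j → value x j ≈ 0#) (columns-↑ˡ i) (sol (i ↑ˡ e))

        value-extra : ∀ z → value x (Z (z ↑ˡ M)) ≈ 0#
        value-extra z = ≡.subst (λ j → value x j ≈ 0#) (columns-↑ʳ z) (sol (t′ ↑ʳ z))

        value-zero : value x (T zero) ≈ 0#
        value-zero = lastTerm y (value x) (T zero) pivot off (trans (∑-swap y (λ j l → G l j) x)
            (sum-zero _ (λ l → trans (*-congʳ (trans (sum-cong-≋ (λ j → *-comm (y j) (G l j))) (trans (reflexive (≡.sym (sumF≡sum (λ j → G l j * y j)))) (dual l)))) (zeroˡ _))))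
          where
          off : ∀ j → ¬ j ≡ T zero → y j * value x j ≈ 0#
          off j j≢ = go (y j ≈? 0#)
            where
            go : Dec (y j ≈ 0#) → y j * value x j ≈ 0#
            go (yes e) = trans (*-congʳ e) (zeroˡ _)
            go (no n)  = hit (support j n)
              where
              hit : (∃ λ t → T t ≡ j) → y j * value x j ≈ 0#
              hit (zero  , e) = contradiction (≡.sym e) j≢
              hit (suc i , e) = trans (*-congˡ (≡.subst (λ j → value x j ≈ 0#) e (value-suc i))) (zeroʳ _)

        value-T : ∀ t → value x (T t) ≈ 0#
        value-T zero    = value-zero
        value-T (suc i) = value-suc i

      enough : suc (suc (t′ ℕ.+ e)) ℕ.< k
      enough = ℕ.≤-reflexive (≡.trans (ℕ.+-comm 2 (suc t′ ℕ.+ e)) k≡)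

      module Sol = ThreeSolutions (threeSolutions enough A)

      -- The three functionals are the coordinates of the projection from the span of the chosen
      -- columns.
      point : Fin n → V
      point j = value Sol.x₁ j , value Sol.x₂ j , value Sol.x₃ j

      word : V → Vector k
      word (a , b , d) i = a * Sol.x₁ i + (b * Sol.x₂ i + d * Sol.x₃ i)

      encode-word : ∀ a j → encode G (word a) j ≈ point j ∙ a
      encode-word (a , b , d) j = begin
        sumF (λ i → word (a , b , d) i * G i j)
          ≡⟨ sumF≡sum (λ i → word (a , b , d) i * G i j) ⟩
        sum (λ i → word (a , b , d) i * G i j)
          ≈⟨ sum-cong-≋ (λ i → solve 7 (λ a b d x y z g → (a :* x :+ (b :* y :+ d :* z)) :* g := a :* (g :* x) :+ (b :* (g :* y) :+ d :* (g :* z))) refl a b d (Sol.x₁ i) (Sol.x₂ i) (Sol.x₃ i) (G i j)) ⟩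
        sum (λ i → a * (G i j * Sol.x₁ i) + (b * (G i j * Sol.x₂ i) + d * (G i j * Sol.x₃ i)))
          ≈⟨ ∑-distrib-+ (λ i → a * (G i j * Sol.x₁ i)) (λ i → b * (G i j * Sol.x₂ i) + d * (G i j * Sol.x₃ i)) ⟩
        sum (λ i → a * (G i j * Sol.x₁ i)) + sum (λ i → b * (G i j * Sol.x₂ i) + d * (G i j * Sol.x₃ i))
          ≈⟨ +-congˡ (∑-distrib-+ (λ i → b * (G i j * Sol.x₂ i)) (λ i → d * (G i j * Sol.x₃ i))) ⟩
        sum (λ i → a * (G i j * Sol.x₁ i)) + (sum (λ i → b * (G i j * Sol.x₂ i)) + sum (λ i → d * (G i j * Sol.x₃ i)))
          ≈⟨ +-cong (pull a Sol.x₁) (+-cong (pull b Sol.x₂) (pull d Sol.x₃)) ⟩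
        value Sol.x₁ j * a + (value Sol.x₂ j * b + value Sol.x₃ j * d) ∎
        where
        open import Relation.Binary.Reasoning.Setoid setoid
        pull : ∀ a x → sum (λ i → a * (G i j * x i)) ≈ value x j * a
        pull a x = trans (sym (*-distribˡ-sum a (λ i → G i j * x i))) (*-comm _ _)

      word-zero : ∀ a j → value Sol.x₁ j ≈ 0# → value Sol.x₂ j ≈ 0# → value Sol.x₃ j ≈ 0# → encode G (word a) j ≈ 0#
      word-zero a@(a₁ , a₂ , a₃) j e₁ e₂ e₃ = trans (encode-word a j) (trans (+-cong (*-congʳ e₁) (+-cong (*-congʳ e₂) (*-congʳ e₃)))
        (solve 3 (λ a b d → con (+ 0) :* a :+ (con (+ 0) :* b :+ con (+ 0) :* d) := con (+ 0)) refl a₁ a₂ a₃))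

      points : Fin M → V
      points m = point (Z (e ↑ʳ m))

      -- The hyperplane `word a` contains the k - 2 chosen columns and at most k + s - 1 columns in
      -- all, so at most s + 1 of the others.
      arc : ∀ a → ¬ (a ≈ᵛ 0ᵛ) → cnt points a ℕ.≤ suc s
      arc a a≉0 = ℕ.+-cancelˡ-≤ (suc t′ ℕ.+ e) _ _ (ℕ.≤-pred (begin
        suc (suc t′ ℕ.+ e ℕ.+ cnt points a)              ≡⟨ ≡.cong suc (ℕ.+-assoc (suc t′) e _) ⟩
        suc (suc t′ ℕ.+ (e ℕ.+ cnt points a))            ≡⟨ ≡.cong suc (≡.sym (≡.cong₂ ℕ._+_ ∑T (≡.trans (∑-split e (f ∘ Z)) (≡.cong₂ ℕ._+_ ∑E ∑M)))) ⟩
        suc (Σℕ.sum (f ∘ T) ℕ.+ Σℕ.sum (f ∘ Z))          ≡⟨ ≡.cong suc (partition f) ⟩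
        suc (zeroCount (encode G (word a)))              ≤⟨ zeros≤ (word a) (λ z → a≉0 (Sol.indep _ _ _ z)) ⟩
        k ℕ.+ s                                          ≡⟨ ≡.cong (ℕ._+ s) k≡ ⟨
        suc t′ ℕ.+ e ℕ.+ 2 ℕ.+ s                         ≡⟨ ℕ.+-assoc (suc t′ ℕ.+ e) 2 s ⟩
        suc t′ ℕ.+ e ℕ.+ suc (suc s)                     ≡⟨ ℕ.+-suc (suc t′ ℕ.+ e) (suc s) ⟩
        suc (suc t′ ℕ.+ e ℕ.+ suc s)                     ∎))
        where
        open ℕ.≤-Reasoning
        f : Fin n → ℕ
        f j = ⟨ encode G (word a) j ≈? 0# ⟩
        ones : ∀ {m} (g : Fin m → Fin n) → (∀ i → encode G (word a) (g i) ≈ 0#) → Σℕ.sum (f ∘ g) ≡ m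
        ones g z = count-all (λ i → encode G (word a) (g i) ≈? 0#) z
        ∑T : Σℕ.sum (f ∘ T) ≡ suc t′
        ∑T = ones T (λ t → word-zero a (T t) (value-T Sol.x₁ Sol.x₁-sol t) (value-T Sol.x₂ Sol.x₂-sol t) (value-T Sol.x₃ Sol.x₃-sol t))
        ∑E : Σℕ.sum (λ i → f (Z (i ↑ˡ M))) ≡ e
        ∑E = ones (λ i → Z (i ↑ˡ M)) (λ i → word-zero a _ (value-extra Sol.x₁ Sol.x₁-sol i) (value-extra Sol.x₂ Sol.x₂-sol i) (value-extra Sol.x₃ Sol.x₃-sol i))
        ∑M : Σℕ.sum (λ i → f (Z (e ↑ʳ i))) ≡ cnt points a
        ∑M = count-cong (λ i → encode G (word a) (Z (e ↑ʳ i)) ≈? 0#) (λ i → (points i ∙ a) ≈? 0#)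
          (λ i z → trans (sym (encode-word a _)) z) (λ i z → trans (encode-word a _) z)

      impossible : ⊥
      impossible = MaximalPlaneArc.noLargeArc F FF s 2≤s s+1<q ¬2 big points arc

    -- The support has at most k - s ≤ k - 2 columns and can be padded to k - 2. Then n - k + 2
    -- columns remain, which is at least s(q + 1).
    noShortDualWord : s ℕ.* (q ℕ.+ 1) ℕ.+ k ℕ.< n ℕ.+ 3 → ¬ IsZero y → ¬ (weight y ℕ.+ s ℕ.≤ k)
    noShortDualWord long y≉0 short = go (count P?) (count (¬? ∘ P?)) (members P?) (members (¬? ∘ P?)) (∑-partition P?) (λ i → members-∈ P? i)
        (members-surjective P?) (count-complement P?) (≡.sym (weight≡count y))
      where
      P? : ∀ j → Dec (¬ (y j ≈ 0#))
      P? j = ¬? (y j ≈? 0#)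
      go : ∀ a b (T : Fin a → Fin n) (Z : Fin b → Fin n) → (∀ (f : Fin n → ℕ) → Σℕ.sum (f ∘ T) ℕ.+ Σℕ.sum (f ∘ Z) ≡ Σℕ.sum f) →
           (∀ i → ¬ (y (T i) ≈ 0#)) → (∀ j → ¬ (y j ≈ 0#) → ∃ λ t → T t ≡ j) → a ℕ.+ b ≡ n → a ≡ weight y → ⊥
      go zero     b T Z part on surj a+b a≡ = let j , yj≉0 = nonzeroEntry y y≉0 in contradiction (proj₁ (surj j yj≉0)) λ ()
      go (suc t′) b T Z part on surj a+b a≡ = split (≡.sym (ℕ.m+[n∸m]≡n e≤b)) Z part
        where
        e : ℕ
        e = k ℕ.∸ (suc t′ ℕ.+ 2)
        t+2≤k : suc t′ ℕ.+ 2 ℕ.≤ k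
        t+2≤k = ℕ.≤-trans (ℕ.+-monoʳ-≤ (suc t′) 2≤s) (ℕ.≤-trans (ℕ.≤-reflexive (≡.cong (ℕ._+ s) a≡)) short)
        k≡ : suc t′ ℕ.+ e ℕ.+ 2 ≡ k
        k≡ = ≡.trans (ℕ.+-assoc (suc t′) e 2) (≡.trans (≡.cong (suc t′ ℕ.+_) (ℕ.+-comm e 2)) (≡.trans (≡.sym (ℕ.+-assoc (suc t′) 2 e)) (ℕ.m+[n∸m]≡n t+2≤k)))
        bound : s ℕ.* suc q ℕ.+ e ℕ.≤ b
        bound = ℕ.+-cancelˡ-≤ (suc t′ ℕ.+ 2) _ _ (ℕ.≤-trans (ℕ.≤-reflexive (≡.trans (shuffle (suc t′) (s ℕ.* suc q) e) (≡.cong₂ (λ x y → s ℕ.* x ℕ.+ y) (ℕ.+-comm 1 q) k≡)))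
          (ℕ.≤-trans (ℕ.≤-pred (ℕ.≤-trans long (ℕ.≤-reflexive (ℕ.+-comm n 3)))) (ℕ.≤-reflexive (≡.trans (≡.cong (2 ℕ.+_) (≡.sym a+b)) (shuffle′ (suc t′) b)))))
          where
          shuffle : ∀ t x e → t ℕ.+ 2 ℕ.+ (x ℕ.+ e) ≡ x ℕ.+ (t ℕ.+ e ℕ.+ 2)
          shuffle = solve-∀
          shuffle′ : ∀ t b → 2 ℕ.+ (t ℕ.+ b) ≡ t ℕ.+ 2 ℕ.+ b
          shuffle′ = solve-∀
        e≤b : e ℕ.≤ b
        e≤b = ℕ.≤-trans (ℕ.m≤n+m e _) bound
        big : s ℕ.* suc q ℕ.≤ b ℕ.∸ e
        big = ℕ.≤-trans (ℕ.≤-reflexive (≡.sym (ℕ.m+n∸n≡m (s ℕ.* suc q) e))) (ℕ.∸-monoˡ-≤ e bound)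
        split : ∀ {b′} → b′ ≡ e ℕ.+ (b ℕ.∸ e) → (Z : Fin b′ → Fin n) → (∀ (f : Fin n → ℕ) → Σℕ.sum (f ∘ T) ℕ.+ Σℕ.sum (f ∘ Z) ≡ Σℕ.sum f) → ⊥
        split ≡.refl Z part = Project.impossible {t′} {e} {b ℕ.∸ e} T Z part (on zero) surj k≡ big

-- A dual word of small weight

module LightDualWord {c ℓ} (F : CommutativeRing c ℓ) {q : ℕ} (FF : IsFiniteField F q) where
  open CommutativeRing F hiding (zero)
  open FiniteField F FF
  open Codes F FF hiding (_≈?_)
  open LinearAlgebra F FF
  open import Algebra.Properties.Semiring.Sum semiring using (sum; sum-cong-≋; ∑-distrib-+; *-distribˡ-sum)
  open IntegerSolver F
  open import Relation.Binary.Reasoning.Setoid setoid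

  module Spread {k n m : ℕ} (G : Matrix k n) (W : Fin m → Fin n) (W-injective : ∀ i j → W i ≡ W j → i ≡ j) (y : Vector m)
    (relation : ∀ i → sum (λ t → G i (W t) * y t) ≈ 0#) where

    spread : Vector n
    spread j = sum (λ t → unit (W t) j * y t)

    spread-dual : DualCode G spread
    spread-dual i = trans (reflexive (sumF≡sum (λ j → G i j * spread j))) (trans (∑-swap (G i) (λ j t → unit (W t) j) y)
      (trans (sum-cong-≋ (λ t → *-congʳ (trans (sum-cong-≋ (λ j → *-comm (G i j) (unit (W t) j))) (dot-unit (W t) (G i))))) (relation i)))

    unit-off : ∀ {j t} → ¬ j ≡ W t → unit (W t) j * y t ≈ 0#
    unit-off {j} {t} n with j ≟ᶠ W t
    ... | yes e = contradiction e n
    ... | no _  = zeroˡ _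

    spread-W : ∀ t → spread (W t) ≈ y t
    spread-W t = trans (MC.∑-single (λ t′ → unit (W t′) (W t) * y t′) t (λ t′ t′≢t → unit-off (λ e → t′≢t (W-injective _ _ (≡.sym e))))) at
      where
      module MC = MonoidCount +-commutativeMonoid
      at : unit (W t) (W t) * y t ≈ y t
      at with W t ≟ᶠ W t
      ... | yes _ = *-identityˡ _
      ... | no n  = contradiction ≡.refl n

    spread≉0 : ¬ IsZero y → ¬ IsZero spread
    spread≉0 y≉0 z = y≉0 (λ t → trans (sym (spread-W t)) (z (W t)))

    source : ∀ j → ¬ (spread j ≈ 0#) → ∃ λ t → W t ≡ j × ¬ (y t ≈ 0#)
    source j n with any? (λ t → (W t ≟ᶠ j) ×-dec ¬? (y t ≈? 0#))
    ... | yes p = p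
    ... | no none = contradiction (sum-zero _ term) n
      where
      term : ∀ t → unit (W t) j * y t ≈ 0#
      term t = go (W t ≟ᶠ j) (y t ≈? 0#)
        where
        go : Dec (W t ≡ j) → Dec (y t ≈ 0#) → unit (W t) j * y t ≈ 0#
        go (no ne) _        = unit-off (λ e → ne (≡.sym e))
        go (yes e) (yes z)  = trans (*-congˡ z) (zeroʳ _)
        go (yes e) (no ne)  = contradiction (t , e , ne) none

    weight-spread : weight spread ℕ.≤ weight y
    weight-spread = ℕ.≤-trans (ℕ.≤-reflexive (weight≡count spread)) (ℕ.≤-trans (∑-mono-≤ _ (λ j → Σℕ.sum (λ t → ⟨ ¬? (y t ≈? 0#) ⟩ ℕ.* ⟨ W t ≟ᶠ j ⟩)) bound)
      (ℕ.≤-reflexive (≡.trans (Σℕ.∑-comm (λ j t → ⟨ ¬? (y t ≈? 0#) ⟩ ℕ.* ⟨ W t ≟ᶠ j ⟩))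
        (≡.trans (Σℕ.sum-cong-≗ (λ t → ≡.trans (∑-*ˡ ⟨ ¬? (y t ≈? 0#) ⟩ (λ j → ⟨ W t ≟ᶠ j ⟩))
            (≡.trans (≡.cong (⟨ ¬? (y t ≈? 0#) ⟩ ℕ.*_) (count-unique (λ j → W t ≟ᶠ j) (W t) ≡.refl (λ j e → ≡.sym e))) (ℕ.*-identityʳ _)))) (≡.sym (weight≡count y))))))
      where
      bound : ∀ j → ⟨ ¬? (spread j ≈? 0#) ⟩ ℕ.≤ Σℕ.sum (λ t → ⟨ ¬? (y t ≈? 0#) ⟩ ℕ.* ⟨ W t ≟ᶠ j ⟩)
      bound j = go (¬? (spread j ≈? 0#))
        where
        go : (d : Dec (¬ (spread j ≈ 0#))) → ⟨ d ⟩ ℕ.≤ Σℕ.sum (λ t → ⟨ ¬? (y t ≈? 0#) ⟩ ℕ.* ⟨ W t ≟ᶠ j ⟩)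
        go (no _)  = z≤n
        go (yes n) = let t , e , yt≉0 = source j n in
          ℕ.≤-trans (ℕ.≤-reflexive (≡.sym (≡.cong₂ ℕ._*_ (⟨⟩-yes (¬? (y t ≈? 0#)) yt≉0) (⟨⟩-yes (W t ≟ᶠ j) e)))) (≤-∑ (λ t → ⟨ ¬? (y t ≈? 0#) ⟩ ℕ.* ⟨ W t ≟ᶠ j ⟩) t)

  module TwoWords {m r : ℕ} (A : Fin m → Vector r) (two : TwoSolutions A) where
    open TwoSolutions two

    -- The q + 1 points of the projective line spanned by `x₁` and `x₂`.
    word : Fin (suc q) → Vector r
    word zero    t = x₂ t
    word (suc i) t = x₁ t + enum i * x₂ t

    word-sol : ∀ i l → dot (A l) (word i) ≈ 0#
    word-sol zero    l = x₂-sol l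
    word-sol (suc i) l = begin
      sum (λ t → A l t * (x₁ t + enum i * x₂ t))            ≈⟨ sum-cong-≋ (λ t → solve 4 (λ a x e y → a :* (x :+ e :* y) := a :* x :+ e :* (a :* y)) refl (A l t) (x₁ t) (enum i) (x₂ t)) ⟩
      sum (λ t → A l t * x₁ t + enum i * (A l t * x₂ t))    ≈⟨ ∑-distrib-+ (λ t → A l t * x₁ t) (λ t → enum i * (A l t * x₂ t)) ⟩
      dot (A l) x₁ + sum (λ t → enum i * (A l t * x₂ t))    ≈⟨ +-cong (x₁-sol l) (trans (sym (*-distribˡ-sum (enum i) (λ t → A l t * x₂ t))) (trans (*-congˡ (x₂-sol l)) (zeroʳ _))) ⟩
      0# + 0#                                               ≈⟨ +-identityˡ _ ⟩
      0#                                                    ∎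

    word≉0 : ∀ i → ¬ IsZero (word i)
    word≉0 zero    = x₂≉0
    word≉0 (suc i) z = x₁-piv (trans (sym (trans (+-congˡ (trans (*-congˡ x₂-piv) (zeroʳ _))) (+-identityʳ _))) (z pivot₁))

    vanishing : ∀ t → ∃ λ i → word i t ≈ 0#
    vanishing t with x₂ t ≈? 0#
    ... | yes e = zero , e
    ... | no n with inverse (x₂ t) n
    ...   | v , xv≈1 = suc (index (- x₁ t * v)) , (begin
      x₁ t + enum (index (- x₁ t * v)) * x₂ t    ≈⟨ +-congˡ (*-congʳ (enum-index _)) ⟩
      x₁ t + (- x₁ t * v) * x₂ t                 ≈⟨ solve 3 (λ x v y → x :+ (:- x :* v) :* y := x :- x :* (y :* v)) refl (x₁ t) v (x₂ t) ⟩
      x₁ t - x₁ t * (x₂ t * v)                   ≈⟨ +-congˡ (-‿cong (trans (*-congˡ xv≈1) (*-identityʳ _))) ⟩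
      x₁ t - x₁ t                                ≈⟨ -‿inverseʳ _ ⟩
      0#                                         ∎)

    abstract
      -- By `vanishing` each of the r positions is zero in some word, so the q + 1 words have at
      -- least r zeros together.
      manyZeros : ∀ s → suc q ℕ.* s ℕ.< r → ∃ λ i → s ℕ.< zeroCount (word i)
      manyZeros s lt with any? (λ i → s ℕ.<? zeroCount (word i))
      ... | yes p = p
      ... | no none = contradiction lt (ℕ.≤⇒≯ (ℕ.≤-trans (ℕ.≤-trans (ℕ.≤-reflexive (≡.sym (ℕ.*-identityʳ r)))
          (∑-≥-const (λ t → count (λ i → word i t ≈? 0#)) 1 (λ t → let i , e = vanishing t in count-≥1 (λ i → word i t ≈? 0#) i e)))
          (ℕ.≤-trans (ℕ.≤-reflexive (Σℕ.∑-comm (λ t i → ⟨ word i t ≈? 0# ⟩))) (∑-≤-const (λ i → zeroCount (word i)) s (λ i → ℕ.≮⇒≥ (λ p → none (i , p)))))))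

  lightDualWord : ∀ {k n s} (G : Matrix k n) (x : Vector k) → ¬ IsZero x → suc k ℕ.≤ zeroCount (encode G x) → suc q ℕ.* s ℕ.< suc k →
                  ∃ λ y → DualCode G y × ¬ IsZero y × weight y ℕ.+ s ℕ.≤ k
  lightDualWord {zero}  G x x≉0 = contradiction (λ ()) x≉0
  lightDualWord {suc k} {n} {s} G x x≉0 enough large =
    spread , spread-dual , spread≉0 (word≉0 i) , ℕ.≤-pred (ℕ.≤-trans (ℕ.≤-reflexive (≡.sym (ℕ.+-suc (weight spread) s)))
      (ℕ.≤-trans (ℕ.+-mono-≤ weight-spread (proj₂ many)) (ℕ.≤-reflexive (≡.trans (ℕ.+-comm (weight (word i)) _) (zeroCount+weight (word i))))))
    where
    zero? : ∀ j → Dec (encode G x j ≈ 0#)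
    zero? j = encode G x j ≈? 0#
    W : Fin (suc (suc k)) → Fin n
    W t = members zero? (Fin.inject≤ t enough)
    W-injective : ∀ i j → W i ≡ W j → i ≡ j
    W-injective i j e = inject≤-injective enough enough i j (members-injective zero? _ _ e)
    pivot : ∃ λ i → ¬ (x i ≈ 0#)
    pivot = nonzeroEntry x x≉0
    o : Fin (suc k)
    o = proj₁ pivot
    A : Fin k → Vector (suc (suc k))
    A i t = G (punchIn o i) (W t)
    open TwoWords A (twoSolutions ℕ.≤-refl A)
    many : ∃ λ i → s ℕ.< zeroCount (word i)
    many = manyZeros s large
    i : Fin (suc q)
    i = proj₁ many
    relation : (y : Vector (suc (suc k))) → (∀ l → dot (A l) y ≈ 0#) → ∀ l → sum (λ t → G l (W t) * y t) ≈ 0#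
    relation y sol l = go (l ≟ᶠ o)
      where
      S : Vector (suc k)
      S l = sum (λ t → G l (W t) * y t)
      off : ∀ l → ¬ l ≡ o → S l ≈ 0#
      off l l≢o = ≡.subst (λ l → S l ≈ 0#) (punchIn-punchOut (l≢o ∘ ≡.sym)) (sol (punchOut (l≢o ∘ ≡.sym)))
      zeroColumn : ∀ t → sum (λ l → x l * G l (W t)) ≈ 0#
      zeroColumn t = trans (reflexive (≡.sym (sumF≡sum (λ l → x l * G l (W t))))) (members-∈ zero? (Fin.inject≤ t enough))
      go : Dec (l ≡ o) → S l ≈ 0#
      go (no l≢o) = off l l≢o
      go (yes l≡o) = ≡.subst (λ l → S l ≈ 0#) (≡.sym l≡o) (lastTerm x S o (proj₂ pivot) (λ l l≢o → trans (*-congˡ (off l l≢o)) (zeroʳ _))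
        (trans (∑-swap x (λ l t → G l (W t)) y) (sum-zero (λ t → sum (λ l → x l * G l (W t)) * y t) (λ t → trans (*-congʳ (zeroColumn t)) (zeroˡ (y t))))))
    open Spread G W W-injective (word i) (relation (word i) (word-sol i))

-- The minimum distance of the dual code

open import Data.Nat using (_+_; _*_; _∸_; _<_; _≤_)

mainTheorem2 : ∀ {c ℓ : Level} (F : CommutativeRing c ℓ) (q : ℕ) (FF : IsFiniteField F q)
    (n k s : ℕ) (G : Codes.Matrix F FF k n) →
    Codes.IsProjectiveSystem F FF G →
    Codes.AsMDS F FF G s →
    1 < s → s + 1 < q →
    ¬ (IsPowerOf2 (s + 1) × IsPowerOf2 q) →
    (s ∸ 1) * (q + 1) < k + 1 →
    s * (q + 1) + k < n + 3 →
    Codes.DualAsMDS F FF G s × Codes.NsMDS F FF G s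
mainTheorem2 F q FF n k s G (rows , _) asMDS@(d , ((v , (x , v≈) , v≉0 , wt-v) , min) , defect) 1<s s+1<q ¬2 large long =
  dualAsMDS , asMDS , dualAsMDS
  where
  open CommutativeRing F using (_≈_; sym; trans; reflexive; refl; zeroˡ; *-congʳ)
  open FiniteField F FF using (_≈?_)
  open Codes F FF hiding (_≈?_)
  open LinearAlgebra F FF
  open ShortDualWord F FF
  open LightDualWord F FF
  n+1≡ : suc n ≡ k + s + d
  n+1≡ = ≡.trans (ℕ.+-comm 1 n) (≡.trans defect (≡.trans (ℕ.+-assoc k d s) (≡.trans (≡.cong (k ℕ.+_) (ℕ.+-comm d s)) (≡.sym (ℕ.+-assoc k s d)))))
  -- A hyperplane holds at most n - d = k + s - 1 columns; the successor avoids the subtraction.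
  zeros≤ : ∀ w → ¬ IsZero w → suc (zeroCount (encode G w)) ≤ k + s
  zeros≤ w w≉0 = ℕ.+-cancelʳ-≤ d _ _ (ℕ.≤-trans (ℕ.+-monoʳ-≤ (suc (zeroCount (encode G w))) (min (encode G w) (w , λ _ → refl) (w≉0 ∘ rows w)))
    (ℕ.≤-reflexive (≡.trans (≡.cong suc (zeroCount+weight (encode G w))) n+1≡)))
  s+1≡ : s + 1 ≡ suc s
  s+1≡ = ℕ.+-comm s 1
  heavy : ∀ y → DualCode G y → ¬ IsZero y → k < weight y + s
  heavy y dual y≉0 = ℕ.≰⇒> (noShortDualWord G 1<s (≡.subst (_< q) s+1≡ s+1<q) (≡.subst (λ m → ¬ (IsPowerOf2 m × IsPowerOf2 q)) s+1≡ ¬2) zeros≤ y dual long y≉0)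
  x≉0 : ¬ IsZero x
  x≉0 x≈0 = v≉0 (λ j → trans (v≈ j) (trans (reflexive (sumF≡sum (λ i → x i *ᶠ G i j))) (sum-zero (λ i → x i *ᶠ G i j) (λ i → trans (*-congʳ (x≈0 i)) (zeroˡ _)))))
    where open CommutativeRing F using () renaming (_*_ to _*ᶠ_)
  zeroCount-x : suc (zeroCount (encode G x)) ≡ k + s
  zeroCount-x = ℕ.+-cancelʳ-≡ d _ _ (≡.trans (≡.cong suc (≡.trans (≡.cong₂ _+_ same (≡.sym wt-v)) (zeroCount+weight v))) n+1≡)
    where
    same : zeroCount (encode G x) ≡ zeroCount v
    same = count-cong (λ j → encode G x j ≈? _) (λ j → v j ≈? _) (λ j e → trans (v≈ j) e) (λ j e → trans (sym (v≈ j)) e)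
  light : ∃ λ y → DualCode G y × ¬ IsZero y × weight y + (s ∸ 1) ≤ k
  -- The hyperplane of a minimum weight word holds k + s - 1 columns, which is at least k + 1
  -- because s ≥ 2.
  light = lightDualWord G x x≉0 (ℕ.≤-pred (ℕ.≤-trans (ℕ.≤-reflexive (ℕ.+-comm 2 k)) (ℕ.≤-trans (ℕ.+-monoʳ-≤ k 1<s) (ℕ.≤-reflexive (≡.sym zeroCount-x)))))
    (≡.subst₂ _<_ (≡.trans (≡.cong ((s ∸ 1) ℕ.*_) (ℕ.+-comm q 1)) (ℕ.*-comm (s ∸ 1) (suc q))) (ℕ.+-comm k 1) large)
  y : Vector n
  y = proj₁ light
  -- The dual dimension `n ∸ k` is a truncated difference, so k ≤ n has to be known before it can be
  -- cancelled.
  k≤n : k ≤ n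
  k≤n = ℕ.+-cancelˡ-≤ 2 k n (ℕ.≤-trans (ℕ.+-monoˡ-≤ k (ℕ.≤-trans 1<s (ℕ.m≤m*n s (q + 1) {{ℕ.>-nonZero (ℕ.m≤n+m 1 q)}})))
    (ℕ.≤-pred (ℕ.≤-trans long (ℕ.≤-reflexive (ℕ.+-comm n 3)))))
  weight-y : weight y + s ≡ k + 1
  weight-y = ℕ.≤-antisym (ℕ.≤-trans (ℕ.≤-reflexive (≡.trans (≡.cong (weight y ℕ.+_) (≡.sym (ℕ.m∸n+n≡m (ℕ.<⇒≤ 1<s)))) (≡.sym (ℕ.+-assoc (weight y) (s ∸ 1) 1))))
      (ℕ.+-monoˡ-≤ 1 (proj₂ (proj₂ (proj₂ light)))))
    (ℕ.≤-trans (ℕ.≤-reflexive (ℕ.+-comm k 1)) (heavy y (proj₁ (proj₂ light)) (proj₁ (proj₂ (proj₂ light)))))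
  dualAsMDS : DualAsMDS G s
  dualAsMDS = weight y , ((y , proj₁ (proj₂ light) , proj₁ (proj₂ (proj₂ light)) , ≡.refl) ,
      λ y′ dual y′≉0 → ℕ.+-cancelʳ-≤ s _ _ (ℕ.≤-trans (ℕ.≤-reflexive (≡.trans weight-y (ℕ.+-comm k 1))) (heavy y′ dual y′≉0))) ,
    ≡.sym (≡.trans (ℕ.+-assoc (n ∸ k) (weight y) s) (≡.trans (≡.cong (n ∸ k ℕ.+_) weight-y)
      (≡.trans (≡.sym (ℕ.+-assoc (n ∸ k) k 1)) (≡.cong (ℕ._+ 1) (ℕ.m∸n+n≡m k≤n)))))
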